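{- Let $\chi$ be a nonprincipal primitive Dirichlet character whose conductor $f_\chi$ is odd, let $r$ be a positive integer and let $b$ be real with $0\le b<r$. For $\theta>0$ set $$G_{1,\chi}(\theta,b,r)=r\sum_{n=0}^\infty(-1)^n\chi(n)e^{ -(n+b/r)^r\theta}.$$ Then for any nonnegative integer $N$, $$G_{1,\chi}(\theta,b,r)=\frac r2\sum_{n=0}^{N}(-1)^{n}\frac{E_{rn,\bar\chi}\left(\frac br\right)}{n!}\,\theta^n+O(\theta^{N+1})\qquad\text{as }\theta\to0^+.$$
   Context: The principal character $\chi^0$ is the one with conductor $1$, i.e. $\chi^0(m)=1$ for all integers $m$; "nonprincipal" means $\chi\ne\chi^0$. A primitive character $\chi$ modulo $f_\chi$ is regarded as a function on $\mathbb Z$, periodic mod $f_\chi$ and zero on integers not coprime to $f_\chi$; $\bar\chi$ is its complex conjugate. For a primitive character $\chi$ modulo an odd $f_\chi>1$, the generalized Euler polynomials $E_{n,\chi}(x)$ are defined by (note the conjugate) $$\sum_{m=0}^{f_\chi-1}\frac{2(-1)^m\bar\chi(m)\,e^{(m+x)t}}{e^{f_\chi t}+1}=\sum_{n=0}^\infty E_{n,\chi}(x)\frac{t^n}{n!}\qquad(|t|<\pi/f_\chi).$$ Thus $E_{n,\bar\chi}(x)$ is given by the same generating function with $\chi(m)$ in place of $\bar\chi(m)$. The implied constant in $O(\theta^{N+1})$ may depend on $N,\chi,b,r$. -}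

module Defs where

open import Data.Nat.Base as ℕ using (ℕ; zero; suc; _!)
import Data.Nat.Properties as ℕ
open import Data.Nat.Divisibility using (_∣_)
open import Data.Nat.Coprimality using (Coprime)
open import Data.Integer.Base as ℤ using (ℤ; +_)
import Data.Integer.Properties as ℤ
open import Data.Rational.Base as ℚ hiding (NonZero)
open import Data.Rational.Properties
open import Data.Rational.Solver using (module +-*-Solver)
open import Data.Rational.Unnormalised.Base as ℚᵘ using (mkℚᵘ)
import Data.Rational.Unnormalised.Properties as ℚᵘ
open import Data.Product.Base using (_×_; _,_; proj₁; proj₂; ∃-syntax)
open import Data.Sum.Base using (inj₁; inj₂)
open import Relation.Nullary.Negation.Core using (¬_)
open import Relation.Binary.PropositionalEquality.Core
  using (_≡_; _≢_; refl; sym; trans; cong; cong₂; subst)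

------------------------------------------------------------------------
-- Estimates for rational sequences

open +-*-Solver using (solve; _:=_; _:+_; _:*_; _:-_; :-_)
open ≤-Reasoning

0≤+ : ∀ {p q} → 0ℚ ≤ p → 0ℚ ≤ q → 0ℚ ≤ p + q
0≤+ = +-mono-≤

*-mono-≤ : ∀ {p p′ q q′} → 0ℚ ≤ p → 0ℚ ≤ q → p ≤ p′ → q ≤ q′ → p * q ≤ p′ * q′
*-mono-≤ {p} {p′} {q} {q′} 0≤p 0≤q p≤p′ q≤q′ = ≤-trans
  (*-monoʳ-≤-nonNeg q {{nonNegative 0≤q}} p≤p′)
  (*-monoˡ-≤-nonNeg p′ {{nonNegative (≤-trans 0≤p p≤p′)}} q≤q′)

0≤* : ∀ {p q} → 0ℚ ≤ p → 0ℚ ≤ q → 0ℚ ≤ p * q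
0≤* = *-mono-≤ ≤-refl ≤-refl

0<* : ∀ {p q} → 0ℚ < p → 0ℚ < q → 0ℚ < p * q
0<* {p} {q} 0<p 0<q = positive⁻¹ (p * q) {{pos*pos⇒pos p {{positive 0<p}} q {{positive 0<q}}}}

0<1 : 0ℚ < 1ℚ
0<1 = positive⁻¹ 1ℚ

∣-∣-swap : ∀ p q → ∣ p - q ∣ ≡ ∣ q - p ∣
∣-∣-swap p q = trans (sym (∣-p∣≡∣p∣ (p - q)))
  (cong ∣_∣ (solve 2 (λ p q → :- (p :- q) := q :- p) refl p q))

-- k ↦ 1/(k+1)
harm : ℕ → ℚ
harm k = + 1 / suc k

fromℕℚ : ℕ → ℚ
fromℕℚ n = + n / 1

/-≤ : ∀ a b c d .{{_ : ℕ.NonZero b}} .{{_ : ℕ.NonZero d}} →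
      a ℕ.* d ℕ.≤ c ℕ.* b → + a / b ≤ + c / d
/-≤ a b@(suc b-1) c d@(suc d-1) ad≤cb = toℚᵘ-cancel-≤
  (ℚᵘ.≤-respˡ-≃ (ℚᵘ.≃-sym (toℚᵘ-fromℚᵘ (mkℚᵘ (+ a) b-1)))
  (ℚᵘ.≤-respʳ-≃ (ℚᵘ.≃-sym (toℚᵘ-fromℚᵘ (mkℚᵘ (+ c) d-1)))
  (ℚᵘ.*≤* (subst (ℤ._≤ + c ℤ.* + b) (ℤ.pos-* a d) (subst (+ (a ℕ.* d) ℤ.≤_) (ℤ.pos-* c b) (ℤ.+≤+ ad≤cb))))))

0≤/ : ∀ a b .{{_ : ℕ.NonZero b}} → 0ℚ ≤ + a / b
0≤/ a b = nonNegative⁻¹ (+ a / b) {{normalize-nonNeg a b}}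

fromℕℚ-* : ∀ m n → fromℕℚ (m ℕ.* n) ≡ fromℕℚ m * fromℕℚ n
fromℕℚ-* m n = toℚᵘ-injective (ℚᵘ.≃-trans (toℚᵘ-fromℚᵘ (mkℚᵘ (+ (m ℕ.* n)) 0))
  (ℚᵘ.≃-sym (ℚᵘ.≃-trans (toℚᵘ-homo-* (fromℕℚ m) (fromℕℚ n))
  (ℚᵘ.≃-trans (ℚᵘ.*-cong (toℚᵘ-fromℚᵘ (mkℚᵘ (+ m) 0)) (toℚᵘ-fromℚᵘ (mkℚᵘ (+ n) 0)))
  (ℚᵘ.*≡* (cong (ℤ._* + 1) (sym (ℤ.pos-* m n))))))))

fromℕℚ-*-/ : ∀ a b c .{{_ : ℕ.NonZero c}} → fromℕℚ a * (+ b / c) ≡ + (a ℕ.* b) / c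
fromℕℚ-*-/ a b (suc c) = toℚᵘ-injective (ℚᵘ.≃-trans (toℚᵘ-homo-* (fromℕℚ a) (+ b / suc c))
  (ℚᵘ.≃-trans (ℚᵘ.*-cong (toℚᵘ-fromℚᵘ (mkℚᵘ (+ a) 0)) (toℚᵘ-fromℚᵘ (mkℚᵘ (+ b) c)))
  (ℚᵘ.≃-sym (ℚᵘ.≃-trans (toℚᵘ-fromℚᵘ (mkℚᵘ (+ (a ℕ.* b)) c))
  (ℚᵘ.*≡* (cong₂ ℤ._*_ (ℤ.pos-* a b) (cong (λ n → + suc n) (ℕ.+-identityʳ c))))))))

harm-diff : ∀ k → harm k - harm (suc k) ≡ + 1 / (suc k ℕ.* suc (suc k))
harm-diff k = toℚᵘ-injective (ℚᵘ.≃-trans (toℚᵘ-homo-+ (harm k) (- harm (suc k)))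
  (ℚᵘ.≃-trans (ℚᵘ.+-cong (toℚᵘ-fromℚᵘ (mkℚᵘ (+ 1) k))
    (ℚᵘ.≃-trans (toℚᵘ-homo‿- (harm (suc k))) (ℚᵘ.-‿cong (toℚᵘ-fromℚᵘ (mkℚᵘ (+ 1) (suc k))))))
  (ℚᵘ.≃-trans (ℚᵘ.*≡* lem)
  (ℚᵘ.≃-sym (toℚᵘ-fromℚᵘ (mkℚᵘ (+ 1) (suc k ℕ.+ k ℕ.* suc (suc k))))))))
  where
  num : + 1 ℤ.* + suc (suc k) ℤ.+ (ℤ.- (+ 1)) ℤ.* + suc k ≡ + 1
  num = trans (cong₂ ℤ._+_ (ℤ.*-identityˡ (+ suc (suc k))) (ℤ.-1*i≡-i (+ suc k)))
    (trans (ℤ.m-n≡m⊖n (suc (suc k)) (suc k)) (ℤ.⊖-≥ (ℕ.n≤1+n (suc k)) ∙ cong +_ (ℕ.m+n∸n≡m 1 (suc k))))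
    where
    _∙_ = trans
  lem : (+ 1 ℤ.* + suc (suc k) ℤ.+ (ℤ.- (+ 1)) ℤ.* + suc k) ℤ.* + (suc k ℕ.* suc (suc k))
        ≡ + 1 ℤ.* + (suc k ℕ.* suc (suc k))
  lem = cong (ℤ._* + (suc k ℕ.* suc (suc k))) num

≤-fromℕℚ : ∀ q → ∃[ n ] q ≤ fromℕℚ n
≤-fromℕℚ q@(mkℚ n d _) = ℤ.∣ n ∣ , toℚᵘ-cancel-≤ (ℚᵘ.≤-respʳ-≃
  (ℚᵘ.≃-sym (toℚᵘ-fromℚᵘ (mkℚᵘ (+ ℤ.∣ n ∣) 0)))
  (ℚᵘ.*≤* (ℤ.≤-trans (ℤ.≤-reflexive (ℤ.*-identityʳ n)) (ℤ.≤-trans (i≤∣i∣ n)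
    (ℤ.≤-trans (ℤ.+≤+ (ℕ.m≤m*n ℤ.∣ n ∣ (suc d))) (ℤ.≤-reflexive (ℤ.pos-* ℤ.∣ n ∣ (suc d))))))))
  where
  i≤∣i∣ : ∀ i → i ℤ.≤ + ℤ.∣ i ∣
  i≤∣i∣ (+ n)      = ℤ.≤-refl
  i≤∣i∣ ℤ.-[1+ n ] = ℤ.-≤+

harm-small : ∀ ε → 0ℚ < ε → ∃[ N ] harm N ≤ ε
harm-small ε 0<ε with positive 0<ε
harm-small ε@(mkℚ ℤ.+[1+ a ] d _) 0<ε | _ = d , toℚᵘ-cancel-≤ (ℚᵘ.≤-respˡ-≃
  (ℚᵘ.≃-sym (toℚᵘ-fromℚᵘ (mkℚᵘ (+ 1) d)))
  (ℚᵘ.*≤* (ℤ.*-monoʳ-≤-nonNeg (+ suc d) {+ 1} {+ suc a} (ℤ.+≤+ (ℕ.s≤s ℕ.z≤n)))))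

telescope : ∀ (s : ℕ → ℚ) K → (∀ n → ∣ s (suc n) - s n ∣ ≤ K * (harm n - harm (suc n))) →
            ∀ m d → ∣ s (d ℕ.+ m) - s m ∣ ≤ K * (harm m - harm (d ℕ.+ m))
telescope s K step m zero = begin
  ∣ s m - s m ∣         ≡⟨ cong ∣_∣ (+-inverseʳ (s m)) ⟩
  0ℚ                    ≡⟨ *-zeroʳ K ⟨
  K * 0ℚ                ≡⟨ cong (K *_) (+-inverseʳ (harm m)) ⟨
  K * (harm m - harm m) ∎
telescope s K step m (suc d) = begin
  ∣ s (suc n) - s m ∣
    ≡⟨ cong ∣_∣ (solve 3 (λ a b c → a :- c := (a :- b) :+ (b :- c)) refl (s (suc n)) (s n) (s m)) ⟩
  ∣ (s (suc n) - s n) + (s n - s m) ∣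
    ≤⟨ ∣p+q∣≤∣p∣+∣q∣ (s (suc n) - s n) (s n - s m) ⟩
  ∣ s (suc n) - s n ∣ + ∣ s n - s m ∣
    ≤⟨ +-mono-≤ (step n) (telescope s K step m d) ⟩
  K * (harm n - harm (suc n)) + K * (harm m - harm n)
    ≡⟨ solve 4 (λ K a b c → K :* (a :- b) :+ K :* (c :- a) := K :* (c :- b)) refl
         K (harm n) (harm (suc n)) (harm m) ⟩
  K * (harm m - harm (suc n)) ∎
  where n = d ℕ.+ m

telescope-≤ : ∀ (s : ℕ → ℚ) K → 0ℚ ≤ K → (∀ n → ∣ s (suc n) - s n ∣ ≤ K * (harm n - harm (suc n))) →
              ∀ m n → m ℕ.≤ n → ∣ s n - s m ∣ ≤ K * harm m
telescope-≤ s K 0≤K step m n m≤n = begin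
  ∣ s n - s m ∣           ≤⟨ subst (λ n → ∣ s n - s m ∣ ≤ K * (harm m - harm n)) (ℕ.m∸n+n≡m m≤n)
                               (telescope s K step m (n ℕ.∸ m)) ⟩
  K * (harm m - harm n)   ≤⟨ *-monoˡ-≤-nonNeg K {{nonNegative 0≤K}}
                               (+-monoʳ-≤ (harm m) (neg-antimono-≤ (0≤/ 1 (suc n)))) ⟩
  K * (harm m + 0ℚ)       ≡⟨ cong (K *_) (+-identityʳ (harm m)) ⟩
  K * harm m              ∎

------------------------------------------------------------------------
-- Real numbers as Cauchy sequences of rationals

Cauchy : (ℕ → ℚ) → Set
Cauchy s = ∀ ε → 0ℚ < ε → ∃[ N ] (∀ m n → N ℕ.≤ m → N ℕ.≤ n → ∣ s m - s n ∣ ≤ ε)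

*-small : ∀ K → 0ℚ ≤ K → ∀ ε → 0ℚ < ε → ∃[ δ ] 0ℚ < δ × K * δ ≤ ε
*-small K 0≤K ε 0<ε = δ , 0<δ , (begin
  K * δ                ≤⟨ *-monoʳ-≤-nonNeg δ {{nonNegative (<⇒≤ 0<δ)}} K≤K+1 ⟩
  K+1 * (1/ K+1 * ε)   ≡⟨ *-assoc K+1 (1/ K+1) ε ⟨
  (K+1 * 1/ K+1) * ε   ≡⟨ cong (_* ε) (*-inverseʳ K+1) ⟩
  1ℚ * ε               ≡⟨ *-identityˡ ε ⟩
  ε                    ∎)
  where
  K+1 = K + 1ℚ
  instance
    K+1-pos : Positive K+1
    K+1-pos = nonNeg+pos⇒pos K {{nonNegative 0≤K}} 1ℚ
    K+1-nonZero : ℚ.NonZero K+1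
    K+1-nonZero = pos⇒nonZero K+1
  K≤K+1 : K ≤ K+1
  K≤K+1 = ≤-trans (≤-reflexive (sym (+-identityʳ K))) (+-monoʳ-≤ K (<⇒≤ 0<1))
  δ = 1/ K+1 * ε
  0<δ : 0ℚ < δ
  0<δ = 0<* (positive⁻¹ (1/ K+1) {{1/pos⇒pos K+1}}) 0<ε

cauchy-scale : ∀ s K → 0ℚ ≤ K →
  (∀ ε → 0ℚ < ε → ∃[ N ] (∀ m n → N ℕ.≤ m → N ℕ.≤ n → ∣ s m - s n ∣ ≤ K * ε)) → Cauchy s
cauchy-scale s K 0≤K H ε 0<ε =
  let δ , 0<δ , Kδ≤ε = *-small K 0≤K ε 0<ε
      N , h          = H δ 0<δ
  in N , λ m n N≤m N≤n → ≤-trans (h m n N≤m N≤n) Kδ≤ε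

record ℝ : Set where
  constructor mkℝ
  field
    seq    : ℕ → ℚ
    cauchy : Cauchy seq

open ℝ public

bounded : ∀ x → ∃[ B ] ∃[ N ] (∀ n → N ℕ.≤ n → ∣ seq x n ∣ ≤ B)
bounded x with cauchy x 1ℚ 0<1
... | N , h = 1ℚ + ∣ seq x N ∣ , N , λ n N≤n → begin
  ∣ seq x n ∣
    ≡⟨ cong ∣_∣ (solve 2 (λ a b → a := (a :- b) :+ b) refl (seq x n) (seq x N)) ⟩
  ∣ (seq x n - seq x N) + seq x N ∣     ≤⟨ ∣p+q∣≤∣p∣+∣q∣ (seq x n - seq x N) (seq x N) ⟩
  ∣ seq x n - seq x N ∣ + ∣ seq x N ∣   ≤⟨ +-monoˡ-≤ ∣ seq x N ∣ (h n N N≤n ℕ.≤-refl) ⟩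
  1ℚ + ∣ seq x N ∣                      ∎

infix  4 _≈ᴿ_ _<ᴿ_ _≤ᴿ_
infix  8 -ᴿ_
infixl 7 _*ᴿ_
infixl 6 _+ᴿ_ _-ᴿ_
infixr 9 _^ᴿ_

_≈ᴿ_ : ℝ → ℝ → Set
x ≈ᴿ y = ∀ ε → 0ℚ < ε → ∃[ N ] (∀ n → N ℕ.≤ n → ∣ seq x n - seq y n ∣ ≤ ε)

_≤ᴿ_ : ℝ → ℝ → Set
x ≤ᴿ y = ∀ ε → 0ℚ < ε → ∃[ N ] (∀ n → N ℕ.≤ n → seq x n ≤ seq y n + ε)

_<ᴿ_ : ℝ → ℝ → Set
x <ᴿ y = ∃[ ε ] 0ℚ < ε × ∃[ N ] (∀ n → N ℕ.≤ n → seq x n + ε ≤ seq y n)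

fromℚ : ℚ → ℝ
fromℚ q = mkℝ (λ _ → q) λ ε 0<ε → 0 , λ _ _ _ _ →
  ≤-trans (≤-reflexive (cong ∣_∣ (+-inverseʳ q))) (<⇒≤ 0<ε)

fromℕ : ℕ → ℝ
fromℕ n = fromℚ (fromℕℚ n)

-ᴿ_ : ℝ → ℝ
-ᴿ x = mkℝ (λ n → - seq x n) λ ε 0<ε → let N , h = cauchy x ε 0<ε in
  N , λ m n N≤m N≤n → ≤-trans
    (≤-reflexive (trans (cong ∣_∣ (sym (neg-distrib-+ (seq x m) (- seq x n)))) (∣-p∣≡∣p∣ (seq x m - seq x n))))
    (h m n N≤m N≤n)

cauchy-+ : ∀ x y → Cauchy (λ n → seq x n + seq y n)
cauchy-+ x y = cauchy-scale s (1ℚ + 1ℚ) (0≤+ (<⇒≤ 0<1) (<⇒≤ 0<1)) λ ε 0<ε →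
  let N₁ , h₁ = cauchy x ε 0<ε
      N₂ , h₂ = cauchy y ε 0<ε
  in N₁ ℕ.⊔ N₂ , λ m n N≤m N≤n → begin
    ∣ s m - s n ∣
      ≡⟨ cong ∣_∣ (solve 4 (λ a b c d → (a :+ b) :- (c :+ d) := (a :- c) :+ (b :- d)) refl
           (seq x m) (seq y m) (seq x n) (seq y n)) ⟩
    ∣ (seq x m - seq x n) + (seq y m - seq y n) ∣
      ≤⟨ ∣p+q∣≤∣p∣+∣q∣ (seq x m - seq x n) (seq y m - seq y n) ⟩
    ∣ seq x m - seq x n ∣ + ∣ seq y m - seq y n ∣
      ≤⟨ +-mono-≤ (h₁ m n (ℕ.m⊔n≤o⇒m≤o N₁ N₂ N≤m) (ℕ.m⊔n≤o⇒m≤o N₁ N₂ N≤n))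
                  (h₂ m n (ℕ.m⊔n≤o⇒n≤o N₁ N₂ N≤m) (ℕ.m⊔n≤o⇒n≤o N₁ N₂ N≤n)) ⟩
    ε + ε                ≡⟨ cong₂ _+_ (*-identityˡ ε) (*-identityˡ ε) ⟨
    1ℚ * ε + 1ℚ * ε      ≡⟨ *-distribʳ-+ ε 1ℚ 1ℚ ⟨
    (1ℚ + 1ℚ) * ε        ∎
  where
  s : ℕ → ℚ
  s n = seq x n + seq y n

∣pq-rs∣≤ : ∀ p q r s → ∣ p * q - r * s ∣ ≤ ∣ p ∣ * ∣ q - s ∣ + ∣ p - r ∣ * ∣ s ∣
∣pq-rs∣≤ p q r s = begin
  ∣ p * q - r * s ∣
    ≡⟨ cong ∣_∣ (solve 4 (λ p q r s → p :* q :- r :* s := p :* (q :- s) :+ (p :- r) :* s) refl p q r s) ⟩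
  ∣ p * (q - s) + (p - r) * s ∣           ≤⟨ ∣p+q∣≤∣p∣+∣q∣ (p * (q - s)) ((p - r) * s) ⟩
  ∣ p * (q - s) ∣ + ∣ (p - r) * s ∣       ≡⟨ cong₂ _+_ (∣p*q∣≡∣p∣*∣q∣ p (q - s)) (∣p*q∣≡∣p∣*∣q∣ (p - r) s) ⟩
  ∣ p ∣ * ∣ q - s ∣ + ∣ p - r ∣ * ∣ s ∣   ∎

cauchy-* : ∀ x y → Cauchy (λ n → seq x n * seq y n)
cauchy-* x y =
  let B₁ , M₁ , b₁ = bounded x
      B₂ , M₂ , b₂ = bounded y
      0≤B₁ = ≤-trans (0≤∣p∣ (seq x M₁)) (b₁ M₁ ℕ.≤-refl)
      0≤B₂ = ≤-trans (0≤∣p∣ (seq y M₂)) (b₂ M₂ ℕ.≤-refl)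
  in cauchy-scale s (B₁ + B₂) (0≤+ 0≤B₁ 0≤B₂) λ ε 0<ε →
  let N₁ , h₁ = cauchy x ε 0<ε
      N₂ , h₂ = cauchy y ε 0<ε
      N       = (M₁ ℕ.⊔ M₂) ℕ.⊔ (N₁ ℕ.⊔ N₂)
  in N , λ m n N≤m N≤n →
    let M≤m = ℕ.m⊔n≤o⇒m≤o (M₁ ℕ.⊔ M₂) (N₁ ℕ.⊔ N₂) N≤m
        M≤n = ℕ.m⊔n≤o⇒m≤o (M₁ ℕ.⊔ M₂) (N₁ ℕ.⊔ N₂) N≤n
        L≤m = ℕ.m⊔n≤o⇒n≤o (M₁ ℕ.⊔ M₂) (N₁ ℕ.⊔ N₂) N≤m
        L≤n = ℕ.m⊔n≤o⇒n≤o (M₁ ℕ.⊔ M₂) (N₁ ℕ.⊔ N₂) N≤n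
    in begin
    ∣ s m - s n ∣
      ≤⟨ ∣pq-rs∣≤ (seq x m) (seq y m) (seq x n) (seq y n) ⟩
    ∣ seq x m ∣ * ∣ seq y m - seq y n ∣ + ∣ seq x m - seq x n ∣ * ∣ seq y n ∣
      ≤⟨ +-mono-≤
           (*-mono-≤ (0≤∣p∣ (seq x m)) (0≤∣p∣ (seq y m - seq y n))
              (b₁ m (ℕ.m⊔n≤o⇒m≤o M₁ M₂ M≤m))
              (h₂ m n (ℕ.m⊔n≤o⇒n≤o N₁ N₂ L≤m) (ℕ.m⊔n≤o⇒n≤o N₁ N₂ L≤n)))
           (*-mono-≤ (0≤∣p∣ (seq x m - seq x n)) (0≤∣p∣ (seq y n))
              (h₁ m n (ℕ.m⊔n≤o⇒m≤o N₁ N₂ L≤m) (ℕ.m⊔n≤o⇒m≤o N₁ N₂ L≤n))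
              (b₂ n (ℕ.m⊔n≤o⇒n≤o M₁ M₂ M≤n))) ⟩
    B₁ * ε + ε * B₂
      ≡⟨ solve 3 (λ a b e → a :* e :+ e :* b := (a :+ b) :* e) refl B₁ B₂ ε ⟩
    (B₁ + B₂) * ε ∎
  where
  s : ℕ → ℚ
  s n = seq x n * seq y n

_+ᴿ_ : ℝ → ℝ → ℝ
x +ᴿ y = mkℝ (λ n → seq x n + seq y n) (cauchy-+ x y)

_-ᴿ_ : ℝ → ℝ → ℝ
x -ᴿ y = x +ᴿ (-ᴿ y)

_*ᴿ_ : ℝ → ℝ → ℝ
x *ᴿ y = mkℝ (λ n → seq x n * seq y n) (cauchy-* x y)

_^ᴿ_ : ℝ → ℕ → ℝ
x ^ᴿ zero  = fromℚ 1ℚ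
x ^ᴿ suc n = x *ᴿ x ^ᴿ n

------------------------------------------------------------------------
-- π

Σℚ : ℕ → (ℕ → ℚ) → ℚ
Σℚ zero    a = 0ℚ
Σℚ (suc n) a = Σℚ n a + a n

-- π = 4 (1 - 1/3 + 1/5 - 1/7 + ⋯), with consecutive terms combined:
-- 4/(4k+1) - 4/(4k+3) = 8/((4k+1)(4k+3)).

π-term : ℕ → ℚ
π-term k = + 8 / (suc (4 ℕ.* k) ℕ.* suc (2 ℕ.+ 4 ℕ.* k))

π-term≤ : ∀ k → ∣ π-term k ∣ ≤ fromℕℚ 8 * (harm k - harm (suc k))
π-term≤ k = begin
  ∣ π-term k ∣
    ≡⟨ 0≤p⇒∣p∣≡p (0≤/ 8 (suc (4 ℕ.* k) ℕ.* suc (2 ℕ.+ 4 ℕ.* k))) ⟩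
  π-term k
    ≤⟨ /-≤ 8 (suc (4 ℕ.* k) ℕ.* suc (2 ℕ.+ 4 ℕ.* k)) 8 (suc k ℕ.* suc (suc k))
         (ℕ.*-monoʳ-≤ 8 (ℕ.*-mono-≤ (ℕ.s≤s k≤4k) (ℕ.s≤s (ℕ.≤-trans (ℕ.s≤s k≤4k) (ℕ.n≤1+n _))))) ⟩
  + 8 / (suc k ℕ.* suc (suc k))
    ≡⟨ fromℕℚ-*-/ 8 1 (suc k ℕ.* suc (suc k)) ⟨
  fromℕℚ 8 * (+ 1 / (suc k ℕ.* suc (suc k)))
    ≡⟨ cong (fromℕℚ 8 *_) (harm-diff k) ⟨
  fromℕℚ 8 * (harm k - harm (suc k)) ∎
  where
  k≤4k : k ℕ.≤ 4 ℕ.* k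
  k≤4k = ℕ.m≤n*m k 4

p+q-p≡q : ∀ p q → (p + q) - p ≡ q
p+q-p≡q = solve 2 (λ p q → (p :+ q) :- p := q) refl

π-cauchy : Cauchy (λ n → Σℚ n π-term)
π-cauchy = cauchy-scale s (K + K) (0≤+ 0≤K 0≤K) λ ε 0<ε →
  let N , hN≤ε = harm-small ε 0<ε
      tail : ∀ n → N ℕ.≤ n → ∣ s n - s N ∣ ≤ K * ε
      tail n N≤n = ≤-trans
        (telescope-≤ s K 0≤K (λ n → ≤-trans (≤-reflexive (cong ∣_∣ (p+q-p≡q (s n) (π-term n)))) (π-term≤ n)) N n N≤n)
        (*-monoˡ-≤-nonNeg K {{nonNegative 0≤K}} hN≤ε)
  in N , λ m n N≤m N≤n → begin
    ∣ s m - s n ∣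
      ≡⟨ cong ∣_∣ (solve 3 (λ a b c → a :- b := (a :- c) :- (b :- c)) refl (s m) (s n) (s N)) ⟩
    ∣ (s m - s N) - (s n - s N) ∣       ≤⟨ ∣p-q∣≤∣p∣+∣q∣ (s m - s N) (s n - s N) ⟩
    ∣ s m - s N ∣ + ∣ s n - s N ∣       ≤⟨ +-mono-≤ (tail m N≤m) (tail n N≤n) ⟩
    K * ε + K * ε                       ≡⟨ *-distribʳ-+ ε K K ⟨
    (K + K) * ε                         ∎
  where
  s : ℕ → ℚ
  s n = Σℚ n π-term
  K = fromℕℚ 8
  0≤K : 0ℚ ≤ K
  0≤K = 0≤/ 8 1

π : ℝ
π = mkℝ (λ n → Σℚ n π-term) π-cauchy

------------------------------------------------------------------------
-- Complex numbers

record ℂ : Set where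
  constructor _+i_
  field
    re im : ℝ

open ℂ public

infix  4 _≈ᶜ_ ∣_∣≤_ ∣_∣<_
infixr 7 _·ᶜ_
infixl 7 _*ᶜ_
infixl 6 _+ᶜ_ _-ᶜ_
infixr 9 _^ᶜ_

_≈ᶜ_ : ℂ → ℂ → Set
z ≈ᶜ w = re z ≈ᴿ re w × im z ≈ᴿ im w

ofℝ : ℝ → ℂ
ofℝ x = x +i fromℚ 0ℚ

0ᶜ 1ᶜ : ℂ
0ᶜ = ofℝ (fromℚ 0ℚ)
1ᶜ = ofℝ (fromℚ 1ℚ)

_+ᶜ_ _-ᶜ_ _*ᶜ_ : ℂ → ℂ → ℂ
z +ᶜ w = (re z +ᴿ re w) +i (im z +ᴿ im w)
z -ᶜ w = (re z -ᴿ re w) +i (im z -ᴿ im w)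
z *ᶜ w = (re z *ᴿ re w -ᴿ im z *ᴿ im w) +i (re z *ᴿ im w +ᴿ im z *ᴿ re w)

_·ᶜ_ : ℝ → ℂ → ℂ
x ·ᶜ z = (x *ᴿ re z) +i (x *ᴿ im z)

_^ᶜ_ : ℂ → ℕ → ℂ
z ^ᶜ zero  = 1ᶜ
z ^ᶜ suc n = z *ᶜ z ^ᶜ n

conj : ℂ → ℂ
conj z = re z +i (-ᴿ im z)

∣_∣² : ℂ → ℝ
∣ z ∣² = re z *ᴿ re z +ᴿ im z *ᴿ im z

∣_∣≤_ ∣_∣<_ : ℂ → ℝ → Set
∣ z ∣≤ B = fromℚ 0ℚ ≤ᴿ B × ∣ z ∣² ≤ᴿ B *ᴿ B
∣ z ∣< B = fromℚ 0ℚ <ᴿ B × ∣ z ∣² <ᴿ B *ᴿ B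

Σᶜ : ℕ → (ℕ → ℂ) → ℂ
Σᶜ zero    a = 0ᶜ
Σᶜ (suc n) a = Σᶜ n a +ᶜ a n

HasSum : (ℕ → ℂ) → ℂ → Set
HasSum a s = ∀ ε → 0ℚ < ε → ∃[ N ] (∀ n → N ℕ.≤ n → ∣ Σᶜ n a -ᶜ s ∣≤ fromℚ ε)

------------------------------------------------------------------------
-- The complex exponential function

1/!_ : ℕ → ℚ
1/! n = + 1 / n !
  where instance _ = n ℕ.!≢0

exp-term : ℂ → ℕ → ℂ
exp-term z k = fromℚ (1/! k) ·ᶜ z ^ᶜ k

-- The ℓ¹ norm of the i-th rational approximation to z, and the ℓ¹ distance
-- between the i-th and the j-th one.

norm : ℕ → ℂ → ℚ
norm i z = ∣ seq (re z) i ∣ + ∣ seq (im z) i ∣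

dist : ℕ → ℕ → ℂ → ℚ
dist i j z = ∣ seq (re z) i - seq (re z) j ∣ + ∣ seq (im z) i - seq (im z) j ∣

0≤norm : ∀ i z → 0ℚ ≤ norm i z
0≤norm i z = 0≤+ (0≤∣p∣ (seq (re z) i)) (0≤∣p∣ (seq (im z) i))

0≤dist : ∀ i j z → 0ℚ ≤ dist i j z
0≤dist i j z = 0≤+ (0≤∣p∣ (seq (re z) i - seq (re z) j)) (0≤∣p∣ (seq (im z) i - seq (im z) j))

norm-* : ∀ i z w → norm i (z *ᶜ w) ≤ norm i z * norm i w
norm-* i z w = begin
  ∣ a * c - b * d ∣ + ∣ a * d + b * c ∣
    ≤⟨ +-mono-≤ (∣p-q∣≤∣p∣+∣q∣ (a * c) (b * d)) (∣p+q∣≤∣p∣+∣q∣ (a * d) (b * c)) ⟩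
  (∣ a * c ∣ + ∣ b * d ∣) + (∣ a * d ∣ + ∣ b * c ∣)
    ≡⟨ cong₂ _+_ (cong₂ _+_ (∣p*q∣≡∣p∣*∣q∣ a c) (∣p*q∣≡∣p∣*∣q∣ b d))
                 (cong₂ _+_ (∣p*q∣≡∣p∣*∣q∣ a d) (∣p*q∣≡∣p∣*∣q∣ b c)) ⟩
  (∣ a ∣ * ∣ c ∣ + ∣ b ∣ * ∣ d ∣) + (∣ a ∣ * ∣ d ∣ + ∣ b ∣ * ∣ c ∣)
    ≡⟨ solve 4 (λ a b c d → (a :* c :+ b :* d) :+ (a :* d :+ b :* c) := (a :+ b) :* (c :+ d)) refl
         (∣ a ∣) (∣ b ∣) (∣ c ∣) (∣ d ∣) ⟩
  (∣ a ∣ + ∣ b ∣) * (∣ c ∣ + ∣ d ∣) ∎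
  where
  a = seq (re z) i
  b = seq (im z) i
  c = seq (re w) i
  d = seq (im w) i

dist-* : ∀ i j z w → dist i j (z *ᶜ w) ≤ norm i z * dist i j w + dist i j z * norm j w
dist-* i j z w = begin
  ∣ (a * c - b * d) - (a′ * c′ - b′ * d′) ∣ + ∣ (a * d + b * c) - (a′ * d′ + b′ * c′) ∣
    ≤⟨ +-mono-≤
         (begin
           ∣ (a * c - b * d) - (a′ * c′ - b′ * d′) ∣
             ≡⟨ cong ∣_∣ (solve 4 (λ p q r s → (p :- q) :- (r :- s) := (p :- r) :- (q :- s)) refl
                  (a * c) (b * d) (a′ * c′) (b′ * d′)) ⟩
           ∣ (a * c - a′ * c′) - (b * d - b′ * d′) ∣
             ≤⟨ ∣p-q∣≤∣p∣+∣q∣ (a * c - a′ * c′) (b * d - b′ * d′) ⟩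
           ∣ a * c - a′ * c′ ∣ + ∣ b * d - b′ * d′ ∣
             ≤⟨ +-mono-≤ (∣pq-rs∣≤ a c a′ c′) (∣pq-rs∣≤ b d b′ d′) ⟩
           (A * γ + α * C) + (B * δ + β * D) ∎)
         (begin
           ∣ (a * d + b * c) - (a′ * d′ + b′ * c′) ∣
             ≡⟨ cong ∣_∣ (solve 4 (λ p q r s → (p :+ q) :- (r :+ s) := (p :- r) :+ (q :- s)) refl
                  (a * d) (b * c) (a′ * d′) (b′ * c′)) ⟩
           ∣ (a * d - a′ * d′) + (b * c - b′ * c′) ∣
             ≤⟨ ∣p+q∣≤∣p∣+∣q∣ (a * d - a′ * d′) (b * c - b′ * c′) ⟩
           ∣ a * d - a′ * d′ ∣ + ∣ b * c - b′ * c′ ∣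
             ≤⟨ +-mono-≤ (∣pq-rs∣≤ a d a′ d′) (∣pq-rs∣≤ b c b′ c′) ⟩
           (A * δ + α * D) + (B * γ + β * C) ∎) ⟩
  ((A * γ + α * C) + (B * δ + β * D)) + ((A * δ + α * D) + (B * γ + β * C))
    ≡⟨ solve 8 (λ A B C D α β γ δ →
         ((A :* γ :+ α :* C) :+ (B :* δ :+ β :* D)) :+ ((A :* δ :+ α :* D) :+ (B :* γ :+ β :* C))
         := (A :+ B) :* (γ :+ δ) :+ (α :+ β) :* (C :+ D)) refl A B C D α β γ δ ⟩
  (A + B) * (γ + δ) + (α + β) * (C + D) ∎
  where
  a = seq (re z) i
  b = seq (im z) i
  c = seq (re w) i
  d = seq (im w) i
  a′ = seq (re z) j
  b′ = seq (im z) j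
  c′ = seq (re w) j
  d′ = seq (im w) j
  A = ∣ a ∣
  B = ∣ b ∣
  C = ∣ c′ ∣
  D = ∣ d′ ∣
  α = ∣ a - a′ ∣
  β = ∣ b - b′ ∣
  γ = ∣ c - c′ ∣
  δ = ∣ d - d′ ∣

norm-^ : ∀ i z D → norm i z ≤ fromℕℚ D → ∀ k → norm i (z ^ᶜ k) ≤ fromℕℚ (D ℕ.^ k)
norm-^ i z D z≤D zero    = ≤-refl
norm-^ i z D z≤D (suc k) = begin
  norm i (z *ᶜ z ^ᶜ k)          ≤⟨ norm-* i z (z ^ᶜ k) ⟩
  norm i z * norm i (z ^ᶜ k)    ≤⟨ *-mono-≤ (0≤norm i z) (0≤norm i (z ^ᶜ k)) z≤D (norm-^ i z D z≤D k) ⟩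
  fromℕℚ D * fromℕℚ (D ℕ.^ k)   ≡⟨ fromℕℚ-* D (D ℕ.^ k) ⟨
  fromℕℚ (D ℕ.^ suc k)          ∎

dist-^ : ∀ i j z D → norm i z + 1ℚ ≤ fromℕℚ D → norm j z ≤ fromℕℚ D →
         ∀ k → dist i j (z ^ᶜ k) ≤ dist i j z * fromℕℚ (D ℕ.^ k)
dist-^ i j z D zᵢ≤D zⱼ≤D zero    = 0≤* (0≤dist i j z) (<⇒≤ 0<1)
dist-^ i j z D zᵢ≤D zⱼ≤D (suc k) = begin
  dist i j (z *ᶜ z ^ᶜ k)
    ≤⟨ dist-* i j z (z ^ᶜ k) ⟩
  norm i z * dist i j (z ^ᶜ k) + δ * norm j (z ^ᶜ k)
    ≤⟨ +-mono-≤
         (*-monoˡ-≤-nonNeg (norm i z) {{nonNegative (0≤norm i z)}} (dist-^ i j z D zᵢ≤D zⱼ≤D k))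
         (*-monoˡ-≤-nonNeg δ {{nonNegative (0≤dist i j z)}} (norm-^ j z D zⱼ≤D k)) ⟩
  norm i z * (δ * P) + δ * P
    ≡⟨ cong (λ q → norm i z * (δ * P) + δ * q) (*-identityˡ P) ⟨
  norm i z * (δ * P) + δ * (1ℚ * P)
    ≡⟨ solve 4 (λ n δ P o → n :* (δ :* P) :+ δ :* (o :* P) := δ :* ((n :+ o) :* P)) refl
         (norm i z) δ P 1ℚ ⟩
  δ * ((norm i z + 1ℚ) * P)
    ≤⟨ *-monoˡ-≤-nonNeg δ {{nonNegative (0≤dist i j z)}}
         (*-monoʳ-≤-nonNeg P {{nonNegative (0≤/ (D ℕ.^ k) 1)}} zᵢ≤D) ⟩
  δ * (fromℕℚ D * P)
    ≡⟨ cong (δ *_) (fromℕℚ-* D (D ℕ.^ k)) ⟨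
  δ * fromℕℚ (D ℕ.^ suc k) ∎
  where
  δ = dist i j z
  P = fromℕℚ (D ℕ.^ k)

ℕ-*-swap : ∀ x y z → x ℕ.* (y ℕ.* z) ≡ y ℕ.* (x ℕ.* z)
ℕ-*-swap x y z = trans (sym (ℕ.*-assoc x y z)) (trans (cong (ℕ._* z) (ℕ.*-comm x y)) (ℕ.*-assoc y x z))

^≤! : ∀ a .{{_ : ℕ.NonZero a}} k → a ℕ.^ k ℕ.≤ a ℕ.^ a ℕ.* k !
^≤! a k with ℕ.≤-total k a
... | inj₁ k≤a = ℕ.≤-trans (ℕ.^-monoʳ-≤ a k≤a) (ℕ.m≤m*n (a ℕ.^ a) (k !) {{k ℕ.!≢0}})
^≤! a zero    | inj₂ _   = ℕ.≤-trans (ℕ.m^n>0 a a) (ℕ.≤-reflexive (sym (ℕ.*-identityʳ (a ℕ.^ a))))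
^≤! a (suc k) | inj₂ a≤k = ℕ.≤-trans (ℕ.*-mono-≤ a≤k (^≤! a k)) (ℕ.≤-reflexive (ℕ-*-swap (suc k) (a ℕ.^ a) (k !)))

[1+k][2+k]≤2*3^k : ∀ k → suc k ℕ.* suc (suc k) ℕ.≤ 2 ℕ.* 3 ℕ.^ k
[1+k][2+k]≤2*3^k zero    = ℕ.≤-refl
[1+k][2+k]≤2*3^k (suc k) = ℕ.≤-trans
  (ℕ.≤-trans (ℕ.*-monoʳ-≤ (2 ℕ.+ k) 3+k≤)
    (ℕ.≤-reflexive (swap (2 ℕ.+ k) 3 (1 ℕ.+ k))))
  (ℕ.≤-trans (ℕ.*-monoʳ-≤ 3 ([1+k][2+k]≤2*3^k k)) (ℕ.≤-reflexive (ℕ-*-swap 3 2 (3 ℕ.^ k))))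
  where
  3+k≤ : 3 ℕ.+ k ℕ.≤ 3 ℕ.* (1 ℕ.+ k)
  3+k≤ = ℕ.≤-trans (ℕ.+-monoʳ-≤ 3 (ℕ.m≤n*m k 3)) (ℕ.≤-reflexive (sym (ℕ.*-distribˡ-+ 3 1 k)))
  swap : ∀ x y z → x ℕ.* (y ℕ.* z) ≡ y ℕ.* (z ℕ.* x)
  swap x y z = trans (ℕ.*-comm x (y ℕ.* z)) (ℕ.*-assoc y z x)

exp-const : ℕ → ℕ
exp-const D = 2 ℕ.* (3 ℕ.* D) ℕ.^ (3 ℕ.* D)

exp-bound : ∀ D .{{_ : ℕ.NonZero D}} k →
  1/! k * fromℕℚ (D ℕ.^ k) ≤ fromℕℚ (exp-const D) * (harm k - harm (suc k))
exp-bound D k = begin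
  1/! k * fromℕℚ (D ℕ.^ k)
    ≡⟨ *-comm (1/! k) (fromℕℚ (D ℕ.^ k)) ⟩
  fromℕℚ (D ℕ.^ k) * 1/! k
    ≡⟨ fromℕℚ-*-/ (D ℕ.^ k) 1 (k !) ⟩
  + (D ℕ.^ k ℕ.* 1) / k !
    ≤⟨ /-≤ (D ℕ.^ k ℕ.* 1) (k !) (C ℕ.* 1) (suc k ℕ.* suc (suc k)) bound ⟩
  + (C ℕ.* 1) / (suc k ℕ.* suc (suc k))
    ≡⟨ fromℕℚ-*-/ C 1 (suc k ℕ.* suc (suc k)) ⟨
  fromℕℚ C * (+ 1 / (suc k ℕ.* suc (suc k)))
    ≡⟨ cong (fromℕℚ C *_) (harm-diff k) ⟨
  fromℕℚ C * (harm k - harm (suc k)) ∎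
  where
  instance
    _ = k ℕ.!≢0
    _ = ℕ.m*n≢0 3 D
  C = exp-const D
  ^-distribʳ-* : ∀ k → (3 ℕ.* D) ℕ.^ k ≡ 3 ℕ.^ k ℕ.* D ℕ.^ k
  ^-distribʳ-* zero    = refl
  ^-distribʳ-* (suc k) = trans (cong (3 ℕ.* D ℕ.*_) (^-distribʳ-* k))
    (ℕ.[m*n]*[o*p]≡[m*o]*[n*p] 3 D (3 ℕ.^ k) (D ℕ.^ k))
  bound : D ℕ.^ k ℕ.* 1 ℕ.* (suc k ℕ.* suc (suc k)) ℕ.≤ C ℕ.* 1 ℕ.* k !
  bound rewrite ℕ.*-identityʳ (D ℕ.^ k) | ℕ.*-identityʳ C = ℕ.≤-trans
    (ℕ.*-monoʳ-≤ (D ℕ.^ k) ([1+k][2+k]≤2*3^k k))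
    (ℕ.≤-trans (ℕ.≤-reflexive (trans (ℕ.*-comm (D ℕ.^ k) (2 ℕ.* 3 ℕ.^ k))
      (trans (ℕ.*-assoc 2 (3 ℕ.^ k) (D ℕ.^ k)) (cong (2 ℕ.*_) (sym (^-distribʳ-* k))))))
    (ℕ.≤-trans (ℕ.*-monoʳ-≤ 2 (^≤! (3 ℕ.* D) k))
    (ℕ.≤-reflexive (sym (ℕ.*-assoc 2 ((3 ℕ.* D) ℕ.^ (3 ℕ.* D)) (k !))))))

private
  module ExpComponent
    (c      : ℂ → ℝ)
    (c-0    : ∀ i → seq (c 0ᶜ) i ≡ 0ℚ)
    (c-+    : ∀ z w i → seq (c (z +ᶜ w)) i ≡ seq (c z) i + seq (c w) i)
    (c-·    : ∀ q z i → seq (c (fromℚ q ·ᶜ z)) i ≡ q * seq (c z) i)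
    (c-norm : ∀ i z → ∣ seq (c z) i ∣ ≤ norm i z)
    (c-dist : ∀ i j z → ∣ seq (c z) i - seq (c z) j ∣ ≤ dist i j z)
    (z : ℂ) (D : ℕ) .{{_ : ℕ.NonZero D}}
    where

    s : ℕ → ℕ → ℚ
    s i n = seq (c (Σᶜ n (exp-term z))) i

    t : ℕ → ℕ → ℚ
    t i n = seq (c (z ^ᶜ n)) i

    K : ℚ
    K = fromℕℚ (exp-const D)

    0≤K : 0ℚ ≤ K
    0≤K = 0≤/ (exp-const D) 1

    0≤1/! : ∀ n → 0ℚ ≤ 1/! n
    0≤1/! n = 0≤/ 1 (n !) {{n ℕ.!≢0}}

    s-suc : ∀ i n → s i (suc n) ≡ s i n + 1/! n * t i n
    s-suc i n = trans (c-+ (Σᶜ n (exp-term z)) (exp-term z n) i)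
                      (cong (λ x → s i n + x) (c-· (1/! n) (z ^ᶜ n) i))

    ∣1/!*p∣≤ : ∀ n p δ → 0ℚ ≤ δ → ∣ p ∣ ≤ δ * fromℕℚ (D ℕ.^ n) →
               ∣ 1/! n * p ∣ ≤ (δ * K) * (harm n - harm (suc n))
    ∣1/!*p∣≤ n p δ 0≤δ p≤ = begin
      ∣ 1/! n * p ∣
        ≡⟨ ∣p*q∣≡∣p∣*∣q∣ (1/! n) p ⟩
      ∣ 1/! n ∣ * ∣ p ∣
        ≡⟨ cong (_* ∣ p ∣) (0≤p⇒∣p∣≡p (0≤1/! n)) ⟩
      1/! n * ∣ p ∣
        ≤⟨ *-monoˡ-≤-nonNeg (1/! n) {{nonNegative (0≤1/! n)}} p≤ ⟩
      1/! n * (δ * fromℕℚ (D ℕ.^ n))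
        ≡⟨ solve 3 (λ a b c → a :* (b :* c) := b :* (a :* c)) refl (1/! n) δ (fromℕℚ (D ℕ.^ n)) ⟩
      δ * (1/! n * fromℕℚ (D ℕ.^ n))
        ≤⟨ *-monoˡ-≤-nonNeg δ {{nonNegative 0≤δ}} (exp-bound D n) ⟩
      δ * (K * (harm n - harm (suc n)))
        ≡⟨ *-assoc δ K (harm n - harm (suc n)) ⟨
      (δ * K) * (harm n - harm (suc n)) ∎

    tail : ∀ i → norm i z ≤ fromℕℚ D → ∀ m n → m ℕ.≤ n → ∣ s i n - s i m ∣ ≤ K * harm m
    tail i zᵢ≤D = telescope-≤ (s i) K 0≤K λ n → begin
      ∣ s i (suc n) - s i n ∣               ≡⟨ cong (λ x → ∣ x - s i n ∣) (s-suc i n) ⟩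
      ∣ (s i n + 1/! n * t i n) - s i n ∣   ≡⟨ cong ∣_∣ (p+q-p≡q (s i n) (1/! n * t i n)) ⟩
      ∣ 1/! n * t i n ∣                     ≤⟨ ∣1/!*p∣≤ n (t i n) 1ℚ (<⇒≤ 0<1) (begin
                                                 ∣ t i n ∣                  ≤⟨ c-norm i (z ^ᶜ n) ⟩
                                                 norm i (z ^ᶜ n)            ≤⟨ norm-^ i z D zᵢ≤D n ⟩
                                                 fromℕℚ (D ℕ.^ n)           ≡⟨ *-identityˡ (fromℕℚ (D ℕ.^ n)) ⟨
                                                 1ℚ * fromℕℚ (D ℕ.^ n)      ∎) ⟩
      (1ℚ * K) * (harm n - harm (suc n))    ≡⟨ cong (_* (harm n - harm (suc n))) (*-identityˡ K) ⟩
      K * (harm n - harm (suc n))           ∎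

    continuity : ∀ i j → norm i z + 1ℚ ≤ fromℕℚ D → norm j z ≤ fromℕℚ D →
                 ∀ n → ∣ s i n - s j n ∣ ≤ dist i j z * K
    continuity i j zᵢ≤D zⱼ≤D n = begin
      ∣ u n ∣             ≡⟨ cong ∣_∣ (trans (cong (λ x → u n - x) u0) (+-identityʳ (u n))) ⟨
      ∣ u n - u 0 ∣       ≤⟨ telescope-≤ u (δ * K) (0≤* (0≤dist i j z) 0≤K) step 0 n ℕ.z≤n ⟩
      (δ * K) * harm 0    ≡⟨ *-identityʳ (δ * K) ⟩
      δ * K               ∎
      where
      δ = dist i j z
      u : ℕ → ℚ
      u n = s i n - s j n
      u0 : u 0 ≡ 0ℚ
      u0 = cong₂ _-_ (c-0 i) (c-0 j)
      step : ∀ n → ∣ u (suc n) - u n ∣ ≤ (δ * K) * (harm n - harm (suc n))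
      step n = begin
        ∣ u (suc n) - u n ∣
          ≡⟨ cong₂ (λ x y → ∣ (x - y) - u n ∣) (s-suc i n) (s-suc j n) ⟩
        ∣ ((s i n + 1/! n * t i n) - (s j n + 1/! n * t j n)) - u n ∣
          ≡⟨ cong ∣_∣ (solve 5 (λ a b f x y → ((a :+ f :* x) :- (b :+ f :* y)) :- (a :- b) := f :* (x :- y)) refl
               (s i n) (s j n) (1/! n) (t i n) (t j n)) ⟩
        ∣ 1/! n * (t i n - t j n) ∣
          ≤⟨ ∣1/!*p∣≤ n (t i n - t j n) δ (0≤dist i j z)
               (≤-trans (c-dist i j (z ^ᶜ n)) (dist-^ i j z D zᵢ≤D zⱼ≤D n)) ⟩
        (δ * K) * (harm n - harm (suc n)) ∎

    diagonal : (∃[ M ] ∀ i → M ℕ.≤ i → norm i z + 1ℚ ≤ fromℕℚ D) → Cauchy (λ n → s n n)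
    diagonal (M , hM) = cauchy-scale (λ n → s n n) ((1ℚ + 1ℚ) * (K + K)) 0≤4K λ ε 0<ε →
      let N₁ , h₁ = harm-small ε 0<ε
          N₂ , h₂ = cauchy (re z) ε 0<ε
          N₃ , h₃ = cauchy (im z) ε 0<ε
          N       = (N₁ ℕ.⊔ M) ℕ.⊔ (N₂ ℕ.⊔ N₃)
          N₁≤ : ∀ {n} → N ℕ.≤ n → N₁ ℕ.≤ n
          N₁≤ N≤n = ℕ.m⊔n≤o⇒m≤o N₁ M (ℕ.m⊔n≤o⇒m≤o (N₁ ℕ.⊔ M) (N₂ ℕ.⊔ N₃) N≤n)
          M≤ : ∀ {n} → N ℕ.≤ n → M ℕ.≤ n
          M≤ N≤n = ℕ.m⊔n≤o⇒n≤o N₁ M (ℕ.m⊔n≤o⇒m≤o (N₁ ℕ.⊔ M) (N₂ ℕ.⊔ N₃) N≤n)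
          N₂≤ : ∀ {n} → N ℕ.≤ n → N₂ ℕ.≤ n
          N₂≤ N≤n = ℕ.m⊔n≤o⇒m≤o N₂ N₃ (ℕ.m⊔n≤o⇒n≤o (N₁ ℕ.⊔ M) (N₂ ℕ.⊔ N₃) N≤n)
          N₃≤ : ∀ {n} → N ℕ.≤ n → N₃ ℕ.≤ n
          N₃≤ N≤n = ℕ.m⊔n≤o⇒n≤o N₂ N₃ (ℕ.m⊔n≤o⇒n≤o (N₁ ℕ.⊔ M) (N₂ ℕ.⊔ N₃) N≤n)
          tail′ : ∀ n → N ℕ.≤ n → ∣ s n n - s n N₁ ∣ ≤ K * ε
          tail′ n N≤n = ≤-trans (tail n (norm≤D n (M≤ N≤n)) N₁ n (N₁≤ N≤n))
                                (*-monoˡ-≤-nonNeg K {{nonNegative 0≤K}} h₁)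
      in N , λ m n N≤m N≤n → begin
        ∣ s m m - s n n ∣
          ≡⟨ cong ∣_∣ (solve 4 (λ a b c d → a :- b := ((a :- c) :- (b :- d)) :+ (c :- d)) refl
               (s m m) (s n n) (s m N₁) (s n N₁)) ⟩
        ∣ ((s m m - s m N₁) - (s n n - s n N₁)) + (s m N₁ - s n N₁) ∣
          ≤⟨ ∣p+q∣≤∣p∣+∣q∣ ((s m m - s m N₁) - (s n n - s n N₁)) (s m N₁ - s n N₁) ⟩
        ∣ (s m m - s m N₁) - (s n n - s n N₁) ∣ + ∣ s m N₁ - s n N₁ ∣
          ≤⟨ +-mono-≤ (≤-trans (∣p-q∣≤∣p∣+∣q∣ (s m m - s m N₁) (s n n - s n N₁))
                               (+-mono-≤ (tail′ m N≤m) (tail′ n N≤n)))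
               (≤-trans (continuity m n (hM m (M≤ N≤m)) (norm≤D n (M≤ N≤n)) N₁)
                        (*-monoʳ-≤-nonNeg K {{nonNegative 0≤K}}
                          (+-mono-≤ (h₂ m n (N₂≤ N≤m) (N₂≤ N≤n)) (h₃ m n (N₃≤ N≤m) (N₃≤ N≤n))))) ⟩
        (K * ε + K * ε) + (ε + ε) * K
          ≡⟨ solve 2 (λ K e → (K :* e :+ K :* e) :+ (e :+ e) :* K := (K :+ K) :* e :+ (K :+ K) :* e) refl K ε ⟩
        (K + K) * ε + (K + K) * ε
          ≡⟨ cong₂ _+_ (*-identityˡ ((K + K) * ε)) (*-identityˡ ((K + K) * ε)) ⟨
        1ℚ * ((K + K) * ε) + 1ℚ * ((K + K) * ε)
          ≡⟨ solve 3 (λ o k e → o :* (k :* e) :+ o :* (k :* e) := ((o :+ o) :* k) :* e) refl 1ℚ (K + K) ε ⟩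
        ((1ℚ + 1ℚ) * (K + K)) * ε ∎
      where
      0≤4K : 0ℚ ≤ (1ℚ + 1ℚ) * (K + K)
      0≤4K = 0≤* (0≤+ (<⇒≤ 0<1) (<⇒≤ 0<1)) (0≤+ 0≤K 0≤K)
      norm≤D : ∀ i → M ℕ.≤ i → norm i z ≤ fromℕℚ D
      norm≤D i M≤i = ≤-trans (≤-trans (≤-reflexive (sym (+-identityʳ (norm i z))))
                                      (+-monoʳ-≤ (norm i z) (<⇒≤ 0<1))) (hM i M≤i)

norm-bounded : ∀ z → ∃[ D ] ∃[ M ] (∀ i → M ℕ.≤ i → norm i z + 1ℚ ≤ fromℕℚ (suc D))
norm-bounded z =
  let B₁ , M₁ , b₁ = bounded (re z)
      B₂ , M₂ , b₂ = bounded (im z)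
      D  , B≤D     = ≤-fromℕℚ ((B₁ + B₂) + 1ℚ)
  in D , M₁ ℕ.⊔ M₂ , λ i M≤i → begin
    norm i z + 1ℚ     ≤⟨ +-monoˡ-≤ 1ℚ (+-mono-≤ (b₁ i (ℕ.m⊔n≤o⇒m≤o M₁ M₂ M≤i)) (b₂ i (ℕ.m⊔n≤o⇒n≤o M₁ M₂ M≤i))) ⟩
    (B₁ + B₂) + 1ℚ    ≤⟨ B≤D ⟩
    fromℕℚ D          ≤⟨ /-≤ D 1 (suc D) 1 (ℕ.*-monoˡ-≤ 1 (ℕ.n≤1+n D)) ⟩
    fromℕℚ (suc D)    ∎

exp-re-cauchy : ∀ z → Cauchy (λ n → seq (re (Σᶜ n (exp-term z))) n)
exp-re-cauchy z = ExpComponent.diagonal re (λ _ → refl) (λ _ _ _ → refl) (λ _ _ _ → refl)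
  (λ i z → p≤p+q ∣ seq (re z) i ∣ (0≤∣p∣ (seq (im z) i)))
  (λ i j z → p≤p+q ∣ seq (re z) i - seq (re z) j ∣ (0≤∣p∣ (seq (im z) i - seq (im z) j)))
  z (suc (proj₁ (norm-bounded z))) (proj₂ (norm-bounded z))
  where
  p≤p+q : ∀ p {q} → 0ℚ ≤ q → p ≤ p + q
  p≤p+q p 0≤q = ≤-trans (≤-reflexive (sym (+-identityʳ p))) (+-monoʳ-≤ p 0≤q)

exp-im-cauchy : ∀ z → Cauchy (λ n → seq (im (Σᶜ n (exp-term z))) n)
exp-im-cauchy z = ExpComponent.diagonal im (λ _ → refl) (λ _ _ _ → refl) (λ _ _ _ → refl)
  (λ i z → p≤q+p ∣ seq (im z) i ∣ (0≤∣p∣ (seq (re z) i)))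
  (λ i j z → p≤q+p ∣ seq (im z) i - seq (im z) j ∣ (0≤∣p∣ (seq (re z) i - seq (re z) j)))
  z (suc (proj₁ (norm-bounded z))) (proj₂ (norm-bounded z))
  where
  p≤q+p : ∀ p {q} → 0ℚ ≤ q → p ≤ q + p
  p≤q+p p 0≤q = ≤-trans (≤-reflexive (sym (+-identityˡ p))) (+-monoˡ-≤ p 0≤q)

-- e^z = ∑ zᵏ/k!.  The n-th approximation to e^z is the n-th partial sum
-- evaluated at the n-th approximation to z.

exp : ℂ → ℂ
exp z = mkℝ (λ n → seq (re (Σᶜ n (exp-term z))) n) (exp-re-cauchy z)
     +i mkℝ (λ n → seq (im (Σᶜ n (exp-term z))) n) (exp-im-cauchy z)

------------------------------------------------------------------------
-- Dirichlet characters

-- Nonvanishing at integers coprime to f follows from the four laws, as some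
-- power of such an integer is 1 modulo f.

record IsDirichletCharacter (f : ℕ) (χ : ℤ → ℂ) : Set where
  field
    periodic       : ∀ m → χ (m ℤ.+ + f) ≈ᶜ χ m
    multiplicative : ∀ m n → χ (m ℤ.* n) ≈ᶜ χ m *ᶜ χ n
    unit           : χ (+ 1) ≈ᶜ 1ᶜ
    support        : ∀ m → ¬ Coprime ℤ.∣ m ∣ f → χ m ≈ᶜ 0ᶜ

-- χ mod f is primitive when no character to a proper divisor d of f induces it.

record IsPrimitive (f : ℕ) (χ : ℤ → ℂ) : Set where
  field
    isCharacter : IsDirichletCharacter f χ
    notInduced  : ∀ d → d ∣ f → d ≢ f → ∀ ψ → IsDirichletCharacter d ψ →
                  ¬ (∀ m → Coprime ℤ.∣ m ∣ f → χ m ≈ᶜ ψ m)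

IsPrincipal : (ℤ → ℂ) → Set
IsPrincipal χ = ∀ m → χ m ≈ᶜ 1ᶜ

conjugate : (ℤ → ℂ) → (ℤ → ℂ)
conjugate χ m = conj (χ m)

infix 9 [-1]^_

[-1]^_ : ℕ → ℝ
[-1]^ n = (-ᴿ fromℕ 1) ^ᴿ n

------------------------------------------------------------------------
-- Generalized Euler polynomials

-- E n x is E_{n,χ}(x).  The defining identity is multiplied through by
-- e^{ft} + 1, which has no zero in the disc |t| < π/f; the conjugate of χ
-- appears on the right-hand side by convention.

AreEulerPolynomials : (f : ℕ) .{{_ : ℕ.NonZero f}} → (ℤ → ℂ) → (ℕ → ℂ → ℂ) → Set
AreEulerPolynomials f χ E = ∀ x t → ∣ t ∣< (π *ᴿ fromℚ (+ 1 / f)) →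
  ∃[ s ] HasSum (λ n → E n x *ᶜ (fromℚ (1/! n) ·ᶜ t ^ᶜ n)) s
       × s *ᶜ (exp (fromℕ f ·ᶜ t) +ᶜ 1ᶜ)
         ≈ᶜ Σᶜ f (λ m → (fromℕ 2 *ᴿ [-1]^ m) ·ᶜ (conjugate χ (+ m) *ᶜ exp ((ofℝ (fromℕ m) +ᶜ x) *ᶜ t)))

------------------------------------------------------------------------
-- The series G_{1,χ}(θ,b,r) and its asymptotics

infixl 7 _/ᴿ_

_/ᴿ_ : ℝ → (r : ℕ) .{{_ : ℕ.NonZero r}} → ℝ
b /ᴿ r = b *ᴿ fromℚ (+ 1 / r)

-- Functions of a positive real variable.

ℝ⁺→ℂ : Set
ℝ⁺→ℂ = (θ : ℝ) → fromℚ 0ℚ <ᴿ θ → ℂ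

-- G θ is the sum of the series, whose convergence is part of the assertion.

IsG₁ : (χ : ℤ → ℂ) (b : ℝ) (r : ℕ) .{{_ : ℕ.NonZero r}} → ℝ⁺→ℂ → Set
IsG₁ χ b r G = ∀ θ (0<θ : fromℚ 0ℚ <ᴿ θ) →
  ∃[ s ] HasSum (λ n → [-1]^ n ·ᶜ (χ (+ n) *ᶜ exp (ofℝ (-ᴿ ((fromℕ n +ᴿ b /ᴿ r) ^ᴿ r *ᴿ θ))))) s
       × G θ 0<θ ≈ᶜ fromℕ r ·ᶜ s

-- R(θ) = O(θᵏ) as θ → 0⁺

infix 4 _=O[θ^_]

_=O[θ^_] : ℝ⁺→ℂ → ℕ → Set
R =O[θ^ k ] = ∃[ C ] ∃[ δ ] fromℚ 0ℚ <ᴿ δ ×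
  (∀ θ (0<θ : fromℚ 0ℚ <ᴿ θ) → θ <ᴿ δ → ∣ R θ 0<θ ∣≤ (C *ᴿ θ ^ᴿ k))

{-# OPTIONS --safe #-}
module Submission where

-- The coefficients c(n) = (-1)ⁿ χ(n) satisfy c(n+f) = -c(n), as f is odd.
-- Write Δg(n) = g(n) - g(n+f), and A(g) for the sum of c(n) g(n) over n < f.
-- Then ∑ c(n) g(n) = ½ (A(g) + ∑ c(n) Δg(n)), and after K such steps
--
--   2ᴷ ∑ c(n) g(n) = M(g) + ∑ c(n) Δᴷg(n),
--
-- where M(g) only involves finitely many values of g.  For g(n) = e^((n+x)t)
-- the right-hand sum is O(tᴷ), so that comparing coefficients of powers of t
-- identifies 2ᴷ Eₖ(x) with 2 M((n+x)ᵏ) for k < K.  For g(n) = e^(-θ(n+x)ʳ) and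
-- K = r(N+1) + 2, Taylor's formula on the scale of a single difference gives
-- Δᴷg(n) = O(θᴺ⁺¹ / n²), so the sum is O(θᴺ⁺¹) and the expansion is M applied
-- to the Taylor polynomial of e^(-θ(n+x)ʳ) in θ.  Real and imaginary parts of χ
-- are treated separately.


open import Defs
open import Algebra.Bundles using (CommutativeRing)
open import Algebra.Structures using (IsCommutativeRing)
import Algebra.Properties.CommutativeSemiring.Exp as CSExp
import Algebra.Properties.Semiring.Exp as SExp
import Algebra.Solver.Ring as RingSolver
open import Algebra.Solver.Ring.AlmostCommutativeRing using (fromCommutativeRing; _-Raw-AlmostCommutative⟶_)
open import Data.Integer.Base as ℤ using (ℤ; +_)
import Data.Integer.Properties as ℤ
open import Data.Maybe.Base using (Maybe; just; nothing)
open import Data.Nat.Base as ℕ using (ℕ; zero; suc; _!; z≤n; s≤s)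
import Data.Nat.Properties as ℕ
open import Data.Nat.Induction using (<-rec)
open import Data.Product.Base using (_×_; _,_; proj₁; proj₂; ∃-syntax)
open import Data.Rational.Base as ℚ using (ℚ; 0ℚ; 1ℚ; ½; _/_; positive)
import Data.Rational.Properties as ℚ
import Data.Rational.Solver as ℚS
open import Data.Rational.Unnormalised.Base as ℚᵘ using ()
import Data.Rational.Unnormalised.Properties as ℚᵘ
open import Data.Sum.Base using (_⊎_; inj₁; inj₂)
open import Level using (0ℓ)
open import Relation.Binary.Bundles using (Poset)
import Relation.Binary.Reasoning.PartialOrder
open import Relation.Binary.PropositionalEquality.Core
  using (_≡_; refl; sym; trans; cong; cong₂; subst; subst₂)
open import Relation.Nullary.Decidable.Core using (yes; no)
open import Data.Nat.Base using (NonZero)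
open import Data.Nat.Divisibility using (_∣_; _∤_; divides; ∣m∣n⇒∣m+n)
import Data.Sum.Base as Sum
open import Function.Base using (id)
open import Relation.Nullary.Negation.Core using (¬_; contradiction)

-- Expanding e^(-θ(n+x)ʳ) in θ under the sum fails: in general the series of c(n)(n+x)ᵃ diverges.
-- The functional 2⁻ᴷM is its finite substitute: Δᴷ kills polynomials of degree below K, so on these
-- nothing beyond M remains. For t > 0 the series of c(n)e^((n+x)t) need not converge either, so the
-- comparison with Eₖ goes through a finite identity: shifting by f multiplies this g by e = e^(ft),
-- hence (1+e)M(g) = (2ᴷ - (1-e)ᴷ)A(g), and 1 - e = O(t). The obstacle is to bound Δᴷg(n) uniformly
-- in n as θ → 0, since θ(n+x)ʳ may be small or large. Put B = θ(n+1)ʳ. A difference of exponents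
-- over K steps is O(B/(n+1)); so K such factors, and likewise K differences of a polynomial in the
-- exponents, gain (n+1)⁻ᴷ. What is left is a power of B times a decaying exponential, which absorbs
-- all powers of B beyond the (N+1)-st. As Bᴺ⁺¹ = θᴺ⁺¹(n+1)^(r(N+1)), the 2 in K is what makes the
-- bound summable.

module ℚ-Solver = ℚS.+-*-Solver

-- Inequalities between rational numbers

half+half : ∀ ε → ½ ℚ.* ε ℚ.+ ½ ℚ.* ε ≡ ε
half+half ε = trans (sym (ℚ.*-distribʳ-+ ε ½ ½)) (ℚ.*-identityˡ ε)

0<half : ∀ {ε} → 0ℚ ℚ.< ε → 0ℚ ℚ.< ½ ℚ.* ε
0<half = 0<* (ℚ.positive⁻¹ ½)

p≤∣p∣ : ∀ p → p ℚ.≤ ℚ.∣ p ∣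
p≤∣p∣ p with ℚ.≤-total 0ℚ p
... | inj₁ 0≤p = ℚ.≤-reflexive (sym (ℚ.0≤p⇒∣p∣≡p 0≤p))
... | inj₂ p≤0 = ℚ.≤-trans p≤0 (ℚ.0≤∣p∣ p)

p-q≤r⇒p≤q+r : ∀ p q {r} → p ℚ.- q ℚ.≤ r → p ℚ.≤ q ℚ.+ r
p-q≤r⇒p≤q+r p q {r} h = subst (ℚ._≤ q ℚ.+ r) (solve 2 (λ p q → q :+ (p :- q) := p) refl p q)
  (ℚ.+-monoʳ-≤ q h)
  where open ℚ-Solver

p≤q+r⇒p-q≤r : ∀ p q {r} → p ℚ.≤ q ℚ.+ r → p ℚ.- q ℚ.≤ r
p≤q+r⇒p-q≤r p q {r} h = subst (p ℚ.- q ℚ.≤_) (solve 2 (λ q r → (q :+ r) :- q := r) refl q r)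
  (ℚ.+-monoˡ-≤ (ℚ.- q) h)
  where open ℚ-Solver

∣p-q∣≤r : ∀ p q {r} → p ℚ.≤ q ℚ.+ r → q ℚ.≤ p ℚ.+ r → ℚ.∣ p ℚ.- q ∣ ℚ.≤ r
∣p-q∣≤r p q {r} h₁ h₂ with ℚ.∣p∣≡p∨∣p∣≡-p (p ℚ.- q)
... | inj₁ eq = subst (ℚ._≤ r) (sym eq) (p≤q+r⇒p-q≤r p q h₁)
... | inj₂ eq = subst (ℚ._≤ r) (trans (solve 2 (λ p q → q :- p := :- (p :- q)) refl p q) (sym eq)) (p≤q+r⇒p-q≤r q p h₂)
  where open ℚ-Solver

∣p∣≤∣q∣+∣p-q∣ : ∀ p q → ℚ.∣ p ∣ ℚ.≤ ℚ.∣ q ∣ ℚ.+ ℚ.∣ p ℚ.- q ∣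
∣p∣≤∣q∣+∣p-q∣ p q = subst (λ s → ℚ.∣ s ∣ ℚ.≤ ℚ.∣ q ∣ ℚ.+ ℚ.∣ p ℚ.- q ∣) (solve 2 (λ p q → q :+ (p :- q) := p) refl p q)
  (ℚ.∣p+q∣≤∣p∣+∣q∣ q (p ℚ.- q))
  where open ℚ-Solver

∣∣p∣-∣q∣∣≤∣p-q∣ : ∀ p q → ℚ.∣ ℚ.∣ p ∣ ℚ.- ℚ.∣ q ∣ ∣ ℚ.≤ ℚ.∣ p ℚ.- q ∣
∣∣p∣-∣q∣∣≤∣p-q∣ p q = ∣p-q∣≤r ℚ.∣ p ∣ ℚ.∣ q ∣ (∣p∣≤∣q∣+∣p-q∣ p q)
  (subst (λ s → ℚ.∣ q ∣ ℚ.≤ ℚ.∣ p ∣ ℚ.+ s) (∣-∣-swap q p) (∣p∣≤∣q∣+∣p-q∣ q p))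

p*p≡∣p∣*∣p∣ : ∀ p → p ℚ.* p ≡ ℚ.∣ p ∣ ℚ.* ℚ.∣ p ∣
p*p≡∣p∣*∣p∣ p with ℚ.∣p∣≡p∨∣p∣≡-p p
... | inj₁ eq = sym (cong₂ ℚ._*_ eq eq)
... | inj₂ eq = trans (solve 1 (λ p → p :* p := (:- p) :* (:- p)) refl p) (sym (cong₂ ℚ._*_ eq eq))
  where open ℚ-Solver

positive-lower-bound : ∀ p q → 0ℚ ℚ.< p → 0ℚ ℚ.< q → ∃[ m ] 0ℚ ℚ.< m × m ℚ.≤ p × m ℚ.≤ q
positive-lower-bound p q 0<p 0<q with ℚ.≤-total p q
... | inj₁ p≤q = p , 0<p , ℚ.≤-refl , p≤q
... | inj₂ q≤p = q , 0<q , q≤p , ℚ.≤-refl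

-- The ordered ring of real numbers

-- The operations are made opaque so that unification never unfolds them to
-- Cauchy sequences.

infix  4 _≈_ _≤_
infix  8 -_
infixl 7 _*_
infixl 6 _+_

opaque
  _≈_ _≤_ : ℝ → ℝ → Set
  _≈_ = _≈ᴿ_
  _≤_ = _≤ᴿ_

opaque
  _+_ _*_ : ℝ → ℝ → ℝ
  _+_ = _+ᴿ_
  _*_ = _*ᴿ_

  -_ : ℝ → ℝ
  -_ = -ᴿ_

  ι : ℚ → ℝ
  ι = fromℚ

  ∣_∣ : ℝ → ℝ
  ∣ x ∣ = mkℝ (λ n → ℚ.∣ seq x n ∣) λ ε 0<ε → let N , h = cauchy x ε 0<ε in
    N , λ m n N≤m N≤n → ℚ.≤-trans (∣∣p∣-∣q∣∣≤∣p-q∣ (seq x m) (seq x n)) (h m n N≤m N≤n)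

Eventually : (ℕ → Set) → Set
Eventually P = ∃[ N ] (∀ n → N ℕ.≤ n → P n)

always : ∀ {P} → (∀ n → P n) → Eventually P
always h = 0 , λ n _ → h n

eventually-map : ∀ {P Q} → (∀ n → P n → Q n) → Eventually P → Eventually Q
eventually-map f (N , h) = N , λ n N≤n → f n (h n N≤n)

eventually-map₂ : ∀ {P Q R} → (∀ n → P n → Q n → R n) → Eventually P → Eventually Q → Eventually R
eventually-map₂ f (N , h) (M , k) = N ℕ.⊔ M , λ n le →
  f n (h n (ℕ.m⊔n≤o⇒m≤o N M le)) (k n (ℕ.m⊔n≤o⇒n≤o N M le))

opaque
  unfolding _≈_

  pointwise⇒≈ : ∀ {x y} → (∀ n → seq x n ≡ seq y n) → x ≈ y
  pointwise⇒≈ {x} {y} h ε 0<ε = always λ n → ℚ.≤-trans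
    (ℚ.≤-reflexive (trans (cong (λ p → ℚ.∣ p ℚ.- seq y n ∣) (h n)) (cong ℚ.∣_∣ (ℚ.+-inverseʳ (seq y n)))))
    (ℚ.<⇒≤ 0<ε)

  eventually⇒≤ : ∀ {x y} → Eventually (λ n → seq x n ℚ.≤ seq y n) → x ≤ y
  eventually⇒≤ {x} {y} h ε 0<ε = eventually-map
    (λ n le → ℚ.≤-trans le (ℚ.≤-trans (ℚ.≤-reflexive (sym (ℚ.+-identityʳ (seq y n))))
      (ℚ.+-monoʳ-≤ (seq y n) (ℚ.<⇒≤ 0<ε))))
    h

  pointwise⇒≤ : ∀ {x y} → (∀ n → seq x n ℚ.≤ seq y n) → x ≤ y
  pointwise⇒≤ {x} {y} h = eventually⇒≤ {x} {y} (always h)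

  scaled⇒≈ : ∀ {x y} K → 0ℚ ℚ.≤ K →
             (∀ ε → 0ℚ ℚ.< ε → Eventually (λ n → ℚ.∣ seq x n ℚ.- seq y n ∣ ℚ.≤ K ℚ.* ε)) → x ≈ y
  scaled⇒≈ K 0≤K H ε 0<ε = let δ , 0<δ , Kδ≤ε = *-small K 0≤K ε 0<ε in
    eventually-map (λ n le → ℚ.≤-trans le Kδ≤ε) (H δ 0<δ)

  ≈-sym : ∀ {x y} → x ≈ y → y ≈ x
  ≈-sym {x} {y} h ε 0<ε = eventually-map (λ n → subst (ℚ._≤ ε) (∣-∣-swap (seq x n) (seq y n))) (h ε 0<ε)

  ≈⇒≤ : ∀ {x y} → x ≈ y → x ≤ y
  ≈⇒≤ {x} {y} h ε 0<ε = eventually-map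
    (λ n le → p-q≤r⇒p≤q+r (seq x n) (seq y n) (ℚ.≤-trans (p≤∣p∣ _) le)) (h ε 0<ε)

  ≤-trans : ∀ {x y z} → x ≤ y → y ≤ z → x ≤ z
  ≤-trans {x} {y} {z} h k ε 0<ε = eventually-map₂
    (λ n a b → ℚ.≤-trans a (ℚ.≤-trans (ℚ.+-monoˡ-≤ (½ ℚ.* ε) b)
      (ℚ.≤-reflexive (trans (ℚ.+-assoc (seq z n) (½ ℚ.* ε) (½ ℚ.* ε)) (cong (seq z n ℚ.+_) (half+half ε))))))
    (h (½ ℚ.* ε) (0<half 0<ε)) (k (½ ℚ.* ε) (0<half 0<ε))

  ≤-antisym : ∀ {x y} → x ≤ y → y ≤ x → x ≈ y
  ≤-antisym {x} {y} h k ε 0<ε = eventually-map₂ (λ n → ∣p-q∣≤r (seq x n) (seq y n)) (h ε 0<ε) (k ε 0<ε)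


≈-refl : ∀ {x} → x ≈ x
≈-refl = pointwise⇒≈ λ _ → refl

opaque
  unfolding _≈_ _+_

  +-mono-≤ : ∀ {x y u v} → x ≤ y → u ≤ v → x + u ≤ y + v
  +-mono-≤ {x} {y} {u} {v} h k ε 0<ε = eventually-map₂
    (λ n a b → ℚ.≤-trans (ℚ.+-mono-≤ a b) (ℚ.≤-reflexive (trans
      (solve 3 (λ y v e → (y :+ e) :+ (v :+ e) := (y :+ v) :+ (e :+ e)) refl (seq y n) (seq v n) (½ ℚ.* ε))
      (cong (seq y n ℚ.+ seq v n ℚ.+_) (half+half ε)))))
    (h (½ ℚ.* ε) (0<half 0<ε)) (k (½ ℚ.* ε) (0<half 0<ε))
    where open ℚ-Solver

  -‿antimono-≤ : ∀ {x y} → x ≤ y → - y ≤ - x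
  -‿antimono-≤ {x} {y} h ε 0<ε = eventually-map
    (λ n a → subst₂ ℚ._≤_ (solve 2 (λ x y → x :+ (:- x :- y) := :- y) refl (seq x n) (seq y n))
                          (solve 3 (λ x y e → (y :+ e) :+ (:- x :- y) := :- x :+ e) refl (seq x n) (seq y n) ε)
               (ℚ.+-monoˡ-≤ (ℚ.- seq x n ℚ.- seq y n) a)) (h ε 0<ε)
    where open ℚ-Solver

  archimedean : ∀ {x y} → (∀ ε → 0ℚ ℚ.< ε → x ≤ y + ι ε) → x ≤ y
  archimedean {x} {y} h ε 0<ε = eventually-map
    (λ n a → ℚ.≤-trans a (ℚ.≤-reflexive (trans (ℚ.+-assoc (seq y n) (½ ℚ.* ε) (½ ℚ.* ε))
      (cong (seq y n ℚ.+_) (half+half ε)))))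
    (h (½ ℚ.* ε) (0<half 0<ε) (½ ℚ.* ε) (0<half 0<ε))

  *-cong : ∀ {x y u v} → x ≈ y → u ≈ v → x * u ≈ y * v
  *-cong {x} {y} {u} {v} h k =
    let B₁ , M₁ , b₁ = bounded x
        B₂ , M₂ , b₂ = bounded v
        0≤B₁ = ℚ.≤-trans (ℚ.0≤∣p∣ (seq x M₁)) (b₁ M₁ ℕ.≤-refl)
        0≤B₂ = ℚ.≤-trans (ℚ.0≤∣p∣ (seq v M₂)) (b₂ M₂ ℕ.≤-refl)
    in scaled⇒≈ {x * u} {y * v} (B₁ ℚ.+ B₂) (0≤+ 0≤B₁ 0≤B₂) λ ε 0<ε → eventually-map₂
         (λ { n (a , b) (c , d) → ℚ.≤-trans (∣pq-rs∣≤ (seq x n) (seq u n) (seq y n) (seq v n))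
              (ℚ.≤-trans (ℚ.+-mono-≤ (*-mono-≤ (ℚ.0≤∣p∣ _) (ℚ.0≤∣p∣ _) a d) (*-mono-≤ (ℚ.0≤∣p∣ _) (ℚ.0≤∣p∣ _) c b))
              (ℚ.≤-reflexive (solve 3 (λ a b e → a :* e :+ e :* b := (a :+ b) :* e) refl B₁ B₂ ε))) })
         (eventually-map₂ (λ n a b → a , b) (M₁ , b₁) (M₂ , b₂))
         (eventually-map₂ (λ n a b → a , b) (h ε 0<ε) (k ε 0<ε))
    where open ℚ-Solver

  ∣∣-cong : ∀ {x y} → x ≈ y → ∣ x ∣ ≈ ∣ y ∣
  ∣∣-cong {x} {y} h ε 0<ε = eventually-map (λ n → ℚ.≤-trans (∣∣p∣-∣q∣∣≤∣p-q∣ (seq x n) (seq y n))) (h ε 0<ε)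

  -- A nonnegative real may have negative approximations; only 0 ≤ xₙ + ε/2 is known eventually.
  -- When xₙ is negative, adding this slack twice still bounds -xₙ by xₙ + ε.
  0≤x⇒∣x∣≈x : ∀ {x} → ι 0ℚ ≤ x → ∣ x ∣ ≈ x
  0≤x⇒∣x∣≈x {x} h = ≤-antisym {∣ x ∣} {x} le (pointwise⇒≤ {x} {∣ x ∣} λ n → p≤∣p∣ (seq x n))
    where
    open ℚ-Solver
    le : ∣ x ∣ ≤ x
    le ε 0<ε = eventually-map (λ n a → bound n a (ℚ.∣p∣≡p∨∣p∣≡-p (seq x n))) (h (½ ℚ.* ε) (0<half 0<ε))
      where
      bound : ∀ n → 0ℚ ℚ.≤ seq x n ℚ.+ ½ ℚ.* ε → (ℚ.∣ seq x n ∣ ≡ seq x n) ⊎ (ℚ.∣ seq x n ∣ ≡ ℚ.- seq x n) →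
              ℚ.∣ seq x n ∣ ℚ.≤ seq x n ℚ.+ ε
      bound n a (inj₁ eq) = ℚ.≤-trans (ℚ.≤-reflexive (trans eq (sym (ℚ.+-identityʳ (seq x n)))))
        (ℚ.+-monoʳ-≤ (seq x n) (ℚ.<⇒≤ 0<ε))
      bound n a (inj₂ eq) = subst₂ ℚ._≤_ (trans (ℚ.+-identityʳ (ℚ.- seq x n)) (sym eq))
        (trans (solve 2 (λ x e → :- x :+ ((x :+ e) :+ (x :+ e)) := x :+ (e :+ e)) refl (seq x n) (½ ℚ.* ε))
               (cong (seq x n ℚ.+_) (half+half ε)))
        (ℚ.+-monoʳ-≤ (ℚ.- seq x n) (0≤+ a a))

  upper-bound : ∀ x → ∃[ B ] x ≤ ι B
  upper-bound x = let B , b = bounded x in B , eventually⇒≤ {x} {ι B} (eventually-map (λ n → ℚ.≤-trans (p≤∣p∣ _)) b)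

+-cong : ∀ {x y u v} → x ≈ y → u ≈ v → x + u ≈ y + v
+-cong h k = ≤-antisym (+-mono-≤ (≈⇒≤ h) (≈⇒≤ k)) (+-mono-≤ (≈⇒≤ (≈-sym h)) (≈⇒≤ (≈-sym k)))

-‿cong : ∀ {x y} → x ≈ y → - x ≈ - y
-‿cong h = ≤-antisym (-‿antimono-≤ (≈⇒≤ (≈-sym h))) (-‿antimono-≤ (≈⇒≤ h))

opaque
  unfolding _+_

  0≤∣x∣ : ∀ x → ι 0ℚ ≤ ∣ x ∣
  0≤∣x∣ x = pointwise⇒≤ λ n → ℚ.0≤∣p∣ (seq x n)

  x≤∣x∣ : ∀ x → x ≤ ∣ x ∣
  x≤∣x∣ x = pointwise⇒≤ λ n → p≤∣p∣ (seq x n)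

  ∣x+y∣≤∣x∣+∣y∣ : ∀ x y → ∣ x + y ∣ ≤ ∣ x ∣ + ∣ y ∣
  ∣x+y∣≤∣x∣+∣y∣ x y = pointwise⇒≤ λ n → ℚ.∣p+q∣≤∣p∣+∣q∣ (seq x n) (seq y n)

  ∣x*y∣≈∣x∣*∣y∣ : ∀ x y → ∣ x * y ∣ ≈ ∣ x ∣ * ∣ y ∣
  ∣x*y∣≈∣x∣*∣y∣ x y = pointwise⇒≈ λ n → ℚ.∣p*q∣≡∣p∣*∣q∣ (seq x n) (seq y n)

  ∣-x∣≈∣x∣ : ∀ x → ∣ - x ∣ ≈ ∣ x ∣
  ∣-x∣≈∣x∣ x = pointwise⇒≈ λ n → ℚ.∣-p∣≡∣p∣ (seq x n)

  ι-+ : ∀ p q → ι (p ℚ.+ q) ≈ ι p + ι q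
  ι-+ p q = pointwise⇒≈ λ _ → refl

  ι-* : ∀ p q → ι (p ℚ.* q) ≈ ι p * ι q
  ι-* p q = pointwise⇒≈ λ _ → refl

  ι-neg : ∀ p → ι (ℚ.- p) ≈ - ι p
  ι-neg p = pointwise⇒≈ λ _ → refl

  ι-mono : ∀ {p q} → p ℚ.≤ q → ι p ≤ ι q
  ι-mono h = pointwise⇒≤ λ _ → h

  isCommutativeRing : IsCommutativeRing _≈_ _+_ _*_ -_ (ι 0ℚ) (ι 1ℚ)
  isCommutativeRing = record
    { isRing = record
      { +-isAbelianGroup = record
        { isGroup = record
          { isMonoid = record
            { isSemigroup = record
              { isMagma = record
                { isEquivalence = record
                  { refl = λ {x} → ≈-refl {x}
                  ; sym = λ {x} {y} → ≈-sym {x} {y}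
                  ; trans = λ {x} {y} {z} h k → ≤-antisym {x} {z}
                      (≤-trans {x} {y} {z} (≈⇒≤ {x} {y} h) (≈⇒≤ {y} {z} k))
                      (≤-trans {z} {y} {x} (≈⇒≤ {z} {y} (≈-sym {y} {z} k)) (≈⇒≤ {y} {x} (≈-sym {x} {y} h)))
                  }
                ; ∙-cong = λ {x} {y} {u} {v} → +-cong {x} {y} {u} {v}
                }
              ; assoc = λ x y z → pointwise⇒≈ λ n → ℚ.+-assoc (seq x n) (seq y n) (seq z n)
              }
            ; identity = (λ x → pointwise⇒≈ λ n → ℚ.+-identityˡ (seq x n))
                       , (λ x → pointwise⇒≈ λ n → ℚ.+-identityʳ (seq x n))
            }
          ; inverse = (λ x → pointwise⇒≈ λ n → ℚ.+-inverseˡ (seq x n))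
                    , (λ x → pointwise⇒≈ λ n → ℚ.+-inverseʳ (seq x n))
          ; ⁻¹-cong = λ {x} {y} → -‿cong {x} {y}
          }
        ; comm = λ x y → pointwise⇒≈ λ n → ℚ.+-comm (seq x n) (seq y n)
        }
      ; *-cong = λ {x} {y} {u} {v} → *-cong {x} {y} {u} {v}
      ; *-assoc = λ x y z → pointwise⇒≈ λ n → ℚ.*-assoc (seq x n) (seq y n) (seq z n)
      ; *-identity = (λ x → pointwise⇒≈ λ n → ℚ.*-identityˡ (seq x n))
                   , (λ x → pointwise⇒≈ λ n → ℚ.*-identityʳ (seq x n))
      ; distrib = (λ x y z → pointwise⇒≈ λ n → ℚ.*-distribˡ-+ (seq x n) (seq y n) (seq z n))
                , (λ x y z → pointwise⇒≈ λ n → ℚ.*-distribʳ-+ (seq x n) (seq y n) (seq z n))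
      }
    ; *-comm = λ x y → pointwise⇒≈ λ n → ℚ.*-comm (seq x n) (seq y n)
    }

ℝ-ring : CommutativeRing 0ℓ 0ℓ
ℝ-ring = record { isCommutativeRing = isCommutativeRing }

open IsCommutativeRing isCommutativeRing public
  using (isEquivalence; +-assoc; +-comm; +-identityˡ; +-identityʳ; *-assoc; *-comm; *-identityˡ; *-identityʳ;
         distribˡ; distribʳ; zeroˡ; zeroʳ; -‿inverseˡ; -‿inverseʳ; +-congˡ; +-congʳ; *-congˡ; *-congʳ)
  renaming (trans to ≈-trans)
open CommutativeRing ℝ-ring public using (_-_)
open SExp (CommutativeRing.semiring ℝ-ring) public using (_^_; ^-congˡ; ^-congʳ; ^-homo-*; ^-assocʳ)
open CSExp (CommutativeRing.commutativeSemiring ℝ-ring) public using (^-distrib-*)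

≤-refl : ∀ {x} → x ≤ x
≤-refl = ≈⇒≤ ≈-refl

≤-poset : Poset 0ℓ 0ℓ 0ℓ
≤-poset = record
  { isPartialOrder = record
    { isPreorder = record { isEquivalence = isEquivalence ; reflexive = ≈⇒≤ ; trans = ≤-trans }
    ; antisym = ≤-antisym
    }
  }

module ≤R = Relation.Binary.Reasoning.PartialOrder ≤-poset

-- Makes ℚ the coefficient ring of the solver for ℝ, so that identities containing numerals such as
-- ½ or 2 normalise.
ι-morphism : CommutativeRing.rawRing ℚ.+-*-commutativeRing -Raw-AlmostCommutative⟶ fromCommutativeRing ℝ-ring
ι-morphism = record
  { ⟦_⟧ = ι ; +-homo = ι-+ ; *-homo = ι-* ; -‿homo = ι-neg ; 0-homo = ≈-refl ; 1-homo = ≈-refl }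

_ι≟_ : ∀ p q → Maybe (ι p ≈ ι q)
p ι≟ q with p ℚ.≟ q
... | yes refl = just ≈-refl
... | no _     = nothing

module ℝ-Solver = RingSolver _ _ ι-morphism _ι≟_

-- Partial sums of the exponential series over ℚ

open SExp (CommutativeRing.semiring ℚ.+-*-commutativeRing) public
  using () renaming (_^_ to _^ℚ_; ^-homo-* to ^ℚ-homo-*)
open CSExp (CommutativeRing.commutativeSemiring ℚ.+-*-commutativeRing) public
  using () renaming (^-distrib-* to ^ℚ-distrib-*)

infixl 7 _^/!_

_^/!_ : ℚ → ℕ → ℚ
q ^/! k = 1/! k ℚ.* q ^ℚ k

expₙ : ℕ → ℚ → ℚ
expₙ n q = Σℚ n (q ^/!_)

/-≡ : ∀ a b c d .{{_ : ℕ.NonZero b}} .{{_ : ℕ.NonZero d}} → a ℕ.* d ≡ c ℕ.* b → + a ℚ./ b ≡ + c ℚ./ d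
/-≡ a b c d eq = ℚ.≤-antisym (/-≤ a b c d (ℕ.≤-reflexive eq)) (/-≤ c d a b (ℕ.≤-reflexive (sym eq)))

0≤1/! : ∀ k → 0ℚ ℚ.≤ 1/! k
0≤1/! k = 0≤/ 1 (k !) {{k ℕ.!≢0}}

0≤fromℕℚ : ∀ n → 0ℚ ℚ.≤ fromℕℚ n
0≤fromℕℚ n = 0≤/ n 1

fromℕℚ-mono : ∀ {m n} → m ℕ.≤ n → fromℕℚ m ℚ.≤ fromℕℚ n
fromℕℚ-mono {m} {n} m≤n = /-≤ m 1 n 1 (ℕ.*-monoˡ-≤ 1 m≤n)

fromℕℚ-+ : ∀ m n → fromℕℚ (m ℕ.+ n) ≡ fromℕℚ m ℚ.+ fromℕℚ n
fromℕℚ-+ m n = ℚ.toℚᵘ-injective (ℚᵘ.≃-trans (ℚ.toℚᵘ-fromℚᵘ (ℚᵘ.mkℚᵘ (+ (m ℕ.+ n)) 0))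
  (ℚᵘ.≃-sym (ℚᵘ.≃-trans (ℚ.toℚᵘ-homo-+ (fromℕℚ m) (fromℕℚ n))
  (ℚᵘ.≃-trans (ℚᵘ.+-cong (ℚ.toℚᵘ-fromℚᵘ (ℚᵘ.mkℚᵘ (+ m) 0)) (ℚ.toℚᵘ-fromℚᵘ (ℚᵘ.mkℚᵘ (+ n) 0)))
  (ℚᵘ.*≡* (cong (ℤ._* + 1) (trans (cong₂ ℤ._+_ (ℤ.*-identityʳ (+ m)) (ℤ.*-identityʳ (+ n))) (sym (ℤ.pos-+ m n)))))))))

fromℕℚ-suc : ∀ n → fromℕℚ (suc n) ≡ 1ℚ ℚ.+ fromℕℚ n
fromℕℚ-suc = fromℕℚ-+ 1

fromℕℚ-*-1/! : ∀ k → fromℕℚ (suc k) ℚ.* 1/! suc k ≡ 1/! k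
fromℕℚ-*-1/! k = trans (fromℕℚ-*-/ (suc k) 1 (suc k !))
  (/-≡ (suc k ℕ.* 1) (suc k !) 1 (k !) (trans (cong (ℕ._* k !) (ℕ.*-identityʳ (suc k)))
    (sym (ℕ.*-identityˡ (suc k !)))))
  where
  instance
    _ = k ℕ.!≢0
    _ = suc k ℕ.!≢0

fromℕℚ-*-harm : ∀ k → fromℕℚ (suc k) ℚ.* harm k ≡ 1ℚ
fromℕℚ-*-harm k = trans (fromℕℚ-*-/ (suc k) 1 (suc k))
  (/-≡ (suc k ℕ.* 1) (suc k) 1 1 (ℕ.*-identityʳ _ ∙ ℕ.*-identityʳ _ ∙ sym (ℕ.*-identityˡ (suc k))))
  where
  _∙_ = trans
  infixr 5 _∙_

1/!-antimono : ∀ j k → 1/! (k ℕ.+ j) ℚ.≤ 1/! j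
1/!-antimono j k = /-≤ 1 ((k ℕ.+ j) !) 1 (j !) (ℕ.*-monoʳ-≤ 1 (!-mono k))
  where
  instance
    _ = j ℕ.!≢0
    _ = (k ℕ.+ j) ℕ.!≢0
  !-mono : ∀ k → j ! ℕ.≤ (k ℕ.+ j) !
  !-mono zero    = ℕ.≤-refl
  !-mono (suc k) = ℕ.≤-trans (!-mono k) (ℕ.m≤n*m ((k ℕ.+ j) !) (suc k ℕ.+ j))

[2e]²≡ : ∀ e → (e ℚ.* e ℚ.+ e ℚ.* e) ℚ.+ (e ℚ.* e ℚ.+ e ℚ.* e) ≡ (e ℚ.+ e) ℚ.* (e ℚ.+ e)
[2e]²≡ = solve 1 (λ e → (e :* e :+ e :* e) :+ (e :* e :+ e :* e) := (e :+ e) :* (e :+ e)) refl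
  where open ℚ-Solver

0≤p*p : ∀ p → 0ℚ ℚ.≤ p ℚ.* p
0≤p*p p = subst (0ℚ ℚ.≤_) (sym (p*p≡∣p∣*∣p∣ p)) (0≤* (ℚ.0≤∣p∣ p) (ℚ.0≤∣p∣ p))

p*p≤q*q⇒∣p∣≤q : ∀ p q → 0ℚ ℚ.≤ q → p ℚ.* p ℚ.≤ q ℚ.* q → ℚ.∣ p ∣ ℚ.≤ q
p*p≤q*q⇒∣p∣≤q p q 0≤q h = ℚ.≮⇒≥ λ q<∣p∣ → ℚ.<-irrefl refl (ℚ.<-≤-trans (begin-strict
  q ℚ.* q   ≤⟨ *-mono-≤ 0≤q 0≤q ℚ.≤-refl (ℚ.<⇒≤ q<∣p∣) ⟩
  q ℚ.* ℚ.∣ p ∣          <⟨ ℚ.*-monoˡ-<-pos ℚ.∣ p ∣ {{positive (ℚ.≤-<-trans 0≤q q<∣p∣)}} q<∣p∣ ⟩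
  ℚ.∣ p ∣ ℚ.* ℚ.∣ p ∣    ≡⟨ p*p≡∣p∣*∣p∣ p ⟨
  p ℚ.* p   ∎) h)
  where open ℚ.≤-Reasoning

-- The hypothesis is what `∣ z ∣≤ fromℚ ε` yields when its own slack is taken to be ε². Since 2ε² ≤
-- (2ε)², a component is bounded by 2ε without any square root.
component-bound : ∀ p q ε → 0ℚ ℚ.< ε → p ℚ.* p ℚ.+ q ℚ.* q ℚ.≤ ε ℚ.* ε ℚ.+ ε ℚ.* ε → ℚ.∣ p ∣ ℚ.≤ ε ℚ.+ ε
component-bound p q ε 0<ε h = p*p≤q*q⇒∣p∣≤q p (ε ℚ.+ ε) (0≤+ 0≤ε 0≤ε) (begin
  p ℚ.* p   ≡⟨ ℚ.+-identityʳ _ ⟨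
  p ℚ.* p ℚ.+ 0ℚ   ≤⟨ ℚ.+-monoʳ-≤ (p ℚ.* p) (0≤p*p q) ⟩
  p ℚ.* p ℚ.+ q ℚ.* q   ≤⟨ h ⟩
  ε ℚ.* ε ℚ.+ ε ℚ.* ε   ≡⟨ ℚ.+-identityʳ _ ⟨
  (ε ℚ.* ε ℚ.+ ε ℚ.* ε) ℚ.+ 0ℚ   ≤⟨ ℚ.+-monoʳ-≤ (ε ℚ.* ε ℚ.+ ε ℚ.* ε)
    (0≤+ (0≤p*p ε) (0≤p*p ε)) ⟩
  (ε ℚ.* ε ℚ.+ ε ℚ.* ε) ℚ.+ (ε ℚ.* ε ℚ.+ ε ℚ.* ε)   ≡⟨ [2e]²≡ ε ⟩
  (ε ℚ.+ ε) ℚ.* (ε ℚ.+ ε)   ∎)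
  where
  open ℚ.≤-Reasoning
  0≤ε = ℚ.<⇒≤ 0<ε

harm-difference : ∀ k → harm k ℚ.- harm (suc k) ≡ harm k ℚ.* harm (suc k)
harm-difference k = trans (cong₂ ℚ._-_ (times-1 h (suc (suc k)) h′ (fromℕℚ-*-harm (suc k)))
  (times-1 h′ (suc k) h (fromℕℚ-*-harm k)))
  (trans (cong (λ n → h ℚ.* (n ℚ.* h′) ℚ.- h′ ℚ.* (fromℕℚ (suc k) ℚ.* h)) (fromℕℚ-suc (suc k)))
         (solve 3 (λ h k n → h :* ((con 1ℚ :+ n) :* k) :- k :* (n :* h) := h :* k) refl h h′ (fromℕℚ (suc k))))
  where
  open ℚ-Solver
  h = harm k
  h′ = harm (suc k)
  times-1 : ∀ p n q → fromℕℚ n ℚ.* q ≡ 1ℚ → p ≡ p ℚ.* (fromℕℚ n ℚ.* q)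
  times-1 p n q eq = trans (sym (ℚ.*-identityʳ p)) (cong (p ℚ.*_) (sym eq))

p-q+[q-r]≡p-r : ∀ p q r → (p ℚ.- q) ℚ.+ (q ℚ.- r) ≡ p ℚ.- r
p-q+[q-r]≡p-r = solve 3 (λ p q r → (p :- q) :+ (q :- r) := p :- r) refl
  where open ℚ-Solver

p*0+0*q≡0 : ∀ p q → p ℚ.* 0ℚ ℚ.+ 0ℚ ℚ.* q ≡ 0ℚ
p*0+0*q≡0 = solve 2 (λ p q → p :* con 0ℚ :+ con 0ℚ :* q := con 0ℚ) refl
  where open ℚ-Solver

neg-involutive : ∀ p → ℚ.- (ℚ.- p) ≡ p
neg-involutive = solve 1 (λ p → :- (:- p) := p) refl
  where open ℚ-Solver

p+p≡2*p : ∀ p → p ℚ.+ p ≡ fromℕℚ 2 ℚ.* p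
p+p≡2*p = solve 1 (λ p → p :+ p := con (fromℕℚ 2) :* p) refl
  where open ℚ-Solver

0≤^ℚ : ∀ {p} → 0ℚ ℚ.≤ p → ∀ k → 0ℚ ℚ.≤ p ^ℚ k
0≤^ℚ 0≤p zero    = ℚ.<⇒≤ 0<1
0≤^ℚ 0≤p (suc k) = 0≤* 0≤p (0≤^ℚ 0≤p k)

^ℚ-mono : ∀ {p q} → 0ℚ ℚ.≤ p → p ℚ.≤ q → ∀ k → p ^ℚ k ℚ.≤ q ^ℚ k
^ℚ-mono 0≤p p≤q zero    = ℚ.≤-refl
^ℚ-mono 0≤p p≤q (suc k) = *-mono-≤ 0≤p (0≤^ℚ 0≤p k) p≤q (^ℚ-mono 0≤p p≤q k)

∣^ℚ∣ : ∀ p k → ℚ.∣ p ^ℚ k ∣ ≡ ℚ.∣ p ∣ ^ℚ k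
∣^ℚ∣ p zero    = refl
∣^ℚ∣ p (suc k) = trans (ℚ.∣p*q∣≡∣p∣*∣q∣ p (p ^ℚ k)) (cong (ℚ.∣ p ∣ ℚ.*_) (∣^ℚ∣ p k))

fromℕℚ-^ : ∀ m k → fromℕℚ (m ℕ.^ k) ≡ fromℕℚ m ^ℚ k
fromℕℚ-^ m zero    = refl
fromℕℚ-^ m (suc k) = trans (fromℕℚ-* m (m ℕ.^ k)) (cong (fromℕℚ m ℚ.*_) (fromℕℚ-^ m k))

0≤^/! : ∀ {p} → 0ℚ ℚ.≤ p → ∀ k → 0ℚ ℚ.≤ p ^/! k
0≤^/! 0≤p k = 0≤* (0≤1/! k) (0≤^ℚ 0≤p k)

∣^/!∣ : ∀ p k → ℚ.∣ p ^/! k ∣ ≡ ℚ.∣ p ∣ ^/! k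
∣^/!∣ p k = trans (ℚ.∣p*q∣≡∣p∣*∣q∣ (1/! k) (p ^ℚ k)) (cong₂ ℚ._*_ (ℚ.0≤p⇒∣p∣≡p (0≤1/! k)) (∣^ℚ∣ p k))

^/!-mono : ∀ {p q} → 0ℚ ℚ.≤ p → p ℚ.≤ q → ∀ k → p ^/! k ℚ.≤ q ^/! k
^/!-mono 0≤p p≤q k = *-mono-≤ (0≤1/! k) (0≤^ℚ 0≤p k) ℚ.≤-refl (^ℚ-mono 0≤p p≤q k)

^/!-suc : ∀ p k → fromℕℚ (suc k) ℚ.* (p ^/! suc k) ≡ p ℚ.* (p ^/! k)
^/!-suc p k = trans (solve 4 (λ n f p x → n :* (f :* (p :* x)) := (n :* f) :* (p :* x)) refl (fromℕℚ (suc k))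
  (1/! suc k) p (p ^ℚ k))
  (trans (cong (ℚ._* (p ℚ.* p ^ℚ k)) (fromℕℚ-*-1/! k))
         (solve 3 (λ f p x → f :* (p :* x) := p :* (f :* x)) refl (1/! k) p (p ^ℚ k)))
  where open ℚ-Solver

^/!-+≤ : ∀ {p} → 0ℚ ℚ.≤ p → ∀ K j → p ^/! (K ℕ.+ j) ℚ.≤ p ^ℚ K ℚ.* (p ^/! j)
^/!-+≤ {p} 0≤p K j = begin
  1/! (K ℕ.+ j) ℚ.* p ^ℚ (K ℕ.+ j)     ≤⟨ *-mono-≤ (0≤1/! (K ℕ.+ j)) (0≤^ℚ 0≤p (K ℕ.+ j)) (1/!-antimono j K) ℚ.≤-refl ⟩
  1/! j ℚ.* p ^ℚ (K ℕ.+ j)   ≡⟨ cong (1/! j ℚ.*_) (^ℚ-homo-* p K j) ⟩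
  1/! j ℚ.* (p ^ℚ K ℚ.* p ^ℚ j)        ≡⟨ solve 3 (λ a b c → a :* (b :* c) := b :* (a :* c)) refl (1/! j) (p ^ℚ K)
    (p ^ℚ j) ⟩
  p ^ℚ K ℚ.* (p ^/! j)   ∎
  where
  open ℚ.≤-Reasoning
  open ℚ-Solver

Σℚ-cong : ∀ n {a b} → (∀ k → a k ≡ b k) → Σℚ n a ≡ Σℚ n b
Σℚ-cong zero    h = refl
Σℚ-cong (suc n) h = cong₂ ℚ._+_ (Σℚ-cong n h) (h n)

Σℚ-front : ∀ n a → Σℚ (suc n) a ≡ a 0 ℚ.+ Σℚ n (λ k → a (suc k))
Σℚ-front zero    a = ℚ.+-comm 0ℚ (a 0)
Σℚ-front (suc n) a = trans (cong (ℚ._+ a (suc n)) (Σℚ-front n a))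
  (ℚ.+-assoc (a 0) (Σℚ n (λ k → a (suc k))) (a (suc n)))

Σℚ-nonNeg : ∀ n {a} → (∀ k → 0ℚ ℚ.≤ a k) → 0ℚ ℚ.≤ Σℚ n a
Σℚ-nonNeg zero    h = ℚ.≤-refl
Σℚ-nonNeg (suc n) h = 0≤+ (Σℚ-nonNeg n h) (h n)

Σℚ-mono-length : ∀ m d {a} → (∀ k → 0ℚ ℚ.≤ a k) → Σℚ m a ℚ.≤ Σℚ (d ℕ.+ m) a
Σℚ-mono-length m zero    h = ℚ.≤-refl
Σℚ-mono-length m (suc d) {a} h = ℚ.≤-trans (Σℚ-mono-length m d h)
  (ℚ.≤-trans (ℚ.≤-reflexive (sym (ℚ.+-identityʳ _))) (ℚ.+-monoʳ-≤ (Σℚ (d ℕ.+ m) a) (h (d ℕ.+ m))))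

-- Every term of index K + j contains the factor |p|ᴷ, and 1/(K+j)! ≤ 1/j!, so the tail is at most
-- |p|ᴷ times a partial sum of e^|p|. The factor 1/K! is given away, as only the order in p matters
-- later.
expₙ-taylor : ∀ K n p → K ℕ.≤ n → ℚ.∣ expₙ n p ℚ.- expₙ K p ∣ ℚ.≤ ℚ.∣ p ∣ ^ℚ K ℚ.* expₙ n ℚ.∣ p ∣
expₙ-taylor K n p K≤n = subst (λ n → ℚ.∣ expₙ n p ℚ.- expₙ K p ∣ ℚ.≤ ∣p∣ ^ℚ K ℚ.* expₙ n ∣p∣) (ℕ.m∸n+n≡m K≤n)
  (ℚ.≤-trans (bound (n ℕ.∸ K)) (*-mono-≤ (0≤^ℚ 0≤∣p∣ K) (Σℚ-nonNeg (n ℕ.∸ K) (0≤^/! 0≤∣p∣)) ℚ.≤-refl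
    (subst (λ m → expₙ (n ℕ.∸ K) ∣p∣ ℚ.≤ expₙ m ∣p∣) (ℕ.+-comm K (n ℕ.∸ K))
      (Σℚ-mono-length (n ℕ.∸ K) K (0≤^/! 0≤∣p∣)))))
  where
  open ℚ.≤-Reasoning
  open ℚ-Solver
  ∣p∣ = ℚ.∣ p ∣
  0≤∣p∣ = ℚ.0≤∣p∣ p
  bound : ∀ d → ℚ.∣ expₙ (d ℕ.+ K) p ℚ.- expₙ K p ∣ ℚ.≤ ∣p∣ ^ℚ K ℚ.* expₙ d ∣p∣
  bound zero = ℚ.≤-reflexive (trans (cong ℚ.∣_∣ (ℚ.+-inverseʳ (expₙ K p))) (sym (ℚ.*-zeroʳ (∣p∣ ^ℚ K))))
  bound (suc d) = begin
    ℚ.∣ (s ℚ.+ t) ℚ.- s₀ ∣   ≡⟨ cong ℚ.∣_∣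
      (solve 3 (λ s t z → (s :+ t) :- z := (s :- z) :+ t) refl s t s₀) ⟩
    ℚ.∣ (s ℚ.- s₀) ℚ.+ t ∣   ≤⟨ ℚ.∣p+q∣≤∣p∣+∣q∣ (s ℚ.- s₀) t ⟩
    ℚ.∣ s ℚ.- s₀ ∣ ℚ.+ ℚ.∣ t ∣   ≤⟨ ℚ.+-mono-≤ (bound d) (begin
      ℚ.∣ t ∣   ≡⟨ ∣^/!∣ p (d ℕ.+ K) ⟩
      ∣p∣ ^/! (d ℕ.+ K)   ≡⟨ cong (∣p∣ ^/!_) (ℕ.+-comm d K) ⟩
      ∣p∣ ^/! (K ℕ.+ d)   ≤⟨ ^/!-+≤ 0≤∣p∣ K d ⟩
      ∣p∣ ^ℚ K ℚ.* (∣p∣ ^/! d)   ∎) ⟩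
    ∣p∣ ^ℚ K ℚ.* expₙ d ∣p∣ ℚ.+ ∣p∣ ^ℚ K ℚ.* (∣p∣ ^/! d)  ≡⟨ ℚ.*-distribˡ-+ (∣p∣ ^ℚ K) (expₙ d ∣p∣) (∣p∣ ^/! d) ⟨
    ∣p∣ ^ℚ K ℚ.* expₙ (suc d) ∣p∣   ∎
    where
    s = expₙ (d ℕ.+ K) p
    s₀ = expₙ K p
    t = p ^/! (d ℕ.+ K)

-- Cauchy products: conv a b m = ∑_{i+j=m} aᵢ bⱼ

conv : (ℕ → ℚ) → (ℕ → ℚ) → ℕ → ℚ
conv a b zero    = a 0 ℚ.* b 0
conv a b (suc m) = a 0 ℚ.* b (suc m) ℚ.+ conv (λ k → a (suc k)) b m

conv-cong : ∀ {a a′ b b′} m → (∀ k → a k ≡ a′ k) → (∀ k → b k ≡ b′ k) → conv a b m ≡ conv a′ b′ m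
conv-cong zero    h k = cong₂ ℚ._*_ (h 0) (k 0)
conv-cong (suc m) h k = cong₂ ℚ._+_ (cong₂ ℚ._*_ (h 0) (k (suc m))) (conv-cong m (λ i → h (suc i)) k)

conv-last : ∀ a b m → conv a b (suc m) ≡ conv a (λ k → b (suc k)) m ℚ.+ a (suc m) ℚ.* b 0
conv-last a b zero    = refl
conv-last a b (suc m) = trans (cong (a 0 ℚ.* b (2 ℕ.+ m) ℚ.+_) (conv-last (λ k → a (suc k)) b m))
  (sym (ℚ.+-assoc (a 0 ℚ.* b (2 ℕ.+ m)) (conv (λ k → a (suc k)) (λ k → b (suc k)) m) (a (2 ℕ.+ m) ℚ.* b 0)))

conv-*ˡ : ∀ p a b m → conv (λ k → p ℚ.* a k) b m ≡ p ℚ.* conv a b m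
conv-*ˡ p a b zero    = ℚ.*-assoc p (a 0) (b 0)
conv-*ˡ p a b (suc m) = trans (cong₂ ℚ._+_ (ℚ.*-assoc p (a 0) (b (suc m))) (conv-*ˡ p (λ k → a (suc k)) b m))
  (sym (ℚ.*-distribˡ-+ p (a 0 ℚ.* b (suc m)) (conv (λ k → a (suc k)) b m)))

conv-*ʳ : ∀ p a b m → conv a (λ k → p ℚ.* b k) m ≡ p ℚ.* conv a b m
conv-*ʳ p a b zero    = solve 3 (λ a p b → a :* (p :* b) := p :* (a :* b)) refl (a 0) p (b 0)
  where open ℚ-Solver
conv-*ʳ p a b (suc m) = trans (cong (a 0 ℚ.* (p ℚ.* b (suc m)) ℚ.+_) (conv-*ʳ p (λ k → a (suc k)) b m))
  (solve 4 (λ a p b c → a :* (p :* b) :+ p :* c := p :* (a :* b :+ c)) refl (a 0) p (b (suc m))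
    (conv (λ k → a (suc k)) b m))
  where open ℚ-Solver

-- The offset s makes the Leibniz rule inductive under shifts of a.

conv-leibniz : ∀ s a b m → fromℕℚ (s ℕ.+ m) ℚ.* conv a b m
  ≡ conv (λ k → fromℕℚ (s ℕ.+ k) ℚ.* a k) b m ℚ.+ conv a (λ k → fromℕℚ k ℚ.* b k) m
conv-leibniz s a b zero = solve 3 (λ s a b → s :* (a :* b) := (s :* a) :* b :+ a :* (con 0ℚ :* b)) refl
  (fromℕℚ (s ℕ.+ 0)) (a 0) (b 0)
  where open ℚ-Solver
conv-leibniz s a b (suc m) = begin-equality
  fromℕℚ (s ℕ.+ suc m) ℚ.* (a 0 ℚ.* b (suc m) ℚ.+ C)
    ≡⟨ solve 4 (λ n a b c → n :* (a :* b :+ c) := n :* (a :* b) :+ n :* c) refl (fromℕℚ (s ℕ.+ suc m)) (a 0)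
      (b (suc m)) C ⟩
  fromℕℚ (s ℕ.+ suc m) ℚ.* (a 0 ℚ.* b (suc m)) ℚ.+ fromℕℚ (s ℕ.+ suc m) ℚ.* C
    ≡⟨ cong₂ (λ x y → x ℚ.* (a 0 ℚ.* b (suc m)) ℚ.+ y ℚ.* C)
      (trans (fromℕℚ-+ s (suc m)) (cong (λ s → fromℕℚ s ℚ.+ fromℕℚ (suc m)) (sym (ℕ.+-identityʳ s))))
      (cong fromℕℚ (ℕ.+-suc s m)) ⟩
  (fromℕℚ (s ℕ.+ 0) ℚ.+ fromℕℚ (suc m)) ℚ.* (a 0 ℚ.* b (suc m)) ℚ.+ fromℕℚ (suc s ℕ.+ m) ℚ.* C
    ≡⟨ cong ((fromℕℚ (s ℕ.+ 0) ℚ.+ fromℕℚ (suc m)) ℚ.* (a 0 ℚ.* b (suc m)) ℚ.+_)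
      (trans (conv-leibniz (suc s) (λ k → a (suc k)) b m)
         (cong (ℚ._+ C₂) (conv-cong m (λ k → cong (λ n → fromℕℚ n ℚ.* a (suc k)) (sym (ℕ.+-suc s k))) (λ _ → refl)))) ⟩
  (fromℕℚ (s ℕ.+ 0) ℚ.+ fromℕℚ (suc m)) ℚ.* (a 0 ℚ.* b (suc m)) ℚ.+ (C₁ ℚ.+ C₂)
    ≡⟨ solve 6 (λ x y a b c d → (x :+ y) :* (a :* b) :+ (c :+ d) := ((x :* a) :* b :+ c) :+ (a :* (y :* b) :+ d)) refl
         (fromℕℚ (s ℕ.+ 0)) (fromℕℚ (suc m)) (a 0) (b (suc m)) C₁ C₂ ⟩
  conv (λ k → fromℕℚ (s ℕ.+ k) ℚ.* a k) b (suc m) ℚ.+ conv a (λ k → fromℕℚ k ℚ.* b k) (suc m) ∎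
  where
  open ℚ.≤-Reasoning
  open ℚ-Solver
  C = conv (λ k → a (suc k)) b m
  C₁ = conv (λ k → fromℕℚ (s ℕ.+ suc k) ℚ.* a (suc k)) b m
  C₂ = conv (λ k → a (suc k)) (λ k → fromℕℚ k ℚ.* b k) m

-- The binomial theorem without binomial coefficients: by the Leibniz rule both sides satisfy
-- (m+1)a(m+1) = (p+q)a(m), the recursion for the coefficients of e^((p+q)X).
conv-^/! : ∀ p q m → conv (p ^/!_) (q ^/!_) m ≡ (p ℚ.+ q) ^/! m
conv-^/! p q zero    = refl
conv-^/! p q (suc m) = trans (sym (ℚ.*-identityˡ _)) (trans (cong (ℚ._* conv (p ^/!_) (q ^/!_) (suc m)) (sym (inv m)))
  (trans (ℚ.*-assoc (harm m) (fromℕℚ (suc m)) _) (trans (cong (harm m ℚ.*_) step)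
  (trans (sym (ℚ.*-assoc (harm m) (fromℕℚ (suc m)) ((p ℚ.+ q) ^/! suc m)))
    (trans (cong (ℚ._* ((p ℚ.+ q) ^/! suc m)) (inv m)) (ℚ.*-identityˡ _))))))
  where
  open ℚ.≤-Reasoning
  open ℚ-Solver
  inv : ∀ m → harm m ℚ.* fromℕℚ (suc m) ≡ 1ℚ
  inv m = trans (ℚ.*-comm (harm m) (fromℕℚ (suc m))) (fromℕℚ-*-harm m)
  a = p ^/!_
  b = q ^/!_
  step : fromℕℚ (suc m) ℚ.* conv a b (suc m) ≡ fromℕℚ (suc m) ℚ.* ((p ℚ.+ q) ^/! suc m)
  step = begin-equality
    fromℕℚ (suc m) ℚ.* conv a b (suc m)
      ≡⟨ conv-leibniz 0 a b (suc m) ⟩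
    conv (λ k → fromℕℚ k ℚ.* a k) b (suc m) ℚ.+ conv a (λ k → fromℕℚ k ℚ.* b k) (suc m)
      ≡⟨ cong (conv (λ k → fromℕℚ k ℚ.* a k) b (suc m) ℚ.+_) (conv-last a (λ k → fromℕℚ k ℚ.* b k) m) ⟩
    ((0ℚ ℚ.* a 0) ℚ.* b (suc m) ℚ.+ conv (λ k → fromℕℚ (suc k) ℚ.* a (suc k)) b m)
      ℚ.+ (conv a (λ k → fromℕℚ (suc k) ℚ.* b (suc k)) m ℚ.+ a (suc m) ℚ.* (0ℚ ℚ.* b 0))
      ≡⟨ cong₂ (λ x y → ((0ℚ ℚ.* a 0) ℚ.* b (suc m) ℚ.+ x) ℚ.+ (y ℚ.+ a (suc m) ℚ.* (0ℚ ℚ.* b 0)))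
           (trans (conv-cong m (^/!-suc p) (λ _ → refl)) (conv-*ˡ p a b m))
           (trans (conv-cong m (λ _ → refl) (^/!-suc q)) (conv-*ʳ q a b m)) ⟩
    ((0ℚ ℚ.* a 0) ℚ.* b (suc m) ℚ.+ p ℚ.* conv a b m) ℚ.+ (q ℚ.* conv a b m ℚ.+ a (suc m) ℚ.* (0ℚ ℚ.* b 0))
      ≡⟨ solve 7 (λ a b p c q a′ b′ → ((con 0ℚ :* a) :* b :+ p :* c) :+ (q :* c :+ a′ :* (con 0ℚ :* b′)) :=
        (p :+ q) :* c) refl
           (a 0) (b (suc m)) p (conv a b m) q (a (suc m)) (b 0) ⟩
    (p ℚ.+ q) ℚ.* conv a b m
      ≡⟨ cong ((p ℚ.+ q) ℚ.*_) (conv-^/! p q m) ⟩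
    (p ℚ.+ q) ℚ.* ((p ℚ.+ q) ^/! m)
      ≡⟨ ^/!-suc (p ℚ.+ q) m ⟨
    fromℕℚ (suc m) ℚ.* ((p ℚ.+ q) ^/! suc m) ∎

-- Product of two truncated exponential series

Σ-conv : ∀ a b n → Σℚ (suc n) (conv a b) ≡ a 0 ℚ.* Σℚ (suc n) b ℚ.+ Σℚ n (conv (λ k → a (suc k)) b)
Σ-conv a b zero    = solve 2 (λ a b → con 0ℚ :+ a :* b := a :* (con 0ℚ :+ b) :+ con 0ℚ) refl (a 0) (b 0)
  where open ℚ-Solver
Σ-conv a b (suc n) = trans (cong (ℚ._+ conv a b (suc n)) (Σ-conv a b n))
  (solve 5 (λ a s t b c → (a :* s :+ t) :+ (a :* b :+ c) := a :* (s :+ b) :+ (t :+ c)) refl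
    (a 0) (Σℚ (suc n) b) (Σℚ n (conv (λ k → a (suc k)) b)) (b (suc n)) (conv (λ k → a (suc k)) b n))
  where open ℚ-Solver

-- The ratio is ½ cubed: in `n*n*⅛^n≤harm` two of the factors ½ⁿ absorb n², and the third is at most
-- 1/(n+1).
⅛ : ℚ
⅛ = + 1 ℚ./ 8

0≤⅛^ : ∀ k → 0ℚ ℚ.≤ ⅛ ^ℚ k
0≤⅛^ = 0≤^ℚ (0≤/ 1 8)

⅛^-antimono : ∀ d k → ⅛ ^ℚ (d ℕ.+ k) ℚ.≤ ⅛ ^ℚ k
⅛^-antimono zero    k = ℚ.≤-refl
⅛^-antimono (suc d) k = ℚ.≤-trans (*-mono-≤ (0≤/ 1 8) (0≤⅛^ (d ℕ.+ k)) (/-≤ 1 8 1 1 (ℕ.m≤m+n 1 7)) (⅛^-antimono d k))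
  (ℚ.≤-reflexive (ℚ.*-identityˡ _))

Σ-tail≤ : ∀ B b → 0ℚ ℚ.≤ B → (∀ k → ℚ.∣ b k ∣ ℚ.≤ B ℚ.* ⅛ ^ℚ k) → ∀ m n → m ℕ.≤ n →
          ℚ.∣ Σℚ n b ℚ.- Σℚ m b ∣ ℚ.≤ fromℕℚ n ℚ.* (B ℚ.* ⅛ ^ℚ m)
Σ-tail≤ B b 0≤B b≤ m n m≤n = subst (λ n → ℚ.∣ Σℚ n b ℚ.- Σℚ m b ∣ ℚ.≤ fromℕℚ n ℚ.* (B ℚ.* ⅛ ^ℚ m)) (ℕ.m∸n+n≡m m≤n)
  (ℚ.≤-trans (bound (n ℕ.∸ m)) (*-mono-≤ (0≤fromℕℚ (n ℕ.∸ m)) (0≤* 0≤B (0≤⅛^ m))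
    (fromℕℚ-mono (ℕ.m≤m+n (n ℕ.∸ m) m)) ℚ.≤-refl))
  where
  open ℚ.≤-Reasoning
  open ℚ-Solver
  bound : ∀ d → ℚ.∣ Σℚ (d ℕ.+ m) b ℚ.- Σℚ m b ∣ ℚ.≤ fromℕℚ d ℚ.* (B ℚ.* ⅛ ^ℚ m)
  bound zero = ℚ.≤-reflexive (trans (cong ℚ.∣_∣ (ℚ.+-inverseʳ (Σℚ m b))) (sym (ℚ.*-zeroˡ (B ℚ.* ⅛ ^ℚ m))))
  bound (suc d) = begin
    ℚ.∣ (s ℚ.+ t) ℚ.- s₀ ∣   ≡⟨ cong ℚ.∣_∣ (solve 3 (λ s t z → (s :+ t) :- z := t :+ (s :- z)) refl s t s₀) ⟩
    ℚ.∣ t ℚ.+ (s ℚ.- s₀) ∣   ≤⟨ ℚ.∣p+q∣≤∣p∣+∣q∣ t (s ℚ.- s₀) ⟩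
    ℚ.∣ t ∣ ℚ.+ ℚ.∣ s ℚ.- s₀ ∣      ≤⟨ ℚ.+-mono-≤
      (ℚ.≤-trans (b≤ (d ℕ.+ m)) (*-mono-≤ 0≤B (0≤⅛^ (d ℕ.+ m)) ℚ.≤-refl (⅛^-antimono d m))) (bound d) ⟩
    B′ ℚ.+ fromℕℚ d ℚ.* B′   ≡⟨ solve 2 (λ b d → b :+ d :* b := (con 1ℚ :+ d) :* b) refl B′ (fromℕℚ d) ⟩
    (1ℚ ℚ.+ fromℕℚ d) ℚ.* B′        ≡⟨ cong (ℚ._* B′) (fromℕℚ-suc d) ⟨
    fromℕℚ (suc d) ℚ.* B′   ∎
    where
    s = Σℚ (d ℕ.+ m) b
    s₀ = Σℚ m b
    t = b (d ℕ.+ m)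
    B′ = B ℚ.* ⅛ ^ℚ m

-- Square minus triangle, row by row: row j misses the tail of b from index m - j on, and this tail
-- times a(j) is of order ⅛ᵐ for every j. Removing the first row shifts a, which is why A is a
-- parameter that gets multiplied by ⅛ while n stays fixed.
Σ*Σ-Σconv≤ : ∀ A B a b n → 0ℚ ℚ.≤ A → 0ℚ ℚ.≤ B → (∀ k → ℚ.∣ a k ∣ ℚ.≤ A ℚ.* ⅛ ^ℚ k) →
  (∀ k → ℚ.∣ b k ∣ ℚ.≤ B ℚ.* ⅛ ^ℚ k) →
  ∀ m → m ℕ.≤ n → ℚ.∣ Σℚ m a ℚ.* Σℚ n b ℚ.- Σℚ m (conv a b) ∣ ℚ.≤ fromℕℚ m ℚ.* (fromℕℚ n ℚ.* ((A ℚ.* B) ℚ.* ⅛ ^ℚ m))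
Σ*Σ-Σconv≤ A B a b n 0≤A 0≤B a≤ b≤ zero m≤n = ℚ.≤-reflexive
  (trans (cong ℚ.∣_∣ (solve 1 (λ s → con 0ℚ :* s :- con 0ℚ := con 0ℚ) refl (Σℚ n b)))
    (sym (ℚ.*-zeroˡ (fromℕℚ n ℚ.* ((A ℚ.* B) ℚ.* 1ℚ)))))
  where open ℚ-Solver
Σ*Σ-Σconv≤ A B a b n 0≤A 0≤B a≤ b≤ (suc m) m≤n = begin
  ℚ.∣ Σℚ (suc m) a ℚ.* S ℚ.- Σℚ (suc m) (conv a b) ∣
    ≡⟨ cong₂ (λ x y → ℚ.∣ x ℚ.* S ℚ.- y ∣) (Σℚ-front m a) (Σ-conv a b m) ⟩
  ℚ.∣ (a 0 ℚ.+ s) ℚ.* S ℚ.- (a 0 ℚ.* S′ ℚ.+ T) ∣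
    ≡⟨ cong ℚ.∣_∣ (solve 5 (λ a s S S′ T → (a :+ s) :* S :- (a :* S′ :+ T) := a :* (S :- S′) :+ (s :* S :- T)) refl
      (a 0) s S S′ T) ⟩
  ℚ.∣ a 0 ℚ.* (S ℚ.- S′) ℚ.+ (s ℚ.* S ℚ.- T) ∣
    ≤⟨ ℚ.∣p+q∣≤∣p∣+∣q∣ (a 0 ℚ.* (S ℚ.- S′)) (s ℚ.* S ℚ.- T) ⟩
  ℚ.∣ a 0 ℚ.* (S ℚ.- S′) ∣ ℚ.+ ℚ.∣ s ℚ.* S ℚ.- T ∣
    ≤⟨ ℚ.+-mono-≤
         (ℚ.≤-trans (ℚ.≤-reflexive (ℚ.∣p*q∣≡∣p∣*∣q∣ (a 0) (S ℚ.- S′)))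
           (*-mono-≤ (ℚ.0≤∣p∣ (a 0)) (ℚ.0≤∣p∣ (S ℚ.- S′)) (ℚ.≤-trans (a≤ 0) (ℚ.≤-reflexive (ℚ.*-identityʳ A)))
             (Σ-tail≤ B b 0≤B b≤ (suc m) n m≤n)))
         (Σ*Σ-Σconv≤ (A ℚ.* ⅛) B (λ k → a (suc k)) b n (0≤* 0≤A (0≤/ 1 8)) 0≤B
           (λ k → ℚ.≤-trans (a≤ (suc k)) (ℚ.≤-reflexive (sym (ℚ.*-assoc A ⅛ (⅛ ^ℚ k))))) b≤ m
             (ℕ.≤-trans (ℕ.n≤1+n m) m≤n)) ⟩
  A ℚ.* (fromℕℚ n ℚ.* (B ℚ.* (⅛ ℚ.* ⅛ ^ℚ m))) ℚ.+ fromℕℚ m ℚ.* (fromℕℚ n ℚ.* (((A ℚ.* ⅛) ℚ.* B) ℚ.* ⅛ ^ℚ m))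
    ≡⟨ solve 6 (λ A n B e x m → A :* (n :* (B :* (e :* x))) :+ m :* (n :* (((A :* e) :* B) :* x)) :=
      (con 1ℚ :+ m) :* (n :* ((A :* B) :* (e :* x)))) refl
         A (fromℕℚ n) B ⅛ (⅛ ^ℚ m) (fromℕℚ m) ⟩
  (1ℚ ℚ.+ fromℕℚ m) ℚ.* (fromℕℚ n ℚ.* ((A ℚ.* B) ℚ.* ⅛ ^ℚ suc m))
    ≡⟨ cong (ℚ._* (fromℕℚ n ℚ.* ((A ℚ.* B) ℚ.* ⅛ ^ℚ suc m))) (fromℕℚ-suc m) ⟨
  fromℕℚ (suc m) ℚ.* (fromℕℚ n ℚ.* ((A ℚ.* B) ℚ.* ⅛ ^ℚ suc m)) ∎
  where
  open ℚ.≤-Reasoning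
  open ℚ-Solver
  S = Σℚ n b
  S′ = Σℚ (suc m) b
  s = Σℚ m (λ k → a (suc k))
  T = Σℚ m (conv (λ k → a (suc k)) b)

[1+n]½^n≤1 : ∀ n → fromℕℚ (suc n) ℚ.* ½ ^ℚ n ℚ.≤ 1ℚ
[1+n]½^n≤1 zero    = ℚ.≤-refl
[1+n]½^n≤1 (suc n) = begin
  fromℕℚ (2 ℕ.+ n) ℚ.* (½ ℚ.* h)   ≡⟨ cong (ℚ._* (½ ℚ.* h)) (fromℕℚ-suc (suc n)) ⟩
  (1ℚ ℚ.+ fromℕℚ (suc n)) ℚ.* (½ ℚ.* h)        ≡⟨ solve 2
    (λ n h → (con 1ℚ :+ n) :* (con ½ :* h) := con ½ :* (con 1ℚ :* h) :+ con ½ :* (n :* h)) refl (fromℕℚ (suc n)) h ⟩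
  ½ ℚ.* (1ℚ ℚ.* h) ℚ.+ ½ ℚ.* (fromℕℚ (suc n) ℚ.* h)
    ≤⟨ ℚ.+-mono-≤ (*-mono-≤ 0≤½ (0≤* (ℚ.<⇒≤ 0<1) 0≤h) ℚ.≤-refl
      (ℚ.≤-trans (*-mono-≤ (ℚ.<⇒≤ 0<1) 0≤h (fromℕℚ-mono (s≤s (z≤n {n}))) ℚ.≤-refl) ([1+n]½^n≤1 n)))
                  (*-mono-≤ 0≤½ (0≤* (0≤fromℕℚ (suc n)) 0≤h) ℚ.≤-refl ([1+n]½^n≤1 n)) ⟩
  1ℚ ∎
  where
  open ℚ.≤-Reasoning
  open ℚ-Solver
  h = ½ ^ℚ n
  0≤½ : 0ℚ ℚ.≤ ½
  0≤½ = 0≤/ 1 2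
  0≤h = 0≤^ℚ 0≤½ n

n*n*⅛^n≤harm : ∀ n → fromℕℚ n ℚ.* (fromℕℚ n ℚ.* ⅛ ^ℚ n) ℚ.≤ harm n
n*n*⅛^n≤harm n = begin
  N ℚ.* (N ℚ.* ⅛ ^ℚ n)   ≡⟨ cong (λ x → N ℚ.* (N ℚ.* x))
    (trans (^ℚ-distrib-* ½ (½ ℚ.* ½) n) (cong (h ℚ.*_) (^ℚ-distrib-* ½ ½ n))) ⟩
  N ℚ.* (N ℚ.* (h ℚ.* (h ℚ.* h)))        ≡⟨ solve 2
    (λ n h → n :* (n :* (h :* (h :* h))) := h :* ((n :* h) :* (n :* h))) refl N h ⟩
  h ℚ.* ((N ℚ.* h) ℚ.* (N ℚ.* h))        ≤⟨ *-mono-≤ 0≤h (0≤* 0≤Nh 0≤Nh) ℚ.≤-refl (*-mono-≤ 0≤Nh 0≤Nh Nh≤1 Nh≤1) ⟩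
  h ℚ.* 1ℚ   ≡⟨ cong (h ℚ.*_) (fromℕℚ-*-harm n) ⟨
  h ℚ.* (fromℕℚ (suc n) ℚ.* harm n)      ≡⟨ solve 3 (λ h n k → h :* (n :* k) := (n :* h) :* k) refl h
    (fromℕℚ (suc n)) (harm n) ⟩
  (fromℕℚ (suc n) ℚ.* h) ℚ.* harm n      ≤⟨ *-mono-≤ (0≤* (0≤fromℕℚ (suc n)) 0≤h) (0≤/ 1 (suc n))
    ([1+n]½^n≤1 n) ℚ.≤-refl ⟩
  1ℚ ℚ.* harm n   ≡⟨ ℚ.*-identityˡ (harm n) ⟩
  harm n   ∎
  where
  open ℚ.≤-Reasoning
  open ℚ-Solver
  N = fromℕℚ n
  h = ½ ^ℚ n
  0≤h = 0≤^ℚ (0≤/ 1 2) n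
  0≤Nh = 0≤* (0≤fromℕℚ n) 0≤h
  Nh≤1 : N ℚ.* h ℚ.≤ 1ℚ
  Nh≤1 = ℚ.≤-trans (*-mono-≤ (0≤fromℕℚ n) 0≤h (fromℕℚ-mono (ℕ.n≤1+n n)) ℚ.≤-refl) ([1+n]½^n≤1 n)

-- `exp-bound` is applied to 8(D+1) in place of D+1; the spare factor 8ᵏ is what turns boundedness
-- into decay like ⅛ᵏ.
^/!-geometric : ∀ D p → ℚ.∣ p ∣ ℚ.≤ fromℕℚ (suc D) → ∀ k →
                ℚ.∣ p ^/! k ∣ ℚ.≤ fromℕℚ (exp-const (8 ℕ.* suc D)) ℚ.* ⅛ ^ℚ k
^/!-geometric D p p≤ k = begin
  ℚ.∣ p ^/! k ∣   ≡⟨ ∣^/!∣ p k ⟩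
  ℚ.∣ p ∣ ^/! k   ≤⟨ ^/!-mono (ℚ.0≤∣p∣ p) p≤ k ⟩
  1/! k ℚ.* d ^ℚ k   ≡⟨ cong (λ x → 1/! k ℚ.* x ^ℚ k)
    (solve 1 (λ d → d := (con (fromℕℚ 8) :* d) :* con ⅛) refl d) ⟩
  1/! k ℚ.* ((fromℕℚ 8 ℚ.* d) ℚ.* ⅛) ^ℚ k    ≡⟨ cong (λ x → 1/! k ℚ.* (x ℚ.* ⅛) ^ℚ k) (fromℕℚ-* 8 (suc D)) ⟨
  1/! k ℚ.* (fromℕℚ D′ ℚ.* ⅛) ^ℚ k   ≡⟨ cong (1/! k ℚ.*_) (^ℚ-distrib-* (fromℕℚ D′) ⅛ k) ⟩
  1/! k ℚ.* (fromℕℚ D′ ^ℚ k ℚ.* ⅛ ^ℚ k)      ≡⟨ cong (λ x → 1/! k ℚ.* (x ℚ.* ⅛ ^ℚ k)) (fromℕℚ-^ D′ k) ⟨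
  1/! k ℚ.* (fromℕℚ (D′ ℕ.^ k) ℚ.* ⅛ ^ℚ k)   ≡⟨ ℚ.*-assoc (1/! k) (fromℕℚ (D′ ℕ.^ k)) (⅛ ^ℚ k) ⟨
  (1/! k ℚ.* fromℕℚ (D′ ℕ.^ k)) ℚ.* ⅛ ^ℚ k   ≤⟨ *-mono-≤ (0≤* (0≤1/! k) (0≤fromℕℚ (D′ ℕ.^ k))) (0≤⅛^ k)
    (exp-bound D′ k) ℚ.≤-refl ⟩
  (K ℚ.* (harm k ℚ.- harm (suc k))) ℚ.* ⅛ ^ℚ k
    ≤⟨ *-mono-≤ (0≤* (0≤fromℕℚ (exp-const D′)) 0≤h) (0≤⅛^ k)
      (*-mono-≤ (0≤fromℕℚ (exp-const D′)) 0≤h ℚ.≤-refl h≤1) ℚ.≤-refl ⟩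
  (K ℚ.* 1ℚ) ℚ.* ⅛ ^ℚ k   ≡⟨ cong (ℚ._* ⅛ ^ℚ k) (ℚ.*-identityʳ K) ⟩
  K ℚ.* ⅛ ^ℚ k   ∎
  where
  open ℚ.≤-Reasoning
  open ℚ-Solver
  d = fromℕℚ (suc D)
  D′ = 8 ℕ.* suc D
  K = fromℕℚ (exp-const D′)
  0≤h : 0ℚ ℚ.≤ harm k ℚ.- harm (suc k)
  0≤h = subst (0ℚ ℚ.≤_) (sym (harm-diff k)) (0≤/ 1 (suc k ℕ.* suc (suc k)))
  h≤1 : harm k ℚ.- harm (suc k) ℚ.≤ 1ℚ
  h≤1 = subst (ℚ._≤ 1ℚ) (sym (harm-diff k)) (/-≤ 1 (suc k ℕ.* suc (suc k)) 1 1 (s≤s z≤n))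

opaque
  -- The functional equation at the level of truncations, where it holds only up to an error. The
  -- error must be uniform for bounded p and q, because the n-th approximation of `exp` truncates
  -- the series at n and changes the argument with n at the same time.
  expₙ-* : ∀ D → ∃[ K ] 0ℚ ℚ.≤ K × (∀ p q n → ℚ.∣ p ∣ ℚ.≤ fromℕℚ (suc D) → ℚ.∣ q ∣ ℚ.≤ fromℕℚ (suc D) →
           ℚ.∣ expₙ n p ℚ.* expₙ n q ℚ.- expₙ n (p ℚ.+ q) ∣ ℚ.≤ K ℚ.* harm n)
  expₙ-* D = K ℚ.* K , 0≤* 0≤K 0≤K , λ p q n p≤ q≤ → begin
    ℚ.∣ expₙ n p ℚ.* expₙ n q ℚ.- expₙ n (p ℚ.+ q) ∣
      ≡⟨ cong (λ x → ℚ.∣ expₙ n p ℚ.* expₙ n q ℚ.- x ∣) (Σℚ-cong n (conv-^/! p q)) ⟨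
    ℚ.∣ expₙ n p ℚ.* expₙ n q ℚ.- Σℚ n (conv (p ^/!_) (q ^/!_)) ∣
      ≤⟨ Σ*Σ-Σconv≤ K K (p ^/!_) (q ^/!_) n 0≤K 0≤K (^/!-geometric D p p≤) (^/!-geometric D q q≤) n ℕ.≤-refl ⟩
    fromℕℚ n ℚ.* (fromℕℚ n ℚ.* ((K ℚ.* K) ℚ.* ⅛ ^ℚ n))
      ≡⟨ solve 3 (λ n k e → n :* (n :* ((k :* k) :* e)) := (k :* k) :* (n :* (n :* e))) refl (fromℕℚ n) K (⅛ ^ℚ n) ⟩
    (K ℚ.* K) ℚ.* (fromℕℚ n ℚ.* (fromℕℚ n ℚ.* ⅛ ^ℚ n))
      ≤⟨ *-mono-≤ (0≤* 0≤K 0≤K) (0≤* (0≤fromℕℚ n) (0≤* (0≤fromℕℚ n) (0≤⅛^ n))) ℚ.≤-refl (n*n*⅛^n≤harm n) ⟩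
    (K ℚ.* K) ℚ.* harm n ∎
    where
    open ℚ.≤-Reasoning
    open ℚ-Solver
    K : ℚ
    K = fromℕℚ (exp-const (8 ℕ.* suc D))
    0≤K : 0ℚ ℚ.≤ K
    0≤K = 0≤fromℕℚ (exp-const (8 ℕ.* suc D))

-- The exponential function on ℝ

^ᶜ-real : ∀ z i → seq (im z) i ≡ 0ℚ → ∀ k → seq (re (z ^ᶜ k)) i ≡ seq (re z) i ^ℚ k × seq (im (z ^ᶜ k)) i ≡ 0ℚ
^ᶜ-real z i h zero    = refl , refl
^ᶜ-real z i h (suc k) = let p , q = ^ᶜ-real z i h k in
  trans (cong₂ (λ x y → seq (re z) i ℚ.* x ℚ.- y) p (trans (cong₂ ℚ._*_ h q) (ℚ.*-zeroˡ 0ℚ))) (ℚ.+-identityʳ _) ,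
  trans (cong₂ (λ x y → seq (re z) i ℚ.* x ℚ.+ y ℚ.* seq (re (z ^ᶜ k)) i) q h)
    (p*0+0*q≡0 (seq (re z) i) (seq (re (z ^ᶜ k)) i))

-- The i-th approximation of `exp z` is a partial sum at the i-th approximation of z. So the
-- hypothesis concerns one index and has to be an equality of rationals: `≈` says nothing about a
-- fixed index.
exp-real : ∀ z i → seq (im z) i ≡ 0ℚ → seq (re (exp z)) i ≡ expₙ i (seq (re z) i) × seq (im (exp z)) i ≡ 0ℚ
exp-real z i h = sums i
  where
  sums : ∀ n → seq (re (Σᶜ n (exp-term z))) i ≡ expₙ n (seq (re z) i) × seq (im (Σᶜ n (exp-term z))) i ≡ 0ℚ
  sums zero    = refl , refl
  sums (suc n) = let p , q = sums n
                     u , v = ^ᶜ-real z i h n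
                 in cong₂ (λ x y → x ℚ.+ 1/! n ℚ.* y) p u
                  , trans (cong₂ (λ x y → x ℚ.+ 1/! n ℚ.* y) q v) (trans (ℚ.+-identityˡ _) (ℚ.*-zeroʳ (1/! n)))

Σᴿ : ℕ → (ℕ → ℝ) → ℝ
Σᴿ zero    a = ι 0ℚ
Σᴿ (suc n) a = Σᴿ n a + a n

harm-antimono : ∀ {m n} → m ℕ.≤ n → harm n ℚ.≤ harm m
harm-antimono {m} {n} m≤n = /-≤ 1 (suc n) 1 (suc m) (ℕ.*-monoʳ-≤ 1 (s≤s m≤n))

eventually-harm≤ : ∀ ε → 0ℚ ℚ.< ε → Eventually (λ n → harm n ℚ.≤ ε)
eventually-harm≤ ε 0<ε = let N , h = harm-small ε 0<ε in N , λ n N≤n → ℚ.≤-trans (harm-antimono N≤n) h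

eventually-∣∣≤ : ∀ x → ∃[ D ] Eventually (λ n → ℚ.∣ seq x n ∣ ℚ.≤ fromℕℚ D)
eventually-∣∣≤ x = let B , N , b = bounded x
                       D , B≤D   = ≤-fromℕℚ B
                   in D , N , λ n N≤n → ℚ.≤-trans (b n N≤n) B≤D

opaque
  unfolding _+_

  seq-+ : ∀ x y n → seq (x + y) n ≡ seq x n ℚ.+ seq y n
  seq-+ x y n = refl

  seq-* : ∀ x y n → seq (x * y) n ≡ seq x n ℚ.* seq y n
  seq-* x y n = refl

  seq-Σᴿ : ∀ n a i → seq (Σᴿ n a) i ≡ Σℚ n (λ k → seq (a k) i)
  seq-Σᴿ zero    a i = refl
  seq-Σᴿ (suc n) a i = cong (ℚ._+ seq (a n) i) (seq-Σᴿ n a i)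

  seq-^ : ∀ x n i → seq (x ^ n) i ≡ seq x i ^ℚ n
  seq-^ x zero    i = refl
  seq-^ x (suc n) i = cong (seq x i ℚ.*_) (seq-^ x n i)

  expᴿ : ℝ → ℝ
  expᴿ x = re (exp (ofℝ x))

  seq-expᴿ : ∀ x i → seq (expᴿ x) i ≡ expₙ i (seq x i)
  seq-expᴿ x i = proj₁ (exp-real (ofℝ x) i refl)

taylor : ℕ → ℝ → ℝ
taylor K x = Σᴿ K λ k → ι (1/! k) * x ^ k

opaque
  unfolding _+_

  seq-taylor : ∀ K x i → seq (taylor K x) i ≡ expₙ K (seq x i)
  seq-taylor K x i = trans (seq-Σᴿ K _ i) (Σℚ-cong K λ k → cong (1/! k ℚ.*_) (seq-^ x k i))

  expᴿ-taylor : ∀ K x → ∣ expᴿ x - taylor K x ∣ ≤ ∣ x ∣ ^ K * expᴿ ∣ x ∣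
  expᴿ-taylor K x = eventually⇒≤ (K , λ n K≤n → subst₂ ℚ._≤_
    (cong₂ (λ p q → ℚ.∣ p ℚ.- q ∣) (sym (seq-expᴿ x n)) (sym (seq-taylor K x n)))
    (cong₂ ℚ._*_ (sym (seq-^ ∣ x ∣ K n)) (sym (seq-expᴿ ∣ x ∣ n)))
    (expₙ-taylor K n (seq x n) K≤n))

  taylor≤expᴿ : ∀ K x → taylor K ∣ x ∣ ≤ expᴿ ∣ x ∣
  taylor≤expᴿ K x = eventually⇒≤ (K , λ n K≤n → subst₂ ℚ._≤_
    (sym (seq-taylor K ∣ x ∣ n)) (sym (seq-expᴿ ∣ x ∣ n))
    (subst (λ m → expₙ K ℚ.∣ seq x n ∣ ℚ.≤ expₙ m ℚ.∣ seq x n ∣) (ℕ.m∸n+n≡m K≤n)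
      (Σℚ-mono-length K (n ℕ.∸ K) (0≤^/! (ℚ.0≤∣p∣ (seq x n))))))

  seq-shift : ∀ x y n → seq y n ≡ seq (x + (y + - x)) n
  seq-shift x y n = solve 2 (λ x y → y := x :+ (y :- x)) refl (seq x n) (seq y n)
    where open ℚ-Solver

expᴿ-pointwise : ∀ {x y} → (∀ n → seq x n ≡ seq y n) → expᴿ x ≈ expᴿ y
expᴿ-pointwise {x} {y} h = pointwise⇒≈ λ n → trans (seq-expᴿ x n) (trans (cong (expₙ n) (h n)) (sym (seq-expᴿ y n)))

expᴿ-+ : ∀ x y → expᴿ (x + y) ≈ expᴿ x * expᴿ y
expᴿ-+ x y = ≈-sym (scaled⇒≈ K 0≤K λ ε 0<ε → eventually-map₂
  (λ { n (p≤ , q≤) h → ℚ.≤-trans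
    (subst (ℚ._≤ K ℚ.* harm n)
      (cong₂ (λ p q → ℚ.∣ p ℚ.- q ∣)
        (sym (trans (seq-* (expᴿ x) (expᴿ y) n) (cong₂ ℚ._*_ (seq-expᴿ x n) (seq-expᴿ y n))))
        (sym (trans (seq-expᴿ (x + y) n) (cong (expₙ n) (seq-+ x y n)))))
      (bound (seq x n) (seq y n) n p≤ q≤))
    (*-mono-≤ 0≤K (0≤/ 1 (suc n)) ℚ.≤-refl h) })
  (eventually-map₂ (λ n p q → ℚ.≤-trans p (fromℕℚ-mono {D₁} {suc (D₁ ℕ.+ D₂)} (ℕ.m≤n⇒m≤1+n (ℕ.m≤m+n D₁ D₂)))
                            , ℚ.≤-trans q (fromℕℚ-mono {D₂} {suc (D₁ ℕ.+ D₂)} (ℕ.m≤n⇒m≤1+n (ℕ.m≤n+m D₂ D₁))))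
    (proj₂ (eventually-∣∣≤ x)) (proj₂ (eventually-∣∣≤ y)))
  (eventually-harm≤ ε 0<ε))
  where
  D₁ = proj₁ (eventually-∣∣≤ x)
  D₂ = proj₁ (eventually-∣∣≤ y)
  K = proj₁ (expₙ-* (D₁ ℕ.+ D₂))
  0≤K = proj₁ (proj₂ (expₙ-* (D₁ ℕ.+ D₂)))
  bound = proj₂ (proj₂ (expₙ-* (D₁ ℕ.+ D₂)))

-- Convergence and completeness

infix 4 _⟶_

_⟶_ : (ℕ → ℝ) → ℝ → Set
a ⟶ s = ∀ ε → 0ℚ ℚ.< ε → Eventually (λ n → ∣ a n - s ∣ ≤ ι ε)

∣p-r∣≤∣p-q∣+∣q-r∣ : ∀ p q r → ℚ.∣ p ℚ.- r ∣ ℚ.≤ ℚ.∣ p ℚ.- q ∣ ℚ.+ ℚ.∣ q ℚ.- r ∣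
∣p-r∣≤∣p-q∣+∣q-r∣ p q r = subst (λ x → ℚ.∣ x ∣ ℚ.≤ ℚ.∣ p ℚ.- q ∣ ℚ.+ ℚ.∣ q ℚ.- r ∣)
  (p-q+[q-r]≡p-r p q r) (ℚ.∣p+q∣≤∣p∣+∣q∣ (p ℚ.- q) (q ℚ.- r))

opaque
  unfolding _≈_ _+_

  -- The limit is a diagonal: its n-th approximation is an approximation of S n taken at a place
  -- where the Cauchy modulus of S n guarantees accuracy 1/(n+1). An explicit rate for S makes this
  -- diagonal Cauchy with a rate of the same kind.
  complete : ∀ (S : ℕ → ℝ) C → 0ℚ ℚ.≤ C → (∀ m n → m ℕ.≤ n → ∣ S n - S m ∣ ≤ ι (C ℚ.* harm m)) → ∃[ s ] S ⟶ s
  complete S C 0≤C S≤ = mkℝ s s-cauchy , λ ε 0<ε →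
    let δ , 0<δ , Kδ≤ε = *-small (K ℚ.+ 1ℚ) (0≤+ 0≤K (ℚ.<⇒≤ 0<1)) ε 0<ε
    in eventually-map (λ n h ε′ 0<ε′ → M n ℕ.⊔ n , λ i le → begin
         ℚ.∣ seq (S n) i ℚ.- s i ∣   ≤⟨ ∣p-r∣≤∣p-q∣+∣q-r∣ (seq (S n) i) (s n) (s i) ⟩
         ℚ.∣ seq (S n) i ℚ.- s n ∣ ℚ.+ ℚ.∣ s n ℚ.- s i ∣    ≤⟨ ℚ.+-mono-≤
           (M-modulus n i (M n) (ℕ.m⊔n≤o⇒m≤o (M n) n le) ℕ.≤-refl)
                                                                 (subst (ℚ._≤ K ℚ.* harm n) (∣-∣-swap (s i) (s n))
                                                                   (s-close n i (ℕ.m⊔n≤o⇒n≤o (M n) n le))) ⟩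
         harm n ℚ.+ K ℚ.* harm n   ≡⟨ solve 2
           (λ h K → h :+ K :* h := (K :+ con 1ℚ) :* h) refl (harm n) K ⟩
         (K ℚ.+ 1ℚ) ℚ.* harm n   ≤⟨ *-mono-≤ (0≤+ 0≤K (ℚ.<⇒≤ 0<1))
           (0≤/ 1 (suc n)) ℚ.≤-refl h ⟩
         (K ℚ.+ 1ℚ) ℚ.* δ   ≤⟨ Kδ≤ε ⟩
         ε                                                  ≡⟨ ℚ.+-identityʳ ε ⟨
         ε ℚ.+ 0ℚ   ≤⟨ ℚ.+-monoʳ-≤ ε (ℚ.<⇒≤ 0<ε′) ⟩
         ε ℚ.+ ε′   ∎)
       (eventually-harm≤ δ 0<δ)
    where
    open ℚ.≤-Reasoning
    open ℚ-Solver
    0<harm : ∀ n → 0ℚ ℚ.< harm n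
    0<harm n = ℚ.positive⁻¹ (harm n) {{ℚ.normalize-pos 1 (suc n)}}
    M : ℕ → ℕ
    M n = proj₁ (cauchy (S n) (harm n) (0<harm n))
    M-modulus : ∀ n i j → M n ℕ.≤ i → M n ℕ.≤ j → ℚ.∣ seq (S n) i ℚ.- seq (S n) j ∣ ℚ.≤ harm n
    M-modulus n = proj₂ (cauchy (S n) (harm n) (0<harm n))
    s : ℕ → ℚ
    s n = seq (S n) (M n)
    -- C comes from the hypothesis; the 3 counts the modulus of `S n`, the modulus of `S m` and the
    -- slack in the real inequality `S≤`, each at most 1/(m+1).
    K : ℚ
    K = C ℚ.+ fromℕℚ 3
    0≤K : 0ℚ ℚ.≤ K
    0≤K = 0≤+ 0≤C (0≤fromℕℚ 3)
    s-close : ∀ m n → m ℕ.≤ n → ℚ.∣ s n ℚ.- s m ∣ ℚ.≤ K ℚ.* harm m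
    s-close m n m≤n =
      let N , h = S≤ m n m≤n (harm m) (0<harm m)
          i     = N ℕ.⊔ (M m ℕ.⊔ M n)
          le    = ℕ.m≤n⊔m N (M m ℕ.⊔ M n)
      in begin
      ℚ.∣ s n ℚ.- s m ∣
        ≤⟨ ∣p-r∣≤∣p-q∣+∣q-r∣ (s n) (seq (S n) i) (s m) ⟩
      ℚ.∣ s n ℚ.- seq (S n) i ∣ ℚ.+ ℚ.∣ seq (S n) i ℚ.- s m ∣
        ≤⟨ ℚ.+-mono-≤ (ℚ.≤-trans (M-modulus n (M n) i ℕ.≤-refl (ℕ.≤-trans (ℕ.m≤n⊔m (M m) (M n)) le))
          (harm-antimono m≤n))
             (ℚ.≤-trans (∣p-r∣≤∣p-q∣+∣q-r∣ (seq (S n) i) (seq (S m) i) (s m))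
               (ℚ.+-mono-≤ (h i (ℕ.m≤m⊔n N (M m ℕ.⊔ M n)))
                 (M-modulus m i (M m) (ℕ.≤-trans (ℕ.m≤m⊔n (M m) (M n)) le) ℕ.≤-refl))) ⟩
      harm m ℚ.+ ((C ℚ.* harm m ℚ.+ harm m) ℚ.+ harm m)
        ≡⟨ solve 2 (λ C h → h :+ ((C :* h :+ h) :+ h) := (C :+ con (fromℕℚ 3)) :* h) refl C (harm m) ⟩
      K ℚ.* harm m ∎
    s-cauchy : Cauchy s
    s-cauchy = cauchy-scale s (K ℚ.+ K) (0≤+ 0≤K 0≤K) λ ε 0<ε → let N , h = harm-small ε 0<ε in N , λ m n N≤m N≤n → begin
      ℚ.∣ s m ℚ.- s n ∣
        ≤⟨ ∣p-r∣≤∣p-q∣+∣q-r∣ (s m) (s N) (s n) ⟩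
      ℚ.∣ s m ℚ.- s N ∣ ℚ.+ ℚ.∣ s N ℚ.- s n ∣
        ≤⟨ ℚ.+-mono-≤ (s-close N m N≤m) (subst (ℚ._≤ K ℚ.* harm N) (∣-∣-swap (s n) (s N)) (s-close N n N≤n)) ⟩
      K ℚ.* harm N ℚ.+ K ℚ.* harm N
        ≡⟨ ℚ.*-distribʳ-+ (harm N) K K ⟨
      (K ℚ.+ K) ℚ.* harm N
        ≤⟨ *-mono-≤ (0≤+ 0≤K 0≤K) (0≤/ 1 (suc N)) ℚ.≤-refl h ⟩
      (K ℚ.+ K) ℚ.* ε ∎

-- Inequalities between real numbers

open ℝ-Solver using (solve; con; _:=_; _:+_; _:*_; _:-_; :-_) 

-- Nonnegative reals coincide with their absolute values, and the absolute value is multiplicative;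
-- thus no estimate with ε is needed.
*-nonNeg : ∀ {x y} → ι 0ℚ ≤ x → ι 0ℚ ≤ y → ι 0ℚ ≤ x * y
*-nonNeg {x} {y} 0≤x 0≤y = begin
  ι 0ℚ   ≤⟨ 0≤∣x∣ (x * y) ⟩
  ∣ x * y ∣       ≈⟨ ∣x*y∣≈∣x∣*∣y∣ x y ⟩
  ∣ x ∣ * ∣ y ∣   ≈⟨ *-cong (0≤x⇒∣x∣≈x 0≤x) (0≤x⇒∣x∣≈x 0≤y) ⟩
  x * y   ∎
  where open ≤R

x≤y⇒0≤y-x : ∀ {x y} → x ≤ y → ι 0ℚ ≤ y - x
x≤y⇒0≤y-x {x} {y} h = begin
  ι 0ℚ    ≈⟨ -‿inverseʳ x ⟨
  x - x   ≤⟨ +-mono-≤ h ≤-refl ⟩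
  y - x   ∎
  where open ≤R

0≤y-x⇒x≤y : ∀ {x y} → ι 0ℚ ≤ y - x → x ≤ y
0≤y-x⇒x≤y {x} {y} h = begin
  x             ≈⟨ +-identityˡ x ⟨
  ι 0ℚ + x      ≤⟨ +-mono-≤ h ≤-refl ⟩
  (y - x) + x   ≈⟨ solve 2 (λ x y → (y :- x) :+ x := y) ≈-refl x y ⟩
  y             ∎
  where open ≤R

*-monoˡ : ∀ {x y z} → ι 0ℚ ≤ z → x ≤ y → z * x ≤ z * y
*-monoˡ {x} {y} {z} 0≤z x≤y = 0≤y-x⇒x≤y (begin
  ι 0ℚ   ≤⟨ *-nonNeg 0≤z (x≤y⇒0≤y-x x≤y) ⟩
  z * (y - x)     ≈⟨ solve 3 (λ x y z → z :* (y :- x) := z :* y :- z :* x) ≈-refl x y z ⟩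
  z * y - z * x   ∎)
  where open ≤R

*-monoʳ : ∀ {x y z} → ι 0ℚ ≤ z → x ≤ y → x * z ≤ y * z
*-monoʳ {x} {y} {z} 0≤z x≤y = begin
  x * z   ≈⟨ *-comm x z ⟩
  z * x   ≤⟨ *-monoˡ 0≤z x≤y ⟩
  z * y   ≈⟨ *-comm z y ⟩
  y * z   ∎
  where open ≤R

*-mono : ∀ {x y u v} → ι 0ℚ ≤ y → ι 0ℚ ≤ u → x ≤ y → u ≤ v → x * u ≤ y * v
*-mono 0≤y 0≤u h k = ≤-trans (*-monoʳ 0≤u h) (*-monoˡ 0≤y k)

0≤1 : ι 0ℚ ≤ ι 1ℚ
0≤1 = ι-mono (ℚ.<⇒≤ 0<1)

^-nonNeg : ∀ {x} → ι 0ℚ ≤ x → ∀ n → ι 0ℚ ≤ x ^ n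
^-nonNeg 0≤x zero    = 0≤1
^-nonNeg 0≤x (suc n) = *-nonNeg 0≤x (^-nonNeg 0≤x n)

^-mono : ∀ {x y} → ι 0ℚ ≤ x → x ≤ y → ∀ n → x ^ n ≤ y ^ n
^-mono 0≤x x≤y zero    = ≤-refl
^-mono 0≤x x≤y (suc n) = *-mono (≤-trans 0≤x x≤y) (^-nonNeg 0≤x n) x≤y (^-mono 0≤x x≤y n)

1≤^ : ∀ {x} → ι 1ℚ ≤ x → ∀ n → ι 1ℚ ≤ x ^ n
1≤^ 1≤x zero    = ≤-refl
1≤^ {x} 1≤x (suc n) = begin
  ι 1ℚ   ≈⟨ *-identityˡ (ι 1ℚ) ⟨
  ι 1ℚ * ι 1ℚ   ≤⟨ *-mono (≤-trans 0≤1 1≤x) 0≤1 1≤x (1≤^ 1≤x n) ⟩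
  x * x ^ n     ∎
  where open ≤R

1^ : ∀ n → ι 1ℚ ^ n ≈ ι 1ℚ
1^ zero    = ≈-refl
1^ (suc n) = ≈-trans (*-identityˡ _) (1^ n)

∣x^n∣≈∣x∣^n : ∀ x n → ∣ x ^ n ∣ ≈ ∣ x ∣ ^ n
∣x^n∣≈∣x∣^n x zero    = 0≤x⇒∣x∣≈x 0≤1
∣x^n∣≈∣x∣^n x (suc n) = ≈-trans (∣x*y∣≈∣x∣*∣y∣ x (x ^ n)) (*-congˡ (∣x^n∣≈∣x∣^n x n))

∣x*y∣≈x*∣y∣ : ∀ {x y} → ι 0ℚ ≤ x → ∣ x * y ∣ ≈ x * ∣ y ∣
∣x*y∣≈x*∣y∣ {x} {y} 0≤x = ≈-trans (∣x*y∣≈∣x∣*∣y∣ x y) (*-congʳ (0≤x⇒∣x∣≈x 0≤x))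

∣x-y∣≤∣x∣+∣y∣ : ∀ x y → ∣ x - y ∣ ≤ ∣ x ∣ + ∣ y ∣
∣x-y∣≤∣x∣+∣y∣ x y = ≤-trans (∣x+y∣≤∣x∣+∣y∣ x (- y)) (+-mono-≤ ≤-refl (≈⇒≤ (∣-x∣≈∣x∣ y)))

≤-respˡ : ∀ {x y z} → x ≈ y → x ≤ z → y ≤ z
≤-respˡ h = ≤-trans (≈⇒≤ (≈-sym h))

≤-respʳ : ∀ {x y z} → y ≈ z → x ≤ y → x ≤ z
≤-respʳ h k = ≤-trans k (≈⇒≤ h)

+-nonNeg : ∀ {x y} → ι 0ℚ ≤ x → ι 0ℚ ≤ y → ι 0ℚ ≤ x + y
+-nonNeg {x} {y} h k = ≤-respˡ (+-identityˡ (ι 0ℚ)) (+-mono-≤ h k)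

∣x∣≤0⇒x≈0 : ∀ {x} → ∣ x ∣ ≤ ι 0ℚ → x ≈ ι 0ℚ
∣x∣≤0⇒x≈0 {x} h = ≤-antisym (≤-trans (x≤∣x∣ x) h) (begin
  ι 0ℚ       ≈⟨ solve 0 (con 0ℚ := :- con 0ℚ) ≈-refl ⟩
  - ι 0ℚ     ≤⟨ -‿antimono-≤ (≤-trans (x≤∣x∣ (- x)) (≤-trans (≈⇒≤ (∣-x∣≈∣x∣ x)) h)) ⟩
  - - x      ≈⟨ solve 1 (λ x → :- (:- x) := x) ≈-refl x ⟩
  x          ∎)
  where open ≤R

ν : ℕ → ℝ
ν n = ι (fromℕℚ n)

0≤ν : ∀ n → ι 0ℚ ≤ ν n
0≤ν n = ι-mono (0≤fromℕℚ n)

ν-suc : ∀ n → ν (suc n) ≈ ι 1ℚ + ν n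
ν-suc n = ≈-trans (≈-reflexive (cong ι (fromℕℚ-suc n))) (ι-+ 1ℚ (fromℕℚ n))
  where open CommutativeRing ℝ-ring using () renaming (reflexive to ≈-reflexive)

opaque
  unfolding _+_

  x*x≈∣x∣*∣x∣ : ∀ x → x * x ≈ ∣ x ∣ * ∣ x ∣
  x*x≈∣x∣*∣x∣ x = pointwise⇒≈ λ n → p*p≡∣p∣*∣p∣ (seq x n)

square-nonNeg : ∀ x → ι 0ℚ ≤ x * x
square-nonNeg x = ≤-respʳ (≈-sym (x*x≈∣x∣*∣x∣ x)) (*-nonNeg (0≤∣x∣ x) (0≤∣x∣ x))

1≤2 : ι 1ℚ ≤ ι (1ℚ ℚ.+ 1ℚ)
1≤2 = ι-mono (ℚ.≤-trans (ℚ.≤-reflexive (sym (ℚ.+-identityʳ 1ℚ))) (ℚ.+-monoʳ-≤ 1ℚ (ℚ.<⇒≤ 0<1)))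

x≤x+y : ∀ {x y} → ι 0ℚ ≤ y → x ≤ x + y
x≤x+y {x} {y} 0≤y = ≤-respˡ (+-identityʳ x) (+-mono-≤ ≤-refl 0≤y)

y≤x+y : ∀ {x y} → ι 0ℚ ≤ x → y ≤ x + y
y≤x+y {x} {y} 0≤x = ≤-respˡ (+-identityˡ y) (+-mono-≤ 0≤x ≤-refl)

x≤y*x : ∀ {x y} → ι 0ℚ ≤ x → ι 1ℚ ≤ y → x ≤ y * x
x≤y*x {x} 0≤x 1≤y = ≤-respˡ (*-identityˡ x) (*-monoʳ 0≤x 1≤y)

-- Finite sums

Σᴿ-cong : ∀ n {a b} → (∀ k → a k ≈ b k) → Σᴿ n a ≈ Σᴿ n b
Σᴿ-cong zero    h = ≈-refl
Σᴿ-cong (suc n) h = +-cong (Σᴿ-cong n h) (h n)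

Σᴿ-linear : ∀ n x a b → Σᴿ n (λ k → x * a k + b k) ≈ x * Σᴿ n a + Σᴿ n b
Σᴿ-linear zero    x a b = solve 1 (λ x → con 0ℚ := x :* con 0ℚ :+ con 0ℚ) ≈-refl x
Σᴿ-linear (suc n) x a b = ≈-trans (+-congʳ (Σᴿ-linear n x a b))
  (solve 5 (λ x s t a b → (x :* s :+ t) :+ (x :* a :+ b) := x :* (s :+ a) :+ (t :+ b)) ≈-refl x (Σᴿ n a) (Σᴿ n b)
    (a n) (b n))

Σᴿ-* : ∀ n x a → Σᴿ n (λ k → x * a k) ≈ x * Σᴿ n a
Σᴿ-* zero    x a = solve 1 (λ x → con 0ℚ := x :* con 0ℚ) ≈-refl x
Σᴿ-* (suc n) x a = ≈-trans (+-congʳ (Σᴿ-* n x a)) (≈-sym (distribˡ x (Σᴿ n a) (a n)))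

Σᴿ-mono : ∀ n {a b} → (∀ k → a k ≤ b k) → Σᴿ n a ≤ Σᴿ n b
Σᴿ-mono zero    h = ≤-refl
Σᴿ-mono (suc n) h = +-mono-≤ (Σᴿ-mono n h) (h n)

Σᴿ-nonNeg : ∀ n {a} → (∀ k → ι 0ℚ ≤ a k) → ι 0ℚ ≤ Σᴿ n a
Σᴿ-nonNeg zero    h = ≤-refl
Σᴿ-nonNeg (suc n) h = +-nonNeg (Σᴿ-nonNeg n h) (h n)

∣Σᴿ∣≤ : ∀ n a → ∣ Σᴿ n a ∣ ≤ Σᴿ n (λ k → ∣ a k ∣)
∣Σᴿ∣≤ zero    a = ≈⇒≤ (0≤x⇒∣x∣≈x ≤-refl)
∣Σᴿ∣≤ (suc n) a = ≤-trans (∣x+y∣≤∣x∣+∣y∣ (Σᴿ n a) (a n)) (+-mono-≤ (∣Σᴿ∣≤ n a) ≤-refl)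

Σᴿ-term≤ : ∀ n {a} → (∀ k → ι 0ℚ ≤ a k) → ∀ m → m ℕ.< n → a m ≤ Σᴿ n a
Σᴿ-term≤ (suc n) h m (s≤s m≤n) with ℕ.m≤n⇒m<n∨m≡n m≤n
... | inj₁ m<n  = ≤-trans (Σᴿ-term≤ n h m m<n) (x≤x+y (h n))
... | inj₂ refl = y≤x+y (Σᴿ-nonNeg n h)

Σᴿ-front : ∀ n a → Σᴿ (suc n) a ≈ a 0 + Σᴿ n (λ k → a (suc k))
Σᴿ-front zero    a = +-comm (ι 0ℚ) (a 0)
Σᴿ-front (suc n) a = ≈-trans (+-congʳ (Σᴿ-front n a)) (+-assoc (a 0) (Σᴿ n (λ k → a (suc k))) (a (suc n)))

Σᴿ-shift : ∀ m n a → Σᴿ (m ℕ.+ n) a ≈ Σᴿ n a + Σᴿ m (λ k → a (k ℕ.+ n))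
Σᴿ-shift zero    n a = ≈-sym (+-identityʳ (Σᴿ n a))
Σᴿ-shift (suc m) n a = ≈-trans (+-congʳ (Σᴿ-shift m n a)) (+-assoc (Σᴿ n a) (Σᴿ m (λ k → a (k ℕ.+ n))) (a (m ℕ.+ n)))

-- Properties of the exponential function

taylor-1 : ∀ x → taylor 1 x ≈ ι 1ℚ
taylor-1 x = solve 0 (con 0ℚ :+ con 1ℚ :* con 1ℚ := con 1ℚ) ≈-refl

taylor-cong : ∀ K {x y} → x ≈ y → taylor K x ≈ taylor K y
taylor-cong K x≈y = Σᴿ-cong K λ k → *-congˡ (^-congˡ k x≈y)

∣expᴿ-1∣≤ : ∀ x → ∣ expᴿ x - ι 1ℚ ∣ ≤ ∣ x ∣ * expᴿ ∣ x ∣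
∣expᴿ-1∣≤ x = begin
  ∣ expᴿ x - ι 1ℚ ∣   ≈⟨ ∣∣-cong (+-congˡ (-‿cong (taylor-1 x))) ⟨
  ∣ expᴿ x - taylor 1 x ∣    ≤⟨ expᴿ-taylor 1 x ⟩
  ∣ x ∣ ^ 1 * expᴿ ∣ x ∣     ≈⟨ *-congʳ (*-identityʳ ∣ x ∣) ⟩
  ∣ x ∣ * expᴿ ∣ x ∣   ∎
  where open ≤R

x≈0⇒expᴿ≈1 : ∀ {x} → x ≈ ι 0ℚ → expᴿ x ≈ ι 1ℚ
x≈0⇒expᴿ≈1 {x} h = begin-equality
  expᴿ x   ≈⟨ solve 1 (λ e → e := (e :- con 1ℚ) :+ con 1ℚ) ≈-refl (expᴿ x) ⟩
  (expᴿ x - ι 1ℚ) + ι 1ℚ   ≈⟨ +-congʳ (∣x∣≤0⇒x≈0 (begin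
    ∣ expᴿ x - ι 1ℚ ∣    ≤⟨ ∣expᴿ-1∣≤ x ⟩
    ∣ x ∣ * expᴿ ∣ x ∣   ≈⟨ *-congʳ (≈-trans (∣∣-cong h) (0≤x⇒∣x∣≈x ≤-refl)) ⟩
    ι 0ℚ * expᴿ ∣ x ∣    ≈⟨ zeroˡ (expᴿ ∣ x ∣) ⟩
    ι 0ℚ   ∎)) ⟩
  ι 0ℚ + ι 1ℚ   ≈⟨ +-identityˡ (ι 1ℚ) ⟩
  ι 1ℚ   ∎
  where open ≤R

-- Write e^y = e^x e^(y-x), where e^(y-x) ≈ 1 by the first-order Taylor bound. The step from y to x
-- + (y - x) must not use the congruence itself; `seq-shift` makes it an equality of all
-- approximations.
expᴿ-cong : ∀ {x y} → x ≈ y → expᴿ x ≈ expᴿ y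
expᴿ-cong {x} {y} h = begin-equality
  expᴿ x   ≈⟨ *-identityʳ (expᴿ x) ⟨
  expᴿ x * ι 1ℚ   ≈⟨ *-congˡ (x≈0⇒expᴿ≈1 (≈-trans (+-congʳ (≈-sym h)) (-‿inverseʳ x))) ⟨
  expᴿ x * expᴿ (y + - x)   ≈⟨ expᴿ-+ x (y + - x) ⟨
  expᴿ (x + (y + - x))      ≈⟨ expᴿ-pointwise (seq-shift x y) ⟨
  expᴿ y   ∎
  where open ≤R

-- e^x is the square of e^(x/2). The approximations give no direct argument, since partial sums at a
-- negative argument can be negative.
expᴿ-nonNeg : ∀ x → ι 0ℚ ≤ expᴿ x
expᴿ-nonNeg x = ≤-respʳ (≈-trans (≈-sym (expᴿ-+ h h))
  (expᴿ-cong (solve 1 (λ x → con ½ :* x :+ con ½ :* x := x) ≈-refl x)))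
  (square-nonNeg (expᴿ h))
  where h = ι ½ * x

expᴿ-inverse : ∀ x → expᴿ (- x) * expᴿ x ≈ ι 1ℚ
expᴿ-inverse x = ≈-trans (≈-sym (expᴿ-+ (- x) x)) (x≈0⇒expᴿ≈1 (-‿inverseˡ x))

taylor≤ : ∀ K {x} → ι 0ℚ ≤ x → taylor K x ≤ expᴿ x
taylor≤ K {x} 0≤x = begin
  taylor K x       ≈⟨ taylor-cong K (0≤x⇒∣x∣≈x 0≤x) ⟨
  taylor K ∣ x ∣   ≤⟨ taylor≤expᴿ K x ⟩
  expᴿ ∣ x ∣       ≈⟨ expᴿ-cong (0≤x⇒∣x∣≈x 0≤x) ⟩
  expᴿ x   ∎
  where open ≤R

1≤expᴿ : ∀ {x} → ι 0ℚ ≤ x → ι 1ℚ ≤ expᴿ x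
1≤expᴿ {x} 0≤x = ≤-respˡ (taylor-1 x) (taylor≤ 1 0≤x)

expᴿ-mono : ∀ {x y} → x ≤ y → expᴿ x ≤ expᴿ y
expᴿ-mono {x} {y} x≤y = begin
  expᴿ x   ≤⟨ x≤y*x (expᴿ-nonNeg x) (1≤expᴿ (x≤y⇒0≤y-x x≤y)) ⟩
  expᴿ (y - x) * expᴿ x   ≈⟨ expᴿ-+ (y - x) x ⟨
  expᴿ ((y - x) + x)      ≈⟨ expᴿ-cong (solve 2 (λ x y → (y :- x) :+ x := y) ≈-refl x y) ⟩
  expᴿ y   ∎
  where open ≤R

ν!*ι1/! : ∀ k → ν (k !) * ι (1/! k) ≈ ι 1ℚ
ν!*ι1/! k = ≈-trans (≈-sym (ι-* (fromℕℚ (k !)) (1/! k))) (subst (λ q → ι q ≈ ι 1ℚ) (sym eq) ≈-refl)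
  where
  instance _ = k ℕ.!≢0
  eq : fromℕℚ (k !) ℚ.* 1/! k ≡ 1ℚ
  eq = trans (fromℕℚ-*-/ (k !) 1 (k !)) (/-≡ (k ! ℕ.* 1) (k !) 1 1
    (trans (ℕ.*-identityʳ (k ! ℕ.* 1)) (ℕ.*-comm (k !) 1)))

-- A single term of the exponential series is at most the whole. This is the source of all decay:
-- through it e^(-u) absorbs powers of u.
x^k≤k!*expᴿ : ∀ {x} → ι 0ℚ ≤ x → ∀ k → x ^ k ≤ ν (k !) * expᴿ x
x^k≤k!*expᴿ {x} 0≤x k = begin
  x ^ k   ≈⟨ *-identityˡ (x ^ k) ⟨
  ι 1ℚ * x ^ k   ≈⟨ *-congʳ (ν!*ι1/! k) ⟨
  ν (k !) * ι (1/! k) * x ^ k      ≈⟨ *-assoc (ν (k !)) (ι (1/! k)) (x ^ k) ⟩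
  ν (k !) * (ι (1/! k) * x ^ k)    ≤⟨ *-monoˡ (0≤ν (k !))
    (≤-trans (Σᴿ-term≤ (suc k) (λ j → *-nonNeg (ι-mono (0≤1/! j)) (^-nonNeg 0≤x j)) k ℕ.≤-refl) (taylor≤ (suc k) 0≤x)) ⟩
  ν (k !) * expᴿ x   ∎
  where open ≤R

-- Limits of sequences and series

⟶-cong : ∀ {a b s t} → (∀ n → a n ≈ b n) → s ≈ t → a ⟶ s → b ⟶ t
⟶-cong h s≈t lim ε 0<ε = eventually-map (λ n → ≤-respˡ (∣∣-cong (+-cong (h n) (-‿cong s≈t)))) (lim ε 0<ε)

⟶-bound : ∀ {a s B} → a ⟶ s → (∀ n → ∣ a n ∣ ≤ B) → ∣ s ∣ ≤ B
⟶-bound {a} {s} {B} lim h = archimedean λ ε 0<ε → let N , k = lim ε 0<ε in begin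
  ∣ s ∣   ≈⟨ ∣∣-cong (solve 2 (λ s a → s := a :- (a :- s)) ≈-refl s (a N)) ⟩
  ∣ a N - (a N - s) ∣        ≤⟨ ∣x-y∣≤∣x∣+∣y∣ (a N) (a N - s) ⟩
  ∣ a N ∣ + ∣ a N - s ∣      ≤⟨ +-mono-≤ (h N) (k N ℕ.≤-refl) ⟩
  B + ι ε   ∎
  where open ≤R

-- 1/((n+1)(n+2))

harm² : ℕ → ℝ
harm² n = ι (harm n ℚ.- harm (suc n))

0≤harm² : ∀ n → ι 0ℚ ≤ harm² n
0≤harm² n = ι-mono (subst (0ℚ ℚ.≤_) (sym (harm-diff n)) (0≤/ 1 (suc n ℕ.* suc (suc n))))

-- `harm²` telescopes, so domination by it gives tails O(1/(m+1)), exactly the rate that `complete`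
-- asks for.
Σᴿ-tail≤ : ∀ C a → (∀ n → ∣ a n ∣ ≤ C * harm² n) → ∀ m n → m ℕ.≤ n → ι 0ℚ ≤ C → ∣ Σᴿ n a - Σᴿ m a ∣ ≤ C * ι (harm m)
Σᴿ-tail≤ C a a≤ m n m≤n 0≤C = subst (λ n → ∣ Σᴿ n a - Σᴿ m a ∣ ≤ C * ι (harm m)) (ℕ.m∸n+n≡m m≤n)
  (≤-trans (bound (n ℕ.∸ m)) (*-monoˡ 0≤C (ι-mono
    (ℚ.≤-trans (ℚ.+-monoʳ-≤ (harm m) (ℚ.neg-antimono-≤ (0≤/ 1 (suc (n ℕ.∸ m ℕ.+ m)))))
    (ℚ.≤-reflexive (ℚ.+-identityʳ (harm m)))))))
  where
  open ≤R
  bound : ∀ d → ∣ Σᴿ (d ℕ.+ m) a - Σᴿ m a ∣ ≤ C * ι (harm m ℚ.- harm (d ℕ.+ m))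
  bound zero = ≈⇒≤ (≈-trans (∣∣-cong (-‿inverseʳ (Σᴿ m a))) (≈-trans (0≤x⇒∣x∣≈x ≤-refl)
    (≈-sym (≈-trans (*-congˡ (subst (λ q → ι q ≈ ι 0ℚ) (sym (ℚ.+-inverseʳ (harm m))) ≈-refl)) (zeroʳ C)))))
  bound (suc d) = begin
    ∣ (s + t) - s₀ ∣   ≈⟨ ∣∣-cong (solve 3 (λ s t z → (s :+ t) :- z := (s :- z) :+ t) ≈-refl s t s₀) ⟩
    ∣ (s - s₀) + t ∣   ≤⟨ ∣x+y∣≤∣x∣+∣y∣ (s - s₀) t ⟩
    ∣ s - s₀ ∣ + ∣ t ∣   ≤⟨ +-mono-≤ (bound d) (a≤ (d ℕ.+ m)) ⟩
    C * ι p + C * ι q   ≈⟨ distribˡ C (ι p) (ι q) ⟨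
    C * (ι p + ι q)   ≈⟨ *-congˡ (ι-+ p q) ⟨
    C * ι (p ℚ.+ q)   ≈⟨ *-congˡ
      (subst (λ x → ι (p ℚ.+ q) ≈ ι x) (p-q+[q-r]≡p-r (harm m) (harm (d ℕ.+ m)) (harm (suc d ℕ.+ m))) ≈-refl) ⟩
    C * ι (harm m ℚ.- harm (suc d ℕ.+ m)) ∎
    where
    s = Σᴿ (d ℕ.+ m) a
    s₀ = Σᴿ m a
    t = a (d ℕ.+ m)
    p = harm m ℚ.- harm (d ℕ.+ m)
    q = harm (d ℕ.+ m) ℚ.- harm (suc d ℕ.+ m)

∣Σᴿ∣≤C : ∀ C a → ι 0ℚ ≤ C → (∀ n → ∣ a n ∣ ≤ C * harm² n) → ∀ n → ∣ Σᴿ n a ∣ ≤ C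
∣Σᴿ∣≤C C a 0≤C a≤ n = begin
  ∣ Σᴿ n a ∣   ≈⟨ ∣∣-cong (solve 1 (λ s → s := s :- con 0ℚ) ≈-refl (Σᴿ n a)) ⟩
  ∣ Σᴿ n a - ι 0ℚ ∣     ≤⟨ Σᴿ-tail≤ C a a≤ 0 n z≤n 0≤C ⟩
  C * ι 1ℚ   ≈⟨ *-identityʳ C ⟩
  C                     ∎
  where open ≤R

opaque
  series-converges : ∀ C a → (∀ n → ∣ a n ∣ ≤ C * harm² n) → ∃[ s ] (λ n → Σᴿ n a) ⟶ s
  series-converges C a a≤ =
    -- `complete` takes a rational constant, so the real C is first replaced by a rational upper
    -- bound, made nonnegative by its absolute value.
    let B , C≤B = upper-bound C
        B′  = ℚ.∣ B ∣
        C≤B′ = ≤-trans C≤B (ι-mono (p≤∣p∣ B))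
    in complete (λ n → Σᴿ n a) B′ (ℚ.0≤∣p∣ B) λ m n m≤n → ≤-trans
      (Σᴿ-tail≤ (ι B′) a (λ n → ≤-trans (a≤ n) (*-monoʳ (0≤harm² n) C≤B′)) m n m≤n (ι-mono (ℚ.0≤∣p∣ B)))
      (≈⇒≤ (≈-sym (ι-* B′ (harm m))))

-- Finite differences with step f

module Differences (f : ℕ) where

  Δ : (ℕ → ℝ) → ℕ → ℝ
  Δ g n = g n - g (n ℕ.+ f)

  Δ^ : ℕ → (ℕ → ℝ) → ℕ → ℝ
  Δ^ zero    g = g
  Δ^ (suc k) g = Δ (Δ^ k g)

  Δ^-cong : ∀ k {g h} → (∀ n → g n ≈ h n) → ∀ n → Δ^ k g n ≈ Δ^ k h n
  Δ^-cong zero    eq n = eq n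
  Δ^-cong (suc k) eq n = +-cong (Δ^-cong k eq n) (-‿cong (Δ^-cong k eq (n ℕ.+ f)))

  Δ^-linear : ∀ k x g h n → Δ^ k (λ i → x * g i + h i) n ≈ x * Δ^ k g n + Δ^ k h n
  Δ^-linear zero    x g h n = ≈-refl
  Δ^-linear (suc k) x g h n = ≈-trans (+-cong (Δ^-linear k x g h n) (-‿cong (Δ^-linear k x g h (n ℕ.+ f))))
    (solve 5 (λ x a b a′ b′ → (x :* a :+ b) :- (x :* a′ :+ b′) := x :* (a :- a′) :+ (b :- b′)) ≈-refl
      x (Δ^ k g n) (Δ^ k h n) (Δ^ k g (n ℕ.+ f)) (Δ^ k h (n ℕ.+ f)))

  Δ^-0 : ∀ k n → Δ^ k (λ _ → ι 0ℚ) n ≈ ι 0ℚ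
  Δ^-0 zero    n = ≈-refl
  Δ^-0 (suc k) n = ≈-trans (+-cong (Δ^-0 k n) (-‿cong (Δ^-0 k (n ℕ.+ f)))) (-‿inverseʳ (ι 0ℚ))

  Δ^-* : ∀ k x g n → Δ^ k (λ i → x * g i) n ≈ x * Δ^ k g n
  Δ^-* k x g n = begin-equality
    Δ^ k (λ i → x * g i) n   ≈⟨ Δ^-cong k (λ i → +-identityʳ (x * g i)) n ⟨
    Δ^ k (λ i → x * g i + ι 0ℚ) n   ≈⟨ Δ^-linear k x g (λ _ → ι 0ℚ) n ⟩
    x * Δ^ k g n + Δ^ k (λ _ → ι 0ℚ) n     ≈⟨ +-congˡ (Δ^-0 k n) ⟩
    x * Δ^ k g n + ι 0ℚ   ≈⟨ +-identityʳ (x * Δ^ k g n) ⟩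
    x * Δ^ k g n   ∎
    where open ≤R

  Δ^-Σᴿ : ∀ k m (x : ℕ → ℝ) (g : ℕ → ℕ → ℝ) n →
          Δ^ k (λ i → Σᴿ m (λ j → x j * g j i)) n ≈ Σᴿ m (λ j → x j * Δ^ k (g j) n)
  Δ^-Σᴿ k zero    x g n = Δ^-0 k n
  Δ^-Σᴿ k (suc m) x g n = begin-equality
    Δ^ k (λ i → Σᴿ m (λ j → x j * g j i) + x m * g m i) n   ≈⟨ Δ^-cong k (λ i → +-comm _ _) n ⟩
    Δ^ k (λ i → x m * g m i + Σᴿ m (λ j → x j * g j i)) n   ≈⟨ Δ^-linear k (x m) (g m) _ n ⟩
    x m * Δ^ k (g m) n + Δ^ k (λ i → Σᴿ m (λ j → x j * g j i)) n    ≈⟨ +-comm _ _ ⟩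
    Δ^ k (λ i → Σᴿ m (λ j → x j * g j i)) n + x m * Δ^ k (g m) n    ≈⟨ +-congʳ (Δ^-Σᴿ k m x g n) ⟩
    Σᴿ m (λ j → x j * Δ^ k (g j) n) + x m * Δ^ k (g m) n   ∎
    where open ≤R

  Δ^-geometric : ∀ {e g} → (∀ n → g (n ℕ.+ f) ≈ e * g n) → ∀ k n → Δ^ k g n ≈ (ι 1ℚ - e) ^ k * g n
  Δ^-geometric {e} {g} h zero    n = ≈-sym (*-identityˡ (g n))
  Δ^-geometric {e} {g} h (suc k) n = begin-equality
    Δ^ k g n - Δ^ k g (n ℕ.+ f)   ≈⟨ +-cong (Δ^-geometric h k n)
      (-‿cong (≈-trans (Δ^-geometric h k (n ℕ.+ f)) (*-congˡ (h n)))) ⟩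
    w ^ k * g n - w ^ k * (e * g n)   ≈⟨ solve 3
      (λ u e g → u :* g :- u :* (e :* g) := ((con 1ℚ :- e) :* u) :* g) ≈-refl (w ^ k) e (g n) ⟩
    w ^ suc k * g n   ∎
    where
    open ≤R
    w = ι 1ℚ - e

  -- Only the k + 1 points n, n+f, ..., n+kf enter, and the absolute values of the binomial
  -- coefficients add up to 2ᵏ. Being local, the bound may use a B that depends on n.
  Δ^-local : ∀ k g n B → (∀ j → j ℕ.≤ k → ∣ g (n ℕ.+ j ℕ.* f) ∣ ≤ B) → ∣ Δ^ k g n ∣ ≤ ν 2 ^ k * B
  Δ^-local zero    g n B h = begin
    ∣ g n ∣   ≡⟨ cong (λ m → ∣ g m ∣) (ℕ.+-identityʳ n) ⟨
    ∣ g (n ℕ.+ 0) ∣      ≤⟨ h 0 z≤n ⟩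
    B                    ≈⟨ *-identityˡ B ⟨
    ι 1ℚ * B   ∎
    where open ≤R
  Δ^-local (suc k) g n B h = begin
    ∣ Δ^ k g n - Δ^ k g (n ℕ.+ f) ∣   ≤⟨ ∣x-y∣≤∣x∣+∣y∣ _ _ ⟩
    ∣ Δ^ k g n ∣ + ∣ Δ^ k g (n ℕ.+ f) ∣       ≤⟨ +-mono-≤ (Δ^-local k g n B (λ j j≤k → h j (ℕ.m≤n⇒m≤1+n j≤k)))
                                                          (Δ^-local k g (n ℕ.+ f) B (λ j j≤k → subst
                                                            (λ m → ∣ g m ∣ ≤ B) (sym (ℕ.+-assoc n f (j ℕ.* f)))
                                                            (h (suc j) (s≤s j≤k)))) ⟩
    ν 2 ^ k * B + ν 2 ^ k * B   ≈⟨ solve 2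
      (λ u b → u :* b :+ u :* b := (con (fromℕℚ 2) :* u) :* b) ≈-refl (ν 2 ^ k) B ⟩
    ν 2 ^ suc k * B   ∎
    where open ≤R

  -- The majorant of Δᵏ with all signs positive: the sum of binomial(k,j) w(n+jf) over j ≤ k.
  Δ⁺^ : ℕ → (ℕ → ℝ) → ℕ → ℝ
  Δ⁺^ zero    w n = w n
  Δ⁺^ (suc k) w n = Δ⁺^ k w n + Δ⁺^ k w (n ℕ.+ f)

  Δ^-dominated : ∀ k g w B → (∀ n → ∣ g n ∣ ≤ B * w n) → ∀ n → ∣ Δ^ k g n ∣ ≤ B * Δ⁺^ k w n
  Δ^-dominated zero    g w B h n = h n
  Δ^-dominated (suc k) g w B h n = begin
    ∣ Δ^ k g n - Δ^ k g (n ℕ.+ f) ∣   ≤⟨ ∣x-y∣≤∣x∣+∣y∣ _ _ ⟩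
    ∣ Δ^ k g n ∣ + ∣ Δ^ k g (n ℕ.+ f) ∣   ≤⟨ +-mono-≤ (Δ^-dominated k g w B h n)
      (Δ^-dominated k g w B h (n ℕ.+ f)) ⟩
    B * Δ⁺^ k w n + B * Δ⁺^ k w (n ℕ.+ f)   ≈⟨ distribˡ B _ _ ⟨
    B * Δ⁺^ (suc k) w n   ∎
    where open ≤R

-- Differences of y^a (Q - θ y^r) ^ m, where y n = n + x

module Monomials (f : ℕ) (x : ℝ) (0≤x : ι 0ℚ ≤ x) (x≤1 : x ≤ ι 1ℚ) where

  open Differences f

  -- `z` stands in for `y` in upper bounds: it is at least 1 and its inverse is `harm n`, whereas y
  -- 0 = x may vanish.
  y z : ℕ → ℝ
  y n = ν n + x
  z n = ν (suc n)

  ν-+ : ∀ m n → ν (m ℕ.+ n) ≈ ν m + ν n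
  ν-+ m n = subst (λ q → ι q ≈ ν m + ν n) (sym (fromℕℚ-+ m n)) (ι-+ (fromℕℚ m) (fromℕℚ n))

  y-shift : ∀ m n → y (n ℕ.+ m) ≈ y n + ν m
  y-shift m n = ≈-trans (+-congʳ (ν-+ n m)) (solve 3 (λ a b x → (a :+ b) :+ x := (a :+ x) :+ b) ≈-refl (ν n) (ν m) x)

  0≤y : ∀ n → ι 0ℚ ≤ y n
  0≤y n = +-nonNeg (0≤ν n) 0≤x

  ν≤y : ∀ n → ν n ≤ y n
  ν≤y n = x≤x+y 0≤x

  y≤z : ∀ n → y n ≤ z n
  y≤z n = ≤-respʳ (≈-trans (+-comm (ν n) (ι 1ℚ)) (≈-sym (ν-suc n))) (+-mono-≤ ≤-refl x≤1)

  y-mono : ∀ {m n} → m ℕ.≤ n → y m ≤ y n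
  y-mono m≤n = +-mono-≤ (ι-mono (fromℕℚ-mono m≤n)) ≤-refl

  1≤z : ∀ n → ι 1ℚ ≤ z n
  1≤z n = ι-mono (fromℕℚ-mono (s≤s (z≤n {n})))

  0≤z : ∀ n → ι 0ℚ ≤ z n
  0≤z n = 0≤ν (suc n)

  z-shift : ∀ m n → z (n ℕ.+ m) ≤ ν (suc m) * z n
  z-shift m n = ≤-respʳ (≈-trans (subst (λ q → ι q ≈ ι (fromℕℚ (suc m) ℚ.* fromℕℚ (suc n)))
    (sym (fromℕℚ-* (suc m) (suc n))) ≈-refl) (ι-* (fromℕℚ (suc m)) (fromℕℚ (suc n))))
    (ι-mono (fromℕℚ-mono (ℕ.+-monoʳ-≤ (suc n) (ℕ.m≤m*n m (suc n)))))

  z-mono : ∀ m n → z n ≤ z (n ℕ.+ m)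
  z-mono m n = ι-mono (fromℕℚ-mono (s≤s (ℕ.m≤m+n n m)))

  -- The Leibniz rule for a product with `y`: as y is affine, its second differences vanish and a
  -- single correction term survives.
  Δ^-y* : ∀ k g n → Δ^ (suc k) (λ i → y i * g i) n ≈ y n * Δ^ (suc k) g n - ν (suc k) * (ν f * Δ^ k g (n ℕ.+ f))
  Δ^-y* zero g n = ≈-trans (+-congˡ (-‿cong (*-congʳ (y-shift f n))))
    (solve 4 (λ y F a b → y :* a :- (y :+ F) :* b := y :* (a :- b) :- con 1ℚ :* (F :* b)) ≈-refl (y n) (ν f) (g n)
      (g (n ℕ.+ f)))
  Δ^-y* (suc k) g n = begin-equality
    Δ^ (suc k) (λ i → y i * g i) n - Δ^ (suc k) (λ i → y i * g i) (n ℕ.+ f)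
      ≈⟨ +-cong (Δ^-y* k g n) (-‿cong (Δ^-y* k g (n ℕ.+ f))) ⟩
    (y n * Δ^ (suc k) g n - K * (F * Δ^ k g (n ℕ.+ f))) -
      (y (n ℕ.+ f) * Δ^ (suc k) g (n ℕ.+ f) - K * (F * Δ^ k g (n ℕ.+ f ℕ.+ f)))
      ≈⟨ +-congˡ (-‿cong (+-congʳ (*-congʳ (y-shift f n)))) ⟩
    (y n * Δ^ (suc k) g n - K * (F * Δ^ k g (n ℕ.+ f))) -
      ((y n + F) * (Δ^ k g (n ℕ.+ f) - Δ^ k g (n ℕ.+ f ℕ.+ f)) - K * (F * Δ^ k g (n ℕ.+ f ℕ.+ f)))
      ≈⟨ solve 6 (λ y F K a b c → (y :* a :- K :* (F :* b)) :- ((y :+ F) :* (b :- c) :- K :* (F :* c))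
           := y :* (a :- (b :- c)) :- (con 1ℚ :+ K) :* (F :* (b :- c))) ≈-refl
           (y n) F K (Δ^ (suc k) g n) (Δ^ k g (n ℕ.+ f)) (Δ^ k g (n ℕ.+ f ℕ.+ f)) ⟩
    y n * Δ^ (2 ℕ.+ k) g n - (ι 1ℚ + K) * (F * Δ^ (suc k) g (n ℕ.+ f))
      ≈⟨ +-congˡ (-‿cong (*-congʳ (ν-suc (suc k)))) ⟨
    y n * Δ^ (2 ℕ.+ k) g n - ν (2 ℕ.+ k) * (F * Δ^ (suc k) g (n ℕ.+ f)) ∎
    where
    open ≤R
    F = ν f
    K = ν (suc k)

  Δ^-1 : ∀ k n → Δ^ (suc k) (λ _ → ι 1ℚ) n ≈ ι 0ℚ
  Δ^-1 zero    n = -‿inverseʳ (ι 1ℚ)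
  Δ^-1 (suc k) n = ≈-trans (+-cong (Δ^-1 k n) (-‿cong (Δ^-1 k (n ℕ.+ f)))) (-‿inverseʳ (ι 0ℚ))

  Δ^-y^-vanishes : ∀ a k → a ℕ.< k → ∀ n → Δ^ k (λ i → y i ^ a) n ≈ ι 0ℚ
  Δ^-y^-vanishes zero    (suc k) _         n = Δ^-1 k n
  Δ^-y^-vanishes (suc a) (suc k) (s≤s a<k) n = begin-equality
    Δ^ (suc k) (λ i → y i * y i ^ a) n
      ≈⟨ Δ^-y* k (λ i → y i ^ a) n ⟩
    y n * Δ^ (suc k) (λ i → y i ^ a) n - ν (suc k) * (ν f * Δ^ k (λ i → y i ^ a) (n ℕ.+ f))
      ≈⟨ +-cong (*-congˡ (Δ^-y^-vanishes a (suc k) (ℕ.m≤n⇒m≤1+n a<k) n))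
        (-‿cong (*-congˡ (*-congˡ (Δ^-y^-vanishes a k a<k (n ℕ.+ f))))) ⟩
    y n * ι 0ℚ - ν (suc k) * (ν f * ι 0ℚ)
      ≈⟨ solve 3 (λ y K F → y :* con 0ℚ :- K :* (F :* con 0ℚ) := con 0ℚ) ≈-refl (y n) (ν (suc k)) (ν f) ⟩
    ι 0ℚ ∎
    where open ≤R

  opaque
    -- As with derivatives, each difference lowers the order of growth by one; the Leibniz rule
    -- trades a power of y for a difference. The gain is stated by multiplying with zᵏ, which avoids
    -- division and negative exponents.
    Δ^-y^-bound : ∀ a k → ∃[ C ] ι 0ℚ ≤ C × (∀ n → z n ^ k * ∣ Δ^ k (λ i → y i ^ a) n ∣ ≤ C * z n ^ a)
    Δ^-y^-bound a zero = ι 1ℚ , 0≤1 , λ n → *-monoˡ 0≤1 (begin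
      ∣ y n ^ a ∣   ≈⟨ 0≤x⇒∣x∣≈x (^-nonNeg (0≤y n) a) ⟩
      y n ^ a       ≤⟨ ^-mono (0≤y n) (y≤z n) a ⟩
      z n ^ a       ∎)
      where open ≤R
    Δ^-y^-bound zero (suc k) = ι 0ℚ , ≤-refl , λ n → ≈⇒≤ (begin-equality
      z n ^ suc k * ∣ Δ^ (suc k) (λ i → ι 1ℚ) n ∣   ≈⟨ *-congˡ (∣∣-cong (Δ^-1 k n)) ⟩
      z n ^ suc k * ∣ ι 0ℚ ∣   ≈⟨ *-congˡ (0≤x⇒∣x∣≈x ≤-refl) ⟩
      z n ^ suc k * ι 0ℚ   ≈⟨ zeroʳ (z n ^ suc k) ⟩
      ι 0ℚ   ≈⟨ zeroˡ (ι 1ℚ) ⟨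
      ι 0ℚ * ι 1ℚ   ∎)
      where open ≤R
    Δ^-y^-bound (suc a) (suc k) =
      let C₁ , 0≤C₁ , h₁ = Δ^-y^-bound a (suc k)
          C₂ , 0≤C₂ , h₂ = Δ^-y^-bound a k
          K = ν (suc k) * ν f
          -- The Leibniz correction lives at n + f; z (n+f) ≤ (f+1) z n brings its bound back to n
          -- at the price of this factor.
          L = ν (suc f) ^ a
          0≤K = *-nonNeg (0≤ν (suc k)) (0≤ν f)
          0≤L = ^-nonNeg (0≤ν (suc f)) a
      in C₁ + K * (C₂ * L) , +-nonNeg 0≤C₁ (*-nonNeg 0≤K (*-nonNeg 0≤C₂ 0≤L)) , λ n →
      let D  = Δ^ (suc k) (λ i → y i ^ a) n
          D′ = Δ^ k (λ i → y i ^ a) (n ℕ.+ f)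
      in begin
      z n ^ suc k * ∣ Δ^ (suc k) (λ i → y i ^ suc a) n ∣
        ≈⟨ *-congˡ (∣∣-cong (≈-trans (Δ^-y* k (λ i → y i ^ a) n)
          (+-congˡ (-‿cong (≈-sym (*-assoc (ν (suc k)) (ν f) D′)))))) ⟩
      z n ^ suc k * ∣ y n * D - K * D′ ∣
        ≤⟨ *-monoˡ (^-nonNeg (0≤z n) (suc k)) (∣x-y∣≤∣x∣+∣y∣ _ _) ⟩
      z n ^ suc k * (∣ y n * D ∣ + ∣ K * D′ ∣)
        ≈⟨ *-congˡ (+-cong (∣x*y∣≈x*∣y∣ (0≤y n)) (∣x*y∣≈x*∣y∣ 0≤K)) ⟩
      z n ^ suc k * (y n * ∣ D ∣ + K * ∣ D′ ∣)
        ≈⟨ solve 6 (λ z u y d K d′ → (z :* u) :* (y :* d :+ K :* d′) := y :* ((z :* u) :* d) :+ z :*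
          (K :* (u :* d′))) ≈-refl
             (z n) (z n ^ k) (y n) (∣ D ∣) K (∣ D′ ∣) ⟩
      y n * (z n ^ suc k * ∣ D ∣) + z n * (K * (z n ^ k * ∣ D′ ∣))
        ≤⟨ +-mono-≤ (*-mono (0≤z n) (*-nonNeg (^-nonNeg (0≤z n) (suc k)) (0≤∣x∣ D)) (y≤z n) (h₁ n))
             (*-monoˡ (0≤z n) (*-monoˡ 0≤K (begin
               z n ^ k * ∣ D′ ∣   ≤⟨ *-monoʳ (0≤∣x∣ D′) (^-mono (0≤z n) (z-mono f n) k) ⟩
               z (n ℕ.+ f) ^ k * ∣ D′ ∣   ≤⟨ h₂ (n ℕ.+ f) ⟩
               C₂ * z (n ℕ.+ f) ^ a   ≤⟨ *-monoˡ 0≤C₂ (^-mono (0≤z (n ℕ.+ f)) (z-shift f n) a) ⟩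
               C₂ * (ν (suc f) * z n) ^ a   ≈⟨ *-congˡ (^-distrib-* (ν (suc f)) (z n) a) ⟩
               C₂ * (L * z n ^ a)   ∎))) ⟩
      z n * (C₁ * z n ^ a) + z n * (K * (C₂ * (L * z n ^ a)))
        ≈⟨ solve 6 (λ z u C₁ K C₂ L → z :* (C₁ :* u) :+ z :* (K :* (C₂ :* (L :* u))) := (C₁ :+ K :* (C₂ :* L)) :*
          (z :* u)) ≈-refl
             (z n) (z n ^ a) C₁ K C₂ L ⟩
      (C₁ + K * (C₂ * L)) * z n ^ suc a ∎
      where open ≤R

  module _ (r : ℕ) where

    p : ℝ → ℝ → ℕ → ℕ → ℕ → ℝ
    p Q θ a m i = y i ^ a * (Q - θ * y i ^ r) ^ m

    -- Expanding one factor Q - θyʳ raises the exponent of y by r; for this reason the inductions on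
    -- m keep the exponent a free.
    p-suc : ∀ Q θ a m i → p Q θ a (suc m) i ≈ (- θ) * p Q θ (a ℕ.+ r) m i + Q * p Q θ a m i
    p-suc Q θ a m i = ≈-trans
      (solve 5 (λ u t v Q w → u :* ((Q :- t :* v) :* w) := (:- t) :* ((u :* v) :* w) :+ Q :* (u :* w)) ≈-refl
        (y i ^ a) θ (y i ^ r) Q ((Q - θ * y i ^ r) ^ m))
      (+-congʳ (*-congˡ (*-congʳ (≈-sym (^-homo-* (y i) a r)))))

    Δ^-p-suc : ∀ Q θ a m k n → Δ^ k (p Q θ a (suc m)) n ≈ (- θ) * Δ^ k (p Q θ (a ℕ.+ r) m) n + Q * Δ^ k (p Q θ a m) n
    Δ^-p-suc Q θ a m k n = ≈-trans (Δ^-cong k (p-suc Q θ a m) n)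
      (≈-trans (Δ^-linear k (- θ) (p Q θ (a ℕ.+ r) m) (λ i → Q * p Q θ a m i) n) (+-congˡ (Δ^-* k Q (p Q θ a m) n)))

    Δ^-p-vanishes : ∀ Q θ a m k → a ℕ.+ m ℕ.* r ℕ.< k → ∀ n → Δ^ k (p Q θ a m) n ≈ ι 0ℚ
    Δ^-p-vanishes Q θ a zero    k a<k n = ≈-trans (Δ^-cong k (λ i → *-identityʳ (y i ^ a)) n)
      (Δ^-y^-vanishes a k (subst (ℕ._< k) (ℕ.+-identityʳ a) a<k) n)
    Δ^-p-vanishes Q θ a (suc m) k lt n = begin-equality
      Δ^ k (p Q θ a (suc m)) n
        ≈⟨ Δ^-p-suc Q θ a m k n ⟩
      (- θ) * Δ^ k (p Q θ (a ℕ.+ r) m) n + Q * Δ^ k (p Q θ a m) n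
        ≈⟨ +-cong (*-congˡ (Δ^-p-vanishes Q θ (a ℕ.+ r) m k (subst (ℕ._< k) (sym (ℕ.+-assoc a r (m ℕ.* r))) lt) n))
                  (*-congˡ (Δ^-p-vanishes Q θ a m k (ℕ.≤-<-trans (ℕ.+-monoʳ-≤ a (ℕ.m≤n+m (m ℕ.* r) r)) lt) n)) ⟩
      (- θ) * ι 0ℚ + Q * ι 0ℚ
        ≈⟨ solve 2 (λ t Q → (:- t) :* con 0ℚ :+ Q :* con 0ℚ := con 0ℚ) ≈-refl θ Q ⟩
      ι 0ℚ ∎
      where open ≤R

    opaque
      -- Both Q and θyʳ are O(θzʳ), so each of the m factors costs one θzʳ while k differences still
      -- gain z⁻ᵏ. The constant is chosen before Q, θ and n, because Q will depend on θ and n.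
      Δ^-p-bound : ∀ D → ι 0ℚ ≤ D → ∀ a m k → ∃[ C ] ι 0ℚ ≤ C ×
        (∀ Q θ n → ι 0ℚ ≤ θ → ∣ Q ∣ ≤ D * (θ * z n ^ r) →
          z n ^ k * ∣ Δ^ k (p Q θ a m) n ∣ ≤ C * (z n ^ a * (θ * z n ^ r) ^ m))
      Δ^-p-bound D 0≤D a zero k =
        let C , 0≤C , h = Δ^-y^-bound a k in C , 0≤C , λ Q θ n _ _ → begin
        z n ^ k * ∣ Δ^ k (p Q θ a 0) n ∣   ≈⟨ *-congˡ (∣∣-cong (Δ^-cong k (λ i → *-identityʳ (y i ^ a)) n)) ⟩
        z n ^ k * ∣ Δ^ k (λ i → y i ^ a) n ∣       ≤⟨ h n ⟩
        C * z n ^ a   ≈⟨ *-congˡ (*-identityʳ (z n ^ a)) ⟨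
        C * (z n ^ a * ι 1ℚ)   ∎
        where open ≤R
      Δ^-p-bound D 0≤D a (suc m) k =
        let C₁ , 0≤C₁ , h₁ = Δ^-p-bound D 0≤D (a ℕ.+ r) m k
            C₂ , 0≤C₂ , h₂ = Δ^-p-bound D 0≤D a m k
        in C₁ + D * C₂ , +-nonNeg 0≤C₁ (*-nonNeg 0≤D 0≤C₂) , λ Q θ n 0≤θ Q≤ →
        let u  = z n ^ k
            0≤u = ^-nonNeg (0≤z n) k
            v  = z n ^ r
            D₁ = Δ^ k (p Q θ (a ℕ.+ r) m) n
            D₂ = Δ^ k (p Q θ a m) n
            B  = θ * v
            0≤B = *-nonNeg 0≤θ (^-nonNeg (0≤z n) r)
        in begin
        u * ∣ Δ^ k (p Q θ a (suc m)) n ∣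
          ≈⟨ *-congˡ (∣∣-cong (Δ^-p-suc Q θ a m k n)) ⟩
        u * ∣ (- θ) * D₁ + Q * D₂ ∣
          ≤⟨ *-monoˡ 0≤u (∣x+y∣≤∣x∣+∣y∣ _ _) ⟩
        u * (∣ (- θ) * D₁ ∣ + ∣ Q * D₂ ∣)
          ≈⟨ *-congˡ (+-cong (≈-trans (∣x*y∣≈∣x∣*∣y∣ (- θ) D₁) (*-congʳ (≈-trans (∣-x∣≈∣x∣ θ) (0≤x⇒∣x∣≈x 0≤θ))))
            (∣x*y∣≈∣x∣*∣y∣ Q D₂)) ⟩
        u * (θ * ∣ D₁ ∣ + ∣ Q ∣ * ∣ D₂ ∣)
          ≈⟨ solve 5 (λ u t a q b → u :* (t :* a :+ q :* b) := t :* (u :* a) :+ q :* (u :* b)) ≈-refl u θ (∣ D₁ ∣)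
            (∣ Q ∣) (∣ D₂ ∣) ⟩
        θ * (u * ∣ D₁ ∣) + ∣ Q ∣ * (u * ∣ D₂ ∣)
          ≤⟨ +-mono-≤ (*-monoˡ 0≤θ (h₁ Q θ n 0≤θ Q≤))
                      (*-mono (*-nonNeg 0≤D 0≤B) (*-nonNeg 0≤u (0≤∣x∣ D₂)) Q≤ (h₂ Q θ n 0≤θ Q≤)) ⟩
        θ * (C₁ * (z n ^ (a ℕ.+ r) * B ^ m)) + (D * B) * (C₂ * (z n ^ a * B ^ m))
          ≈⟨ +-congʳ (*-congˡ (*-congˡ (*-congʳ (^-homo-* (z n) a r)))) ⟩
        θ * (C₁ * ((z n ^ a * v) * B ^ m)) + (D * B) * (C₂ * (z n ^ a * B ^ m))
          ≈⟨ solve 7 (λ t C₁ w v b D C₂ → t :* (C₁ :* ((w :* v) :* b)) :+ (D :* (t :* v)) :* (C₂ :* (w :* b)) :=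
            (C₁ :+ D :* C₂) :* (w :* ((t :* v) :* b))) ≈-refl
               θ C₁ (z n ^ a) v (B ^ m) D C₂ ⟩
        (C₁ + D * C₂) * (z n ^ a * B ^ suc m) ∎
        where open ≤R

-- Summation by parts against an f-antiperiodic sequence

module Summation (f : ℕ) (c : ℕ → ℝ) (c-antiperiodic : ∀ n → c (n ℕ.+ f) ≈ - c n) where

  open Differences f

  S : (ℕ → ℝ) → ℕ → ℝ
  S g n = Σᴿ n (λ i → c i * g i)

  A : (ℕ → ℝ) → ℝ
  A g = S g f

  -- 2⁻ᵏ M k g is the contribution of the initial segments to the sum of c g
  -- after k summations by parts.

  M : ℕ → (ℕ → ℝ) → ℝ
  M zero    g = ι 0ℚ
  M (suc k) g = ν 2 * M k g + A (Δ^ k g)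

  S-cong : ∀ {g h} → (∀ n → g n ≈ h n) → ∀ n → S g n ≈ S h n
  S-cong eq n = Σᴿ-cong n λ i → *-congˡ (eq i)

  S-linear : ∀ x g h n → S (λ i → x * g i + h i) n ≈ x * S g n + S h n
  S-linear x g h n = ≈-trans
    (Σᴿ-cong n λ i → solve 4 (λ c x g h → c :* (x :* g :+ h) := x :* (c :* g) :+ c :* h) ≈-refl (c i) x (g i) (h i))
    (Σᴿ-linear n x (λ i → c i * g i) (λ i → c i * h i))

  M-cong : ∀ k {g h} → (∀ n → g n ≈ h n) → M k g ≈ M k h
  M-cong zero    eq = ≈-refl
  M-cong (suc k) eq = +-cong (*-congˡ (M-cong k eq)) (S-cong (Δ^-cong k eq) f)

  M-linear : ∀ k x g h → M k (λ i → x * g i + h i) ≈ x * M k g + M k h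
  M-linear zero    x g h = solve 1 (λ x → con 0ℚ := x :* con 0ℚ :+ con 0ℚ) ≈-refl x
  M-linear (suc k) x g h = ≈-trans
    (+-cong (*-congˡ (M-linear k x g h)) (≈-trans (S-cong (Δ^-linear k x g h) f) (S-linear x (Δ^ k g) (Δ^ k h) f)))
    (solve 6 (λ t x a b a′ b′ → t :* (x :* a :+ b) :+ (x :* a′ :+ b′) := x :* (t :* a :+ a′) :+ (t :* b :+ b′)) ≈-refl
      (ν 2) x (M k g) (M k h) (A (Δ^ k g)) (A (Δ^ k h)))

  M-0 : ∀ k → M k (λ _ → ι 0ℚ) ≈ ι 0ℚ
  M-0 k = begin-equality
    M k (λ _ → ι 0ℚ)   ≈⟨ M-cong k
      (λ _ → solve 0 (con 0ℚ := (:- con 1ℚ) :* con 0ℚ :+ con 0ℚ) ≈-refl) ⟩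
    M k (λ _ → - ι 1ℚ * ι 0ℚ + ι 0ℚ)      ≈⟨ M-linear k (- ι 1ℚ) (λ _ → ι 0ℚ) (λ _ → ι 0ℚ) ⟩
    - ι 1ℚ * M₀ + M₀   ≈⟨ solve 1 (λ m → (:- con 1ℚ) :* m :+ m := con 0ℚ) ≈-refl M₀ ⟩
    ι 0ℚ   ∎
    where
    open ≤R
    M₀ = M k (λ _ → ι 0ℚ)

  M-Σᴿ : ∀ k m (x : ℕ → ℝ) (g : ℕ → ℕ → ℝ) → M k (λ i → Σᴿ m (λ j → x j * g j i)) ≈ Σᴿ m (λ j → x j * M k (g j))
  M-Σᴿ k zero    x g = M-0 k
  M-Σᴿ k (suc m) x g = begin-equality
    M k (λ i → Σᴿ m (λ j → x j * g j i) + x m * g m i)   ≈⟨ M-cong k (λ i → +-comm _ _) ⟩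
    M k (λ i → x m * g m i + Σᴿ m (λ j → x j * g j i))   ≈⟨ M-linear k (x m) (g m) _ ⟩
    x m * M k (g m) + M k (λ i → Σᴿ m (λ j → x j * g j i))     ≈⟨ +-comm _ _ ⟩
    M k (λ i → Σᴿ m (λ j → x j * g j i)) + x m * M k (g m)     ≈⟨ +-congʳ (M-Σᴿ k m x g) ⟩
    Σᴿ m (λ j → x j * M k (g j)) + x m * M k (g m)   ∎
    where open ≤R

  M-sub : ∀ k g h → M k (λ i → g i - h i) ≈ M k g - M k h
  M-sub k g h = ≈-trans (M-cong k λ i → solve 2 (λ g h → g :- h := (:- con 1ℚ) :* h :+ g) ≈-refl (g i) (h i))
    (≈-trans (M-linear k (- ι 1ℚ) h g) (solve 2 (λ g h → (:- con 1ℚ) :* h :+ g := g :- h) ≈-refl (M k g) (M k h)))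

  ∣S∣≤ : ∀ (g w : ℕ → ℝ) B → (∀ n → ∣ g n ∣ ≤ B * w n) → ∀ n → ∣ S g n ∣ ≤ Σᴿ n (λ i → ∣ c i ∣ * w i) * B
  ∣S∣≤ g w B h n = begin
    ∣ S g n ∣   ≤⟨ ∣Σᴿ∣≤ n _ ⟩
    Σᴿ n (λ i → ∣ c i * g i ∣)   ≤⟨ Σᴿ-mono n
      (λ i → ≤-trans (≈⇒≤ (∣x*y∣≈∣x∣*∣y∣ (c i) (g i))) (≤-trans (*-monoˡ (0≤∣x∣ (c i)) (h i))
                                                (≈⇒≤ (solve 3 (λ c B w → c :* (B :* w) := B :* (c :* w)) ≈-refl
                                                  (∣ c i ∣) B (w i))))) ⟩
    Σᴿ n (λ i → B * (∣ c i ∣ * w i))       ≈⟨ Σᴿ-* n B _ ⟩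
    B * Σᴿ n (λ i → ∣ c i ∣ * w i)   ≈⟨ *-comm B _ ⟩
    Σᴿ n (λ i → ∣ c i ∣ * w i) * B   ∎
    where open ≤R

  M-const : ℕ → (ℕ → ℝ) → ℝ
  M-const zero    w = ι 0ℚ
  M-const (suc k) w = ν 2 * M-const k w + Σᴿ f (λ i → ∣ c i ∣ * Δ⁺^ k w i)

  -- The weight w may grow at will: M reads finitely many values of g, so nothing has to be
  -- summable.
  ∣M∣≤ : ∀ k (g w : ℕ → ℝ) B → (∀ n → ∣ g n ∣ ≤ B * w n) → ∣ M k g ∣ ≤ M-const k w * B
  ∣M∣≤ zero    g w B h = ≈⇒≤ (≈-trans (0≤x⇒∣x∣≈x ≤-refl) (≈-sym (zeroˡ B)))
  ∣M∣≤ (suc k) g w B h = begin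
    ∣ ν 2 * M k g + A (Δ^ k g) ∣   ≤⟨ ∣x+y∣≤∣x∣+∣y∣ _ _ ⟩
    ∣ ν 2 * M k g ∣ + ∣ A (Δ^ k g) ∣        ≤⟨ +-mono-≤ (≤-trans (≈⇒≤ (∣x*y∣≈x*∣y∣ (0≤ν 2)))
                                                                  (*-monoˡ (0≤ν 2) (∣M∣≤ k g w B h)))
                                                        (∣S∣≤ (Δ^ k g) (Δ⁺^ k w) B (Δ^-dominated k g w B h) f) ⟩
    ν 2 * (M-const k w * B) + Σᴿ f (λ i → ∣ c i ∣ * Δ⁺^ k w i) * B
      ≈⟨ solve 4 (λ t m a B → t :* (m :* B) :+ a :* B := (t :* m :+ a) :* B) ≈-refl (ν 2) (M-const k w)
        (Σᴿ f (λ i → ∣ c i ∣ * Δ⁺^ k w i)) B ⟩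
    M-const (suc k) w * B ∎
    where open ≤R

  -- Here Δ multiplies g by w = 1 - e, so `M k g` is the sum of 2^(k-1-j) wʲ A(g) over j < k. As 1 +
  -- e = 2 - w, multiplying by it telescopes this geometric sum.
  M-geometric : ∀ {e g} → (∀ n → g (n ℕ.+ f) ≈ e * g n) → ∀ k →
                (ι 1ℚ + e) * M k g ≈ (ν 2 ^ k - (ι 1ℚ - e) ^ k) * A g
  M-geometric {e} {g} h zero    = solve 2 (λ e a → (con 1ℚ :+ e) :* con 0ℚ := (con 1ℚ :- con 1ℚ) :* a) ≈-refl e (A g)
  M-geometric {e} {g} h (suc k) = begin-equality
    (ι 1ℚ + e) * (ν 2 * M k g + A (Δ^ k g))
      ≈⟨ *-congˡ (+-congˡ (≈-trans (Σᴿ-cong f λ i → ≈-trans (*-congˡ (Δ^-geometric h k i))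
           (solve 3 (λ c u g → c :* (u :* g) := u :* (c :* g)) ≈-refl (c i) (w ^ k) (g i)))
             (Σᴿ-* f (w ^ k) (λ i → c i * g i)))) ⟩
    (ι 1ℚ + e) * (ν 2 * M k g + w ^ k * A g)
      ≈⟨ solve 5 (λ e t m u a → (con 1ℚ :+ e) :* (t :* m :+ u :* a) := t :* ((con 1ℚ :+ e) :* m) :+ (con 1ℚ :+ e) :*
        (u :* a)) ≈-refl e (ν 2) (M k g) (w ^ k) (A g) ⟩
    ν 2 * ((ι 1ℚ + e) * M k g) + (ι 1ℚ + e) * (w ^ k * A g)
      ≈⟨ +-congʳ (*-congˡ (M-geometric h k)) ⟩
    ν 2 * ((ν 2 ^ k - w ^ k) * A g) + (ι 1ℚ + e) * (w ^ k * A g)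
      ≈⟨ solve 4 (λ e p u a → con (fromℕℚ 2) :* ((p :- u) :* a) :+ (con 1ℚ :+ e) :* (u :* a) :=
        (con (fromℕℚ 2) :* p :- (con 1ℚ :- e) :* u) :* a) ≈-refl
           e (ν 2 ^ k) (w ^ k) (A g) ⟩
    (ν 2 ^ suc k - w ^ suc k) * A g ∎
    where
    open ≤R
    w = ι 1ℚ - e

  -- Antiperiodicity turns -c(i)g(i+f) into c(i+f)g(i+f). So the second half of S(Δg) is the same
  -- sum shifted by f, which lacks precisely the first period A(g).
  S-Δ : ∀ g n → S (Δ g) n ≈ (S g n + S g (n ℕ.+ f)) - A g
  S-Δ g n = begin-equality
    S (Δ g) n
      ≈⟨ Σᴿ-cong n (λ i → ≈-trans (solve 3 (λ c a b → c :* (a :- b) := con 1ℚ :* (c :* a) :+ (:- c) :* b) ≈-refl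
        (c i) (g i) (g (i ℕ.+ f)))
           (+-congˡ (*-congʳ (≈-sym (c-antiperiodic i))))) ⟩
    Σᴿ n (λ i → ι 1ℚ * (c i * g i) + c (i ℕ.+ f) * g (i ℕ.+ f))
      ≈⟨ Σᴿ-linear n (ι 1ℚ) _ _ ⟩
    ι 1ℚ * S g n + T
      ≈⟨ solve 3 (λ s t a → con 1ℚ :* s :+ t := (s :+ (a :+ t)) :- a) ≈-refl (S g n) T (A g) ⟩
    (S g n + (A g + T)) - A g
      ≈⟨ +-congʳ (+-congˡ (Σᴿ-shift n f (λ i → c i * g i))) ⟨
    (S g n + S g (n ℕ.+ f)) - A g ∎
    where
    open ≤R
    T = Σᴿ n (λ i → c (i ℕ.+ f) * g (i ℕ.+ f))

  S-Δ-⟶ : ∀ {g s} → S g ⟶ s → S (Δ g) ⟶ (s + s) - A g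
  S-Δ-⟶ {g} {s} lim ε 0<ε = eventually-map
    (λ { n h → begin
      ∣ S (Δ g) n - ((s + s) - A g) ∣
        ≈⟨ ∣∣-cong (≈-trans (+-congʳ (S-Δ g n))
             (solve 4 (λ a b s t → ((a :+ b) :- t) :- ((s :+ s) :- t) := (a :- s) :+ (b :- s)) ≈-refl (S g n)
               (S g (n ℕ.+ f)) s (A g))) ⟩
      ∣ (S g n - s) + (S g (n ℕ.+ f) - s) ∣
        ≤⟨ ∣x+y∣≤∣x∣+∣y∣ _ _ ⟩
      ∣ S g n - s ∣ + ∣ S g (n ℕ.+ f) - s ∣
        ≤⟨ +-mono-≤ (proj₁ h) (proj₂ h) ⟩
      ι (½ ℚ.* ε) + ι (½ ℚ.* ε)
        ≈⟨ ι-+ (½ ℚ.* ε) (½ ℚ.* ε) ⟨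
      ι (½ ℚ.* ε ℚ.+ ½ ℚ.* ε)
        ≡⟨ cong ι (half+half ε) ⟩
      ι ε ∎ })
    (let N , h = lim (½ ℚ.* ε) (0<half 0<ε) in N , λ n N≤n → h n N≤n , h (n ℕ.+ f) (ℕ.≤-trans N≤n (ℕ.m≤m+n n f)))
    where open ≤R

  S-Δ^-⟶ : ∀ {g s} → S g ⟶ s → ∀ k → S (Δ^ k g) ⟶ ν 2 ^ k * s - M k g
  S-Δ^-⟶ {g} {s} lim zero    = ⟶-cong (λ _ → ≈-refl) (solve 1 (λ s → s := con 1ℚ :* s :- con 0ℚ) ≈-refl s) lim
  S-Δ^-⟶ {g} {s} lim (suc k) = ⟶-cong (λ _ → ≈-refl)
    (solve 4 (λ p s m a → ((p :* s :- m) :+ (p :* s :- m)) :- a := (con (fromℕℚ 2) :* p) :* s :-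
      (con (fromℕℚ 2) :* m :+ a)) ≈-refl
      (ν 2 ^ k) s (M k g) (A (Δ^ k g)))
    (S-Δ-⟶ (S-Δ^-⟶ lim k))

  C₀ : ℝ
  C₀ = Σᴿ f (λ i → ∣ c i ∣)

  0≤C₀ : ι 0ℚ ≤ C₀
  0≤C₀ = Σᴿ-nonNeg f (λ i → 0≤∣x∣ (c i))

  -- |c| has period f, and the sum over one period serves as a bound in place of a maximum.
  ∣c∣≤C₀ : .{{_ : ℕ.NonZero f}} → ∀ n → ∣ c n ∣ ≤ C₀
  ∣c∣≤C₀ = <-rec _ λ n rec → bound n rec (ℕ.<-≤-connex n f)
    where
    open ≤R
    bound : ∀ n → (∀ {m} → m ℕ.< n → ∣ c m ∣ ≤ C₀) → (n ℕ.< f) ⊎ (f ℕ.≤ n) → ∣ c n ∣ ≤ C₀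
    bound n rec (inj₁ n<f) = Σᴿ-term≤ f (λ i → 0≤∣x∣ (c i)) n n<f
    bound n rec (inj₂ f≤n) = begin
      ∣ c n ∣   ≡⟨ cong (λ m → ∣ c m ∣) (ℕ.m∸n+n≡m f≤n) ⟨
      ∣ c (n ℕ.∸ f ℕ.+ f) ∣       ≈⟨ ≈-trans (∣∣-cong (c-antiperiodic (n ℕ.∸ f))) (∣-x∣≈∣x∣ (c (n ℕ.∸ f))) ⟩
      ∣ c (n ℕ.∸ f) ∣   ≤⟨ rec (ℕ.∸-monoʳ-< {n} (ℕ.>-nonZero⁻¹ f) f≤n) ⟩
      C₀   ∎

-- Estimates for n ↦ e^(-θ (n + x) ^ r)

Σᴿ-cong-< : ∀ n {a b} → (∀ k → k ℕ.< n → a k ≈ b k) → Σᴿ n a ≈ Σᴿ n b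
Σᴿ-cong-< zero    h = ≈-refl
Σᴿ-cong-< (suc n) h = +-cong (Σᴿ-cong-< n (λ k k<n → h k (ℕ.m≤n⇒m≤1+n k<n))) (h n ℕ.≤-refl)

-- (1+u)ʲ is at most j! e^(1+u), and e^(-u) cancels all but the constant e. With 1 + u in place of u
-- the bound also serves where u is close to 0.
[1+u]^j*expᴿ[-u]≤ : ∀ j {u} → ι 0ℚ ≤ u → (ι 1ℚ + u) ^ j * expᴿ (- u) ≤ ν (j !) * expᴿ (ι 1ℚ)
[1+u]^j*expᴿ[-u]≤ j {u} 0≤u = begin
  (ι 1ℚ + u) ^ j * expᴿ (- u)   ≤⟨ *-monoʳ (expᴿ-nonNeg (- u)) (x^k≤k!*expᴿ (+-nonNeg 0≤1 0≤u) j) ⟩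
  ν (j !) * expᴿ (ι 1ℚ + u) * expᴿ (- u)        ≈⟨ *-congʳ (*-congˡ (expᴿ-+ (ι 1ℚ) u)) ⟩
  ν (j !) * (expᴿ (ι 1ℚ) * expᴿ u) * expᴿ (- u) ≈⟨ solve 4
    (λ k e v w → k :* (e :* v) :* w := k :* e :* (w :* v)) ≈-refl (ν (j !)) (expᴿ (ι 1ℚ)) (expᴿ u) (expᴿ (- u)) ⟩
  ν (j !) * expᴿ (ι 1ℚ) * (expᴿ (- u) * expᴿ u) ≈⟨ *-congˡ (expᴿ-inverse u) ⟩
  ν (j !) * expᴿ (ι 1ℚ) * ι 1ℚ   ≈⟨ *-identityʳ _ ⟩
  ν (j !) * expᴿ (ι 1ℚ)   ∎
  where open ≤R

opaque
  -- A mean value estimate for the r-th power: Yʳ - yʳ = O((Y-y)zʳ⁻¹). The extra factor z avoids the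
  -- exponent r - 1, so that r = 0 can start the induction.
  power-gap : ∀ D d r → ι 0ℚ ≤ D → ι 0ℚ ≤ d → ∃[ C ] ι 0ℚ ≤ C ×
    (∀ z y Y → ι 0ℚ ≤ z → ι 0ℚ ≤ y → y ≤ Y → Y ≤ D * z → Y - y ≤ d → z * (Y ^ r - y ^ r) ≤ C * z ^ r)
  power-gap D d zero    0≤D 0≤d = ι 0ℚ , ≤-refl , λ z y Y _ _ _ _ _ →
    ≈⇒≤ (solve 1 (λ z → z :* (con 1ℚ :- con 1ℚ) := con 0ℚ :* con 1ℚ) ≈-refl z)
  power-gap D d (suc r) 0≤D 0≤d =
    let C , 0≤C , h = power-gap D d r 0≤D 0≤d
    in D * C + d * D ^ r , +-nonNeg (*-nonNeg 0≤D 0≤C)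
      (*-nonNeg 0≤d (^-nonNeg 0≤D r)) , λ z y Y 0≤z 0≤y y≤Y Y≤Dz Y-y≤d →
    let 0≤Dz = *-nonNeg 0≤D 0≤z
        0≤Y  = ≤-trans 0≤y y≤Y
    in begin
    z * (Y ^ suc r - y ^ suc r)
      ≈⟨ solve 5 (λ z Y y U u → z :* (Y :* U :- y :* u) := Y :* (z :* (U :- u)) :+ (Y :- y) :*
        (z :* u)) ≈-refl z Y y (Y ^ r) (y ^ r) ⟩
    Y * (z * (Y ^ r - y ^ r)) + (Y - y) * (z * y ^ r)
      ≤⟨ +-mono-≤ (*-mono 0≤Dz (*-nonNeg 0≤z (x≤y⇒0≤y-x (^-mono 0≤y y≤Y r))) Y≤Dz (h z y Y 0≤z 0≤y y≤Y Y≤Dz Y-y≤d))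
                  (*-mono 0≤d (*-nonNeg 0≤z (^-nonNeg 0≤y r)) Y-y≤d (*-monoˡ 0≤z (^-mono 0≤y (≤-trans y≤Y Y≤Dz) r))) ⟩
    (D * z) * (C * z ^ r) + d * (z * (D * z) ^ r)
      ≈⟨ +-congˡ (*-congˡ (*-congˡ (^-distrib-* D z r))) ⟩
    (D * z) * (C * z ^ r) + d * (z * (D ^ r * z ^ r))
      ≈⟨ solve 6 (λ D z C u d E → (D :* z) :* (C :* u) :+ d :* (z :* (E :* u)) := (D :* C :+ d :* E) :*
        (z :* u)) ≈-refl D z C (z ^ r) d (D ^ r) ⟩
    (D * C + d * D ^ r) * z ^ suc r ∎
    where open ≤R

harm*z : ∀ n → ι (harm n) * ν (suc n) ≈ ι 1ℚ
harm*z n = ≈-trans (≈-sym (ι-* (harm n) (fromℕℚ (suc n))))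
  (subst (λ q → ι q ≈ ι 1ℚ) (sym (trans (ℚ.*-comm (harm n) (fromℕℚ (suc n))) (fromℕℚ-*-harm n))) ≈-refl)

harm*harm≤2harm² : ∀ n → ι (harm n) * ι (harm n) ≤ ν 2 * harm² n
harm*harm≤2harm² n = begin
  ι h * ι h   ≤⟨ *-monoˡ (ι-mono (0≤/ 1 (suc n))) (ι-mono h≤2h′) ⟩
  ι h * ι (fromℕℚ 2 ℚ.* h′)    ≈⟨ *-congˡ (ι-* (fromℕℚ 2) h′) ⟩
  ι h * (ν 2 * ι h′)      ≈⟨ solve 3 (λ h t k → h :* (t :* k) := t :* (h :* k)) ≈-refl (ι h) (ν 2) (ι h′) ⟩
  ν 2 * (ι h * ι h′)      ≈⟨ *-congˡ (ι-* h h′) ⟨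
  ν 2 * ι (h ℚ.* h′)      ≡⟨ cong (λ q → ν 2 * ι q) (harm-difference n) ⟨
  ν 2 * harm² n   ∎
  where
  open ≤R
  h = harm n
  h′ = harm (suc n)
  h≤2h′ : h ℚ.≤ fromℕℚ 2 ℚ.* h′
  h≤2h′ = subst (h ℚ.≤_) (sym (fromℕℚ-*-/ 2 1 (suc (suc n))))
    (/-≤ 1 (suc n) 2 (suc (suc n)) (ℕ.≤-trans (ℕ.≤-reflexive (ℕ.*-identityˡ (suc (suc n))))
      (ℕ.≤-trans (s≤s (ℕ.≤-trans (s≤s (ℕ.m≤m+n n (n ℕ.+ 0))) (ℕ.≤-reflexive (sym (ℕ.+-suc n (n ℕ.+ 0)))))) ℕ.≤-refl)))

module Decay (f : ℕ) (x : ℝ) (0≤x : ι 0ℚ ≤ x) (x≤1 : x ≤ ι 1ℚ) (r : ℕ) where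

  open Differences f
  open Monomials f x 0≤x x≤1

  q φ : ℝ → ℕ → ℝ
  q θ n = θ * y n ^ r
  φ θ n = expᴿ (- q θ n)

  0≤q : ∀ {θ} → ι 0ℚ ≤ θ → ∀ n → ι 0ℚ ≤ q θ n
  0≤q 0≤θ n = *-nonNeg 0≤θ (^-nonNeg (0≤y n) r)

  q-mono : ∀ {θ} → ι 0ℚ ≤ θ → ∀ {m n} → m ℕ.≤ n → q θ m ≤ q θ n
  q-mono 0≤θ {m} m≤n = *-monoˡ 0≤θ (^-mono (0≤y m) (y-mono m≤n) r)

  -- The common scale of the estimates in this module; `q` itself does not serve, as it may vanish
  -- at n = 0.
  B : ℝ → ℕ → ℝ
  B θ n = θ * z n ^ r

  0≤B : ∀ {θ} → ι 0ℚ ≤ θ → ∀ n → ι 0ℚ ≤ B θ n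
  0≤B 0≤θ n = *-nonNeg 0≤θ (^-nonNeg (0≤z n) r)

  z-double : ∀ n → z (suc n) ≤ ν 2 * ν (suc n)
  z-double n = subst (λ m → z m ≤ ν 2 * z n) (ℕ.+-comm n 1) (z-shift 1 n)

  -- For n ≥ 1 one has n + 1 ≤ 2n ≤ 2y(n). At n = 0, where y may vanish, the summand 1 takes over.
  z^r≤ : ∀ n → z n ^ r ≤ ν 2 ^ r * (ι 1ℚ + y n ^ r)
  z^r≤ zero = begin
    z 0 ^ r   ≤⟨ ^-mono (0≤z 0) (ι-mono (fromℕℚ-mono {1} {2} (s≤s z≤n))) r ⟩
    ν 2 ^ r   ≈⟨ *-identityʳ (ν 2 ^ r) ⟨
    ν 2 ^ r * ι 1ℚ   ≤⟨ *-monoˡ (^-nonNeg (0≤ν 2) r) (x≤x+y (^-nonNeg (0≤y 0) r)) ⟩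
    ν 2 ^ r * (ι 1ℚ + y 0 ^ r)       ∎
    where open ≤R
  z^r≤ (suc n) = begin
    z (suc n) ^ r   ≤⟨ ^-mono (0≤z (suc n)) (z-double n) r ⟩
    (ν 2 * ν (suc n)) ^ r   ≈⟨ ^-distrib-* (ν 2) (ν (suc n)) r ⟩
    ν 2 ^ r * ν (suc n) ^ r   ≤⟨ *-monoˡ (^-nonNeg (0≤ν 2) r)
      (≤-trans (^-mono (0≤ν (suc n)) (ν≤y (suc n)) r) (y≤x+y 0≤1)) ⟩
    ν 2 ^ r * (ι 1ℚ + y (suc n) ^ r) ∎
    where open ≤R

  opaque
    -- B is at most 2ʳ(θ + q) ≤ 2ʳ(1 + q), where θ ≤ 1 enters, and e^(-q) absorbs powers of 1 + q.
    -- Since q increases, φ may be evaluated at any i ≥ n while B stays at n. The constant does not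
    -- depend on θ or n.
    damping : ∀ j → ∃[ C ] ι 0ℚ ≤ C × (∀ θ → ι 0ℚ ≤ θ → θ ≤ ι 1ℚ → ∀ n i → n ℕ.≤ i → B θ n ^ j * φ θ i ≤ C)
    damping j = (ν 2 ^ r) ^ j * (ν (j !) * expᴿ (ι 1ℚ))
      , *-nonNeg (^-nonNeg (^-nonNeg (0≤ν 2) r) j) (*-nonNeg (0≤ν (j !)) (expᴿ-nonNeg (ι 1ℚ)))
      , λ θ 0≤θ θ≤1 n i n≤i → begin
      B θ n ^ j * φ θ i
        ≤⟨ *-monoˡ (^-nonNeg (0≤B 0≤θ n) j) (expᴿ-mono (-‿antimono-≤ (q-mono 0≤θ n≤i))) ⟩
      B θ n ^ j * φ θ n
        ≤⟨ *-monoʳ (expᴿ-nonNeg _) (^-mono (0≤B 0≤θ n) (begin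
             θ * z n ^ r   ≤⟨ *-monoˡ 0≤θ (z^r≤ n) ⟩
             θ * (ν 2 ^ r * (ι 1ℚ + y n ^ r))       ≈⟨ solve 3
               (λ t p w → t :* (p :* (con 1ℚ :+ w)) := p :* (t :+ t :* w)) ≈-refl θ (ν 2 ^ r) (y n ^ r) ⟩
             ν 2 ^ r * (θ + q θ n)   ≤⟨ *-monoˡ (^-nonNeg (0≤ν 2) r) (+-mono-≤ θ≤1 ≤-refl) ⟩
             ν 2 ^ r * (ι 1ℚ + q θ n)   ∎) j) ⟩
      (ν 2 ^ r * (ι 1ℚ + q θ n)) ^ j * φ θ n
        ≈⟨ ≈-trans (*-congʳ (^-distrib-* (ν 2 ^ r) (ι 1ℚ + q θ n) j)) (*-assoc _ _ _) ⟩
      (ν 2 ^ r) ^ j * ((ι 1ℚ + q θ n) ^ j * φ θ n)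
        ≤⟨ *-monoˡ (^-nonNeg (^-nonNeg (0≤ν 2) r) j) ([1+u]^j*expᴿ[-u]≤ j (0≤q 0≤θ n)) ⟩
      (ν 2 ^ r) ^ j * (ν (j !) * expᴿ (ι 1ℚ)) ∎
      where open ≤R

    -- The exponential pays for b powers of B and leaves a of them; it is applied with a = N + 1,
    -- the power that carries θᴺ⁺¹.
    damping-+ : ∀ a b → ∃[ C ] ι 0ℚ ≤ C × (∀ θ → ι 0ℚ ≤ θ → θ ≤ ι 1ℚ → ∀ n i → n ℕ.≤ i → B θ n ^
      (a ℕ.+ b) * φ θ i ≤ C * B θ n ^ a)
    damping-+ a b = let C , 0≤C , h = damping b in C , 0≤C , λ θ 0≤θ θ≤1 n i n≤i → begin
      B θ n ^ (a ℕ.+ b) * φ θ i   ≈⟨ *-congʳ (^-homo-* (B θ n) a b) ⟩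
      (B θ n ^ a * B θ n ^ b) * φ θ i   ≈⟨ *-assoc _ _ _ ⟩
      B θ n ^ a * (B θ n ^ b * φ θ i)   ≤⟨ *-monoˡ (^-nonNeg (0≤B 0≤θ n) a) (h θ 0≤θ θ≤1 n i n≤i) ⟩
      B θ n ^ a * C   ≈⟨ *-comm _ _ ⟩
      C * B θ n ^ a   ∎
      where open ≤R

  -- φ is expanded about the last of the points n, n+f, …, n+K f, so that the
  -- exponents v below are nonnegative and e^(-Q) e^v is again a value of φ.

  module _ (K N : ℕ) (N*r<K : N ℕ.* r ℕ.< K) (N<K : N ℕ.< K) where

    Q : ℝ → ℕ → ℝ
    Q θ n = q θ (n ℕ.+ K ℕ.* f)

    v : ℝ → ℕ → ℕ → ℝ
    v θ n i = Q θ n - q θ i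

    W : ℝ → ℕ → ℝ
    W θ n = z n ^ K * expᴿ (- Q θ n)

    0≤W : ∀ θ n → ι 0ℚ ≤ W θ n
    0≤W θ n = *-nonNeg (^-nonNeg (0≤z n) K) (expᴿ-nonNeg _)

    D : ℝ
    D = ν (suc (K ℕ.* f))

    Y≤Dz : ∀ n → y (n ℕ.+ K ℕ.* f) ≤ D * z n
    Y≤Dz n = ≤-trans (y≤z (n ℕ.+ K ℕ.* f)) (z-shift (K ℕ.* f) n)

    n≤n+Kf : ∀ n → n ℕ.≤ n ℕ.+ K ℕ.* f
    n≤n+Kf n = ℕ.m≤m+n n (K ℕ.* f)

    Q-bound : ∀ θ → ι 0ℚ ≤ θ → ∀ n → ∣ Q θ n ∣ ≤ D ^ r * B θ n
    Q-bound θ 0≤θ n = begin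
      ∣ Q θ n ∣   ≈⟨ 0≤x⇒∣x∣≈x (0≤q 0≤θ (n ℕ.+ K ℕ.* f)) ⟩
      θ * y (n ℕ.+ K ℕ.* f) ^ r   ≤⟨ *-monoˡ 0≤θ (^-mono (0≤y (n ℕ.+ K ℕ.* f)) (Y≤Dz n) r) ⟩
      θ * (D * z n) ^ r   ≈⟨ *-congˡ (^-distrib-* D (z n) r) ⟩
      θ * (D ^ r * z n ^ r)   ≈⟨ solve 3 (λ t d w → t :* (d :* w) := d :* (t :* w)) ≈-refl θ (D ^ r)
        (z n ^ r) ⟩
      D ^ r * B θ n   ∎
      where open ≤R

    opaque
      -- With n frozen, v^m is a polynomial in y(i) of degree mr. If m ≤ N this degree is below K
      -- and the K-th difference is zero. If m > N the difference is of order z⁻ᴷBᵐ, and the factor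
      -- e^(-Q) in W reduces Bᵐ to Bᴺ⁺¹.
      polynomial-part : ∀ m → ∃[ C ] ι 0ℚ ≤ C × (∀ θ → ι 0ℚ ≤ θ → θ ≤ ι 1ℚ → ∀ n →
        W θ n * ∣ Δ^ K (λ i → v θ n i ^ m) n ∣ ≤ C * B θ n ^ suc N)
      polynomial-part m with ℕ.<-≤-connex N m
      ... | inj₂ m≤N = ι 0ℚ , ≤-refl , λ θ _ _ n → ≈⇒≤ (begin-equality
        W θ n * ∣ Δ^ K (λ i → v θ n i ^ m) n ∣       ≈⟨ *-congˡ
          (∣∣-cong (≈-trans (Δ^-cong K (λ i → ≈-sym (*-identityˡ _)) n)
                                                          (Δ^-p-vanishes r (Q θ n) θ 0 m K
                                                            (ℕ.≤-<-trans (ℕ.*-monoˡ-≤ r m≤N) N*r<K) n))) ⟩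
        W θ n * ∣ ι 0ℚ ∣   ≈⟨ *-congˡ (0≤x⇒∣x∣≈x ≤-refl) ⟩
        W θ n * ι 0ℚ   ≈⟨ zeroʳ _ ⟩
        ι 0ℚ   ≈⟨ zeroˡ _ ⟨
        ι 0ℚ * B θ n ^ suc N   ∎)
        where open ≤R
      ... | inj₁ N<m =
        let C₁ , 0≤C₁ , h₁ = Δ^-p-bound r (D ^ r) (^-nonNeg (0≤ν (suc (K ℕ.* f))) r) 0 m K
            C₂ , 0≤C₂ , h₂ = damping-+ (suc N) (m ℕ.∸ suc N)
        in C₁ * C₂ , *-nonNeg 0≤C₁ 0≤C₂ , λ θ 0≤θ θ≤1 n →
        let e = expᴿ (- Q θ n)
            b = B θ n
        in begin
        W θ n * ∣ Δ^ K (λ i → v θ n i ^ m) n ∣   ≈⟨ *-congˡ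
          (∣∣-cong (Δ^-cong K (λ i → ≈-sym (*-identityˡ _)) n)) ⟩
        (z n ^ K * e) * ∣ Δ^ K (p r (Q θ n) θ 0 m) n ∣   ≈⟨ solve 3
          (λ u e d → (u :* e) :* d := e :* (u :* d)) ≈-refl (z n ^ K) e _ ⟩
        e * (z n ^ K * ∣ Δ^ K (p r (Q θ n) θ 0 m) n ∣)   ≤⟨ *-monoˡ (expᴿ-nonNeg _)
          (h₁ (Q θ n) θ n 0≤θ (Q-bound θ 0≤θ n)) ⟩
        e * (C₁ * (ι 1ℚ * b ^ m))   ≈⟨ solve 3
          (λ e C b → e :* (C :* (con 1ℚ :* b)) := C :* (b :* e)) ≈-refl e C₁ (b ^ m) ⟩
        C₁ * (b ^ m * e)   ≡⟨ cong (λ m → C₁ * (b ^ m * e)) (ℕ.m+[n∸m]≡n N<m) ⟨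
        C₁ * (b ^ (suc N ℕ.+ (m ℕ.∸ suc N)) * e)   ≤⟨ *-monoˡ 0≤C₁
          (h₂ θ 0≤θ θ≤1 n (n ℕ.+ K ℕ.* f) (n≤n+Kf n)) ⟩
        C₁ * (C₂ * b ^ suc N)   ≈⟨ *-assoc C₁ C₂ _ ⟨
        (C₁ * C₂) * b ^ suc N   ∎
        where open ≤R

      -- Taylor's remainder is at most vᴷe^v, and W supplies zᴷ to match: `power-gap` gives zv ≤ GB
      -- at each of the K + 1 points, so zᴷvᴷ is O(Bᴷ) and damping cuts this down to Bᴺ⁺¹. No
      -- cancellation between the points is used.
      remainder : ∃[ C ] ι 0ℚ ≤ C × (∀ θ → ι 0ℚ ≤ θ → θ ≤ ι 1ℚ → ∀ n →
        ∣ Δ^ K (λ i → W θ n * (expᴿ (v θ n i) - taylor K (v θ n i))) n ∣ ≤ C * B θ n ^ suc N)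
      remainder =
        let G , 0≤G , g = power-gap D (ν (K ℕ.* f)) r (0≤ν (suc (K ℕ.* f))) (0≤ν (K ℕ.* f))
            C , 0≤C , h = damping-+ (suc N) (K ℕ.∸ suc N)
        in ν 2 ^ K * (G ^ K * C) , *-nonNeg (^-nonNeg (0≤ν 2) K) (*-nonNeg (^-nonNeg 0≤G K) 0≤C) , λ θ 0≤θ θ≤1 n →
        let b = B θ n
            e = expᴿ (- Q θ n)
        in begin
        ∣ Δ^ K (λ i → W θ n * (expᴿ (v θ n i) - taylor K (v θ n i))) n ∣
          ≤⟨ Δ^-local K _ n ((G ^ K * C) * b ^ suc N) (λ j j≤K →
               let i    = n ℕ.+ j ℕ.* f
                   i≤   = ℕ.+-monoʳ-≤ n (ℕ.*-monoˡ-≤ f j≤K)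
                   w    = v θ n i
                   0≤w  = x≤y⇒0≤y-x (q-mono 0≤θ i≤)
               in begin
               ∣ W θ n * (expᴿ w - taylor K w) ∣
                 ≈⟨ ∣x*y∣≈x*∣y∣ (0≤W θ n) ⟩
               W θ n * ∣ expᴿ w - taylor K w ∣
                 ≤⟨ *-monoˡ (0≤W θ n) (expᴿ-taylor K w) ⟩
               W θ n * (∣ w ∣ ^ K * expᴿ ∣ w ∣)
                 ≈⟨ *-congˡ (*-cong (^-congˡ K (0≤x⇒∣x∣≈x 0≤w)) (expᴿ-cong (0≤x⇒∣x∣≈x 0≤w))) ⟩
               (z n ^ K * e) * (w ^ K * expᴿ w)
                 ≈⟨ solve 4 (λ u e w t → (u :* e) :* (w :* t) := (u :* w) :* (e :* t)) ≈-refl (z n ^ K) e (w ^ K)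
                   (expᴿ w) ⟩
               (z n ^ K * w ^ K) * (e * expᴿ w)
                 ≈⟨ *-cong (≈-sym (^-distrib-* (z n) w K))
                   (≈-trans (≈-sym (expᴿ-+ _ _)) (expᴿ-cong
                   (solve 2 (λ Q q → :- Q :+ (Q :- q) := :- q) ≈-refl (Q θ n) (q θ i)))) ⟩
               (z n * w) ^ K * φ θ i
                 ≤⟨ *-monoʳ (expᴿ-nonNeg _) (^-mono (*-nonNeg (0≤z n) 0≤w) (begin
                      z n * (θ * y (n ℕ.+ K ℕ.* f) ^ r - θ * y i ^ r)
                        ≈⟨ solve 4 (λ z t a b → z :* (t :* a :- t :* b) := t :* (z :* (a :- b))) ≈-refl (z n) θ
                          (y (n ℕ.+ K ℕ.* f) ^ r) (y i ^ r) ⟩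
                      θ * (z n * (y (n ℕ.+ K ℕ.* f) ^ r - y i ^ r))
                        ≤⟨ *-monoˡ 0≤θ (g (z n) (y i) (y (n ℕ.+ K ℕ.* f)) (0≤z n) (0≤y i) (y-mono i≤) (Y≤Dz n)
                          (gap n j)) ⟩
                      θ * (G * z n ^ r)
                        ≈⟨ solve 3 (λ t G w → t :* (G :* w) := G :* (t :* w)) ≈-refl θ G (z n ^ r) ⟩
                      G * b ∎) K) ⟩
               (G * b) ^ K * φ θ i
                 ≈⟨ ≈-trans (*-congʳ (^-distrib-* G b K)) (*-assoc _ _ _) ⟩
               G ^ K * (b ^ K * φ θ i)
                 ≡⟨ cong (λ k → G ^ K * (b ^ k * φ θ i)) (ℕ.m+[n∸m]≡n N<K) ⟨
               G ^ K * (b ^ (suc N ℕ.+ (K ℕ.∸ suc N)) * φ θ i)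
                 ≤⟨ *-monoˡ (^-nonNeg 0≤G K) (h θ 0≤θ θ≤1 n i (ℕ.m≤m+n n (j ℕ.* f))) ⟩
               G ^ K * (C * b ^ suc N)
                 ≈⟨ *-assoc _ _ _ ⟨
               (G ^ K * C) * b ^ suc N ∎) ⟩
        ν 2 ^ K * ((G ^ K * C) * b ^ suc N)
          ≈⟨ *-assoc _ _ _ ⟨
        (ν 2 ^ K * (G ^ K * C)) * b ^ suc N ∎
        where
        open ≤R
        gap : ∀ n j → y (n ℕ.+ K ℕ.* f) - y (n ℕ.+ j ℕ.* f) ≤ ν (K ℕ.* f)
        gap n j = begin
          y (n ℕ.+ K ℕ.* f) - y (n ℕ.+ j ℕ.* f)     ≤⟨ +-mono-≤ ≤-refl (-‿antimono-≤ (y-mono (ℕ.m≤m+n n (j ℕ.* f)))) ⟩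
          y (n ℕ.+ K ℕ.* f) - y n   ≈⟨ +-congʳ (y-shift (K ℕ.* f) n) ⟩
          (y n + ν (K ℕ.* f)) - y n   ≈⟨ solve 2 (λ y k → (y :+ k) :- y := k) ≈-refl (y n) (ν (K ℕ.* f)) ⟩
          ν (K ℕ.* f)   ∎

    φ-expansion : ∀ θ n i → z n ^ K * φ θ i ≈
      W θ n * (expᴿ (v θ n i) - taylor K (v θ n i)) + Σᴿ K (λ m → (W θ n * ι (1/! m)) * v θ n i ^ m)
    φ-expansion θ n i = begin-equality
      z n ^ K * φ θ i
        ≈⟨ *-congˡ (≈-trans (expᴿ-cong (solve 2 (λ Q q → :- q := :- Q :+ (Q :- q)) ≈-refl (Q θ n) (q θ i)))
          (expᴿ-+ _ _)) ⟩
      z n ^ K * (expᴿ (- Q θ n) * expᴿ (v θ n i))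
        ≈⟨ solve 4 (λ u e w t → u :* (e :* w) := (u :* e) :* (w :- t) :+ (u :* e) :* t) ≈-refl (z n ^ K)
          (expᴿ (- Q θ n)) (expᴿ (v θ n i)) (taylor K (v θ n i)) ⟩
      W θ n * (expᴿ (v θ n i) - taylor K (v θ n i)) + W θ n * taylor K (v θ n i)
        ≈⟨ +-congˡ (≈-trans (Σᴿ-cong K λ m → *-assoc (W θ n) (ι (1/! m)) (v θ n i ^ m))
          (Σᴿ-* K (W θ n) (λ m → ι (1/! m) * v θ n i ^ m))) ⟨
      W θ n * (expᴿ (v θ n i) - taylor K (v θ n i)) + Σᴿ K (λ m → (W θ n * ι (1/! m)) * v θ n i ^ m) ∎
      where open ≤R

    opaque
      Δ^-φ-bound : ∃[ C ] ι 0ℚ ≤ C × (∀ θ → ι 0ℚ ≤ θ → θ ≤ ι 1ℚ → ∀ n → z n ^ K * ∣ Δ^ K (φ θ) n ∣ ≤ C * B θ n ^ suc N)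
      Δ^-φ-bound =
        let C₁ , 0≤C₁ , h₁ = remainder
            P : ℕ → ℝ
            P m = proj₁ (polynomial-part m)
            C₂ = Σᴿ K (λ m → ι (1/! m) * P m)
        in C₁ + C₂ , +-nonNeg 0≤C₁ (Σᴿ-nonNeg K λ m → *-nonNeg (ι-mono (0≤1/! m))
          (proj₁ (proj₂ (polynomial-part m)))) , λ θ 0≤θ θ≤1 n →
        let b = B θ n ^ suc N
            R = λ i → W θ n * (expᴿ (v θ n i) - taylor K (v θ n i))
            T = λ i → Σᴿ K (λ m → (W θ n * ι (1/! m)) * v θ n i ^ m)
        in begin
        z n ^ K * ∣ Δ^ K (φ θ) n ∣
          ≈⟨ ∣x*y∣≈x*∣y∣ (^-nonNeg (0≤z n) K) ⟨
        ∣ z n ^ K * Δ^ K (φ θ) n ∣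
          ≈⟨ ∣∣-cong (begin-equality
               z n ^ K * Δ^ K (φ θ) n   ≈⟨ Δ^-* K (z n ^ K) (φ θ) n ⟨
               Δ^ K (λ i → z n ^ K * φ θ i) n   ≈⟨ Δ^-cong K
                 (λ i → ≈-trans (φ-expansion θ n i) (+-congʳ (≈-sym (*-identityˡ _)))) n ⟩
               Δ^ K (λ i → ι 1ℚ * R i + T i) n   ≈⟨ Δ^-linear K (ι 1ℚ) R T n ⟩
               ι 1ℚ * Δ^ K R n + Δ^ K T n   ≈⟨ +-cong (*-identityˡ _)
                 (Δ^-Σᴿ K K (λ m → W θ n * ι (1/! m)) (λ m i → v θ n i ^ m) n) ⟩
               Δ^ K R n + Σᴿ K (λ m → (W θ n * ι (1/! m)) * Δ^ K (λ i → v θ n i ^ m) n) ∎) ⟩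
        ∣ Δ^ K R n + Σᴿ K (λ m → (W θ n * ι (1/! m)) * Δ^ K (λ i → v θ n i ^ m) n) ∣
          ≤⟨ ≤-trans (∣x+y∣≤∣x∣+∣y∣ _ _) (+-mono-≤ (h₁ θ 0≤θ θ≤1 n) (≤-trans (∣Σᴿ∣≤ K _) (Σᴿ-mono K λ m → begin
               ∣ (W θ n * ι (1/! m)) * Δ^ K (λ i → v θ n i ^ m) n ∣
                 ≈⟨ ∣x*y∣≈x*∣y∣ (*-nonNeg (0≤W θ n) (ι-mono (0≤1/! m))) ⟩
               (W θ n * ι (1/! m)) * ∣ Δ^ K (λ i → v θ n i ^ m) n ∣
                 ≈⟨ solve 3 (λ w k d → (w :* k) :* d := k :* (w :* d)) ≈-refl (W θ n) (ι (1/! m)) _ ⟩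
               ι (1/! m) * (W θ n * ∣ Δ^ K (λ i → v θ n i ^ m) n ∣)
                 ≤⟨ *-monoˡ (ι-mono (0≤1/! m)) (proj₂ (proj₂ (polynomial-part m)) θ 0≤θ θ≤1 n) ⟩
               ι (1/! m) * (P m * b)
                 ≈⟨ solve 3 (λ k P b → k :* (P :* b) := b :* (k :* P)) ≈-refl (ι (1/! m)) (P m) b ⟩
               b * (ι (1/! m) * P m) ∎))) ⟩
        C₁ * b + Σᴿ K (λ m → b * (ι (1/! m) * P m))
          ≈⟨ +-congˡ (≈-trans (Σᴿ-* K b _) (*-comm b C₂)) ⟩
        C₁ * b + C₂ * b
          ≈⟨ distribʳ b C₁ C₂ ⟨
        (C₁ + C₂) * b ∎
        where open ≤R

  opaque
    -- Bᴺ⁺¹ carries z to the power (N+1)r, which cancels all but two of the K factors 1/z; the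
    -- remaining z⁻² is at most 2 `harm²`.
    Δ^-φ-summable : .{{_ : ℕ.NonZero r}} → ∀ N → ∃[ C ] ι 0ℚ ≤ C × (∀ θ → ι 0ℚ ≤ θ → θ ≤ ι 1ℚ → ∀ n →
      ∣ Δ^ (2 ℕ.+ suc N ℕ.* r) (φ θ) n ∣ ≤ (C * θ ^ suc N) * harm² n)
    Δ^-φ-summable N =
      let C , 0≤C , h = Δ^-φ-bound K N N*r<K N<K
      in C * ν 2 , *-nonNeg 0≤C (0≤ν 2) , λ θ 0≤θ θ≤1 n →
      let ζ = ι (harm n)
          0≤ζ = ι-mono (0≤/ 1 (suc n))
          d = ∣ Δ^ K (φ θ) n ∣
          t = θ ^ suc N
          ζz : ∀ k → ζ ^ k * z n ^ k ≈ ι 1ℚ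
          ζz k = ≈-trans (≈-sym (^-distrib-* ζ (z n) k)) (≈-trans (^-congˡ k (harm*z n)) (1^ k))
      in begin
      d                                             ≈⟨ ≈-trans (*-congʳ (ζz K)) (*-identityˡ d) ⟨
      (ζ ^ K * z n ^ K) * d   ≈⟨ *-assoc _ _ _ ⟩
      ζ ^ K * (z n ^ K * d)   ≤⟨ *-monoˡ (^-nonNeg 0≤ζ K) (h θ 0≤θ θ≤1 n) ⟩
      ζ ^ K * (C * (θ * z n ^ r) ^ suc N)   ≈⟨ *-congˡ
        (*-congˡ (≈-trans (^-distrib-* θ (z n ^ r) (suc N))
        (*-congˡ (≈-trans (^-assocʳ (z n) r (suc N)) (^-congʳ (z n) (ℕ.*-comm r (suc N))))))) ⟩
      ζ ^ K * (C * (t * z n ^ L))   ≈⟨ solve 5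
        (λ ζ u C t w → (ζ :* (ζ :* u)) :* (C :* (t :* w)) := C :* (t :* ((ζ :* ζ) :* (u :* w)))) ≈-refl ζ
        (ζ ^ L) C t (z n ^ L) ⟩
      C * (t * ((ζ * ζ) * (ζ ^ L * z n ^ L)))       ≈⟨ *-congˡ (*-congˡ (≈-trans (*-congˡ (ζz L)) (*-identityʳ _))) ⟩
      C * (t * (ζ * ζ))   ≤⟨ *-monoˡ 0≤C
        (*-monoˡ (^-nonNeg 0≤θ (suc N)) (harm*harm≤2harm² n)) ⟩
      C * (t * (ν 2 * harm² n))   ≈⟨ solve 4
        (λ C t k h → C :* (t :* (k :* h)) := ((C :* k) :* t) :* h) ≈-refl C t (ν 2) (harm² n) ⟩
      ((C * ν 2) * t) * harm² n   ∎
      where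
      open ≤R
      L K : ℕ
      L = suc N ℕ.* r
      K = 2 ℕ.+ L
      N*r<K : N ℕ.* r ℕ.< K
      N*r<K = s≤s (ℕ.≤-trans (ℕ.m≤n+m (N ℕ.* r) r) (ℕ.n≤1+n L))
      N<K : N ℕ.< K
      N<K = ℕ.≤-trans (ℕ.m≤m*n (suc N) r) (ℕ.m≤n+m L 2)

-- Comparison of power series coefficients

^≤1 : ∀ {x} → ι 0ℚ ≤ x → x ≤ ι 1ℚ → ∀ n → x ^ n ≤ ι 1ℚ
^≤1 0≤x x≤1 zero    = ≤-refl
^≤1 0≤x x≤1 (suc n) = ≤-respʳ (*-identityˡ (ι 1ℚ)) (*-mono 0≤1 (^-nonNeg 0≤x n) x≤1 (^≤1 0≤x x≤1 n))

ι-inverse : ∀ τ → 0ℚ ℚ.< τ → ∃[ σ ] ι 0ℚ ≤ ι σ × ι σ * ι τ ≈ ι 1ℚ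
ι-inverse τ 0<τ = ℚ.1/ τ , ι-mono (ℚ.<⇒≤ (ℚ.positive⁻¹ (ℚ.1/ τ) {{ℚ.1/pos⇒pos τ}}))
  , ≈-trans (≈-sym (ι-* (ℚ.1/ τ) τ)) (subst (λ q → ι q ≈ ι 1ℚ) (sym (ℚ.*-inverseˡ τ)) ≈-refl)
  where
  instance
    _ = positive 0<τ
    _ = ℚ.pos⇒nonZero τ

*-cancelˡ-≤ : ∀ τ → 0ℚ ℚ.< τ → ∀ {x y} → ι τ * x ≤ ι τ * y → x ≤ y
*-cancelˡ-≤ τ 0<τ {x} {y} h = let σ , 0≤σ , στ≈1 = ι-inverse τ 0<τ
                                  cancel : ∀ z → ι σ * (ι τ * z) ≈ z
                                  cancel z = ≈-trans (≈-sym (*-assoc _ _ z)) (≈-trans (*-congʳ στ≈1) (*-identityˡ z))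
                              in ≤-respˡ (cancel x) (≤-respʳ (cancel y) (*-monoˡ 0≤σ h))

∣x∣≤Cτ⇒x≈0 : ∀ {x C} → (∀ τ → 0ℚ ℚ.< τ → τ ℚ.≤ ½ → ∣ x ∣ ≤ ι τ * C) → x ≈ ι 0ℚ
∣x∣≤Cτ⇒x≈0 {x} {C} h = ∣x∣≤0⇒x≈0 (archimedean λ ε 0<ε →
  let D , C≤D = upper-bound C
      δ , 0<δ , Dδ≤ε = *-small ℚ.∣ D ∣ (ℚ.0≤∣p∣ D) ε 0<ε
      τ , 0<τ , τ≤½ , τ≤δ = positive-lower-bound ½ δ (ℚ.positive⁻¹ ½) 0<δ
  in begin
    ∣ x ∣   ≤⟨ h τ 0<τ τ≤½ ⟩
    ι τ * C   ≤⟨ *-monoˡ (ι-mono (ℚ.<⇒≤ 0<τ)) (≤-trans C≤D (ι-mono (p≤∣p∣ D))) ⟩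
    ι τ * ι ℚ.∣ D ∣   ≈⟨ ι-* τ ℚ.∣ D ∣ ⟨
    ι (τ ℚ.* ℚ.∣ D ∣)        ≤⟨ ι-mono (ℚ.≤-trans (ℚ.≤-reflexive (ℚ.*-comm τ ℚ.∣ D ∣))
      (ℚ.≤-trans (*-mono-≤ (ℚ.0≤∣p∣ D) (ℚ.<⇒≤ 0<τ) ℚ.≤-refl τ≤δ) Dδ≤ε)) ⟩
    ι ε   ≈⟨ +-identityˡ (ι ε) ⟨
    ι 0ℚ + ι ε   ∎)
  where
  open ≤R

½≤1 : ½ ℚ.≤ 1ℚ
½≤1 = /-≤ 1 2 1 1 (s≤s z≤n)

-- As τ → 0 only the constant term survives, so it vanishes; cancelling one τ from the rest gives
-- the same hypothesis, with the same C, for the shifted coefficients and K - 1.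
coefficients-vanish : ∀ K (b : ℕ → ℝ) C → ι 0ℚ ≤ C →
  (∀ τ → 0ℚ ℚ.< τ → τ ℚ.≤ ½ → ∣ Σᴿ K (λ n → b n * ι τ ^ n) ∣ ≤ C * ι τ ^ K) → ∀ n → n ℕ.< K → b n ≈ ι 0ℚ
coefficients-vanish (suc K) b C 0≤C h = vanish
  where
  open ≤R
  b′ : ℕ → ℝ
  b′ n = b (suc n)
  P : ℚ → ℝ
  P τ = Σᴿ K (λ n → b′ n * ι τ ^ n)
  C′ : ℝ
  C′ = Σᴿ K (λ n → ∣ b′ n ∣)
  split : ∀ τ → Σᴿ (suc K) (λ n → b n * ι τ ^ n) ≈ b 0 + ι τ * P τ
  split τ = ≈-trans (Σᴿ-front K _) (+-cong (*-identityʳ (b 0))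
    (≈-trans (Σᴿ-cong K λ n → solve 3 (λ b t u → b :* (t :* u) := t :* (b :* u)) ≈-refl (b′ n) (ι τ) (ι τ ^ n))
      (Σᴿ-* K (ι τ) (λ n → b′ n * ι τ ^ n))))
  ∣P∣≤C′ : ∀ τ → 0ℚ ℚ.< τ → τ ℚ.≤ ½ → ∣ P τ ∣ ≤ C′
  ∣P∣≤C′ τ 0<τ τ≤½ = ≤-trans (∣Σᴿ∣≤ K _) (Σᴿ-mono K λ n → begin
    ∣ b′ n * ι τ ^ n ∣   ≈⟨ ≈-trans (∣x*y∣≈∣x∣*∣y∣ _ _) (*-congˡ (0≤x⇒∣x∣≈x (^-nonNeg 0≤τ n))) ⟩
    ∣ b′ n ∣ * ι τ ^ n   ≤⟨ *-monoˡ (0≤∣x∣ _) (^≤1 0≤τ (ι-mono (ℚ.≤-trans τ≤½ ½≤1)) n) ⟩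
    ∣ b′ n ∣ * ι 1ℚ   ≈⟨ *-identityʳ _ ⟩
    ∣ b′ n ∣   ∎)
    where 0≤τ = ι-mono (ℚ.<⇒≤ 0<τ)
  b₀≈0 : b 0 ≈ ι 0ℚ
  b₀≈0 = ∣x∣≤Cτ⇒x≈0 {C = C + C′} λ τ 0<τ τ≤½ → let 0≤τ = ι-mono (ℚ.<⇒≤ 0<τ) in begin
    ∣ b 0 ∣   ≈⟨ ∣∣-cong
      (solve 2 (λ b p → b := (b :+ p) :- p) ≈-refl (b 0) (ι τ * P τ)) ⟩
    ∣ (b 0 + ι τ * P τ) - ι τ * P τ ∣   ≤⟨ ∣x-y∣≤∣x∣+∣y∣ _ _ ⟩
    ∣ b 0 + ι τ * P τ ∣ + ∣ ι τ * P τ ∣   ≤⟨ +-mono-≤ (≤-respˡ (∣∣-cong (split τ)) (h τ 0<τ τ≤½))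
                                                          (≈⇒≤ (∣x*y∣≈x*∣y∣ 0≤τ)) ⟩
    C * (ι τ * ι τ ^ K) + ι τ * ∣ P τ ∣   ≤⟨ +-mono-≤
      (*-monoˡ 0≤C (*-monoˡ 0≤τ (^≤1 0≤τ (ι-mono (ℚ.≤-trans τ≤½ ½≤1)) K))) (*-monoˡ 0≤τ (∣P∣≤C′ τ 0<τ τ≤½)) ⟩
    C * (ι τ * ι 1ℚ) + ι τ * C′   ≈⟨ solve 3
      (λ C t D → C :* (t :* con 1ℚ) :+ t :* D := t :* (C :+ D)) ≈-refl C (ι τ) C′ ⟩
    ι τ * (C + C′)   ∎
  vanish : ∀ n → n ℕ.< suc K → b n ≈ ι 0ℚ
  vanish zero    _         = b₀≈0
  vanish (suc n) (s≤s n<K) = coefficients-vanish K b′ C 0≤C (λ τ 0<τ τ≤½ → *-cancelˡ-≤ τ 0<τ (begin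
    ι τ * ∣ P τ ∣   ≈⟨ *-congʳ (0≤x⇒∣x∣≈x (ι-mono (ℚ.<⇒≤ 0<τ))) ⟨
    ∣ ι τ ∣ * ∣ P τ ∣   ≈⟨ ∣x*y∣≈∣x∣*∣y∣ _ _ ⟨
    ∣ ι τ * P τ ∣   ≈⟨ ∣∣-cong (≈-trans (split τ) (≈-trans (+-congʳ b₀≈0) (+-identityˡ _))) ⟨
    ∣ Σᴿ (suc K) _ ∣   ≤⟨ h τ 0<τ τ≤½ ⟩
    C * (ι τ * ι τ ^ K)   ≈⟨ solve 3 (λ C t u → C :* (t :* u) := t :* (C :* u)) ≈-refl C (ι τ) (ι τ ^ K) ⟩
    ι τ * (C * ι τ ^ K)   ∎)) n n<K

⟶⇒bounded : ∀ a {s} → (λ n → Σᴿ n a) ⟶ s → ∃[ C ] ι 0ℚ ≤ C × (∀ n → ∣ a n ∣ ≤ C)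
⟶⇒bounded a {s} lim =
  let N , h = lim 1ℚ 0<1
      T = Σᴿ N (λ k → ∣ a k ∣)
      0≤T = Σᴿ-nonNeg N (λ k → 0≤∣x∣ (a k))
      bound : ∀ n → (n ℕ.< N) ⊎ (N ℕ.≤ n) → ∣ a n ∣ ≤ ν 2 + T
      bound = λ { n (inj₁ n<N) → ≤-trans (Σᴿ-term≤ N (λ k → 0≤∣x∣ (a k)) n n<N) (y≤x+y (0≤ν 2))
                ; n (inj₂ N≤n) → ≤-trans (begin
                    ∣ a n ∣   ≈⟨ ∣∣-cong
                      (solve 3 (λ a u s → a := ((u :+ a) :- s) :- (u :- s)) ≈-refl (a n) (Σᴿ n a) s) ⟩
                    ∣ (Σᴿ (suc n) a - s) - (Σᴿ n a - s) ∣    ≤⟨ ∣x-y∣≤∣x∣+∣y∣ _ _ ⟩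
                    ∣ Σᴿ (suc n) a - s ∣ + ∣ Σᴿ n a - s ∣    ≤⟨ +-mono-≤ (h (suc n) (ℕ.m≤n⇒m≤1+n N≤n)) (h n N≤n) ⟩
                    ι 1ℚ + ι 1ℚ   ≈⟨ solve 0 (con 1ℚ :+ con 1ℚ := con (fromℕℚ 2)) ≈-refl ⟩
                    ν 2   ∎) (x≤x+y 0≤T) }
  in ν 2 + T , +-nonNeg (0≤ν 2) 0≤T , λ n → bound n (ℕ.<-≤-connex n N)
  where open ≤R

Σ-½-geometric : ∀ τ → ι 0ℚ ≤ τ → τ ≤ ι ½ → ∀ n → Σᴿ n (λ k → τ ^ k) ≤ ν 2
Σ-½-geometric τ 0≤τ τ≤½ zero    = 0≤ν 2
Σ-½-geometric τ 0≤τ τ≤½ (suc n) = begin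
  Σᴿ (suc n) (λ k → τ ^ k)   ≈⟨ ≈-trans (Σᴿ-front n (λ k → τ ^ k)) (+-congˡ (Σᴿ-* n τ (λ k → τ ^ k))) ⟩
  ι 1ℚ + τ * Σᴿ n (λ k → τ ^ k)       ≤⟨ +-mono-≤ ≤-refl
    (*-mono (ι-mono (0≤/ 1 2)) (Σᴿ-nonNeg n (^-nonNeg 0≤τ)) τ≤½ (Σ-½-geometric τ 0≤τ τ≤½ n)) ⟩
  ι 1ℚ + ι ½ * ν 2   ≈⟨ solve 0 (con 1ℚ :+ con ½ :* con (fromℕℚ 2) := con (fromℕℚ 2)) ≈-refl ⟩
  ν 2   ∎
  where open ≤R

-- For τ ≤ ½ the geometric series stays below 2, which keeps the constant in front of τᴷ independent
-- of τ.
power-series-tail : ∀ (a : ℕ → ℝ) C τ {s} → ι 0ℚ ≤ C → (∀ n → ∣ a n ∣ ≤ C) → ι 0ℚ ≤ τ → τ ≤ ι ½ →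
  (λ n → Σᴿ n (λ k → a k * τ ^ k)) ⟶ s → ∀ K → ∣ s - Σᴿ K (λ k → a k * τ ^ k) ∣ ≤ (C * ν 2) * τ ^ K
power-series-tail a C τ {s} 0≤C a≤ 0≤τ τ≤½ lim K = ⟶-bound {a = λ d → T (d ℕ.+ K) - T K}
  (λ ε 0<ε → let N , h = lim ε 0<ε in N , λ d N≤d → ≤-respˡ
    (∣∣-cong (solve 3 (λ u s t → u :- s := (u :- t) :- (s :- t)) ≈-refl (T (d ℕ.+ K)) s (T K)))
    (h (d ℕ.+ K) (ℕ.≤-trans N≤d (ℕ.m≤m+n d K))))
  (λ d → begin
    ∣ T (d ℕ.+ K) - T K ∣
      ≈⟨ ∣∣-cong (≈-trans (+-congʳ (Σᴿ-shift d K _)) (solve 2 (λ t u → (t :+ u) :- t := u) ≈-refl (T K) _)) ⟩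
    ∣ Σᴿ d (λ k → a (k ℕ.+ K) * τ ^ (k ℕ.+ K)) ∣
      ≤⟨ ∣Σᴿ∣≤ d _ ⟩
    Σᴿ d (λ k → ∣ a (k ℕ.+ K) * τ ^ (k ℕ.+ K) ∣)
      ≤⟨ Σᴿ-mono d (λ k → begin
           ∣ a (k ℕ.+ K) * τ ^ (k ℕ.+ K) ∣       ≈⟨ ≈-trans (∣x*y∣≈∣x∣*∣y∣ _ _)
             (*-congˡ (0≤x⇒∣x∣≈x (^-nonNeg 0≤τ (k ℕ.+ K)))) ⟩
           ∣ a (k ℕ.+ K) ∣ * τ ^ (k ℕ.+ K)       ≤⟨ *-monoʳ (^-nonNeg 0≤τ (k ℕ.+ K)) (a≤ (k ℕ.+ K)) ⟩
           C * τ ^ (k ℕ.+ K)   ≈⟨ *-congˡ (^-homo-* τ k K) ⟩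
           C * (τ ^ k * τ ^ K)   ≈⟨ solve 3 (λ C u w → C :* (u :* w) := (C :* w) :* u) ≈-refl C
             (τ ^ k) (τ ^ K) ⟩
           (C * τ ^ K) * τ ^ k   ∎) ⟩
    Σᴿ d (λ k → (C * τ ^ K) * τ ^ k)
      ≈⟨ Σᴿ-* d _ _ ⟩
    (C * τ ^ K) * Σᴿ d (λ k → τ ^ k)
      ≤⟨ *-monoˡ (*-nonNeg 0≤C (^-nonNeg 0≤τ K)) (Σ-½-geometric τ 0≤τ τ≤½ d) ⟩
    (C * τ ^ K) * ν 2
      ≈⟨ solve 3 (λ C u t → (C :* u) :* t := (C :* t) :* u) ≈-refl C (τ ^ K) (ν 2) ⟩
    (C * ν 2) * τ ^ K ∎)
  where
  open ≤R
  T : ℕ → ℝ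
  T n = Σᴿ n (λ k → a k * τ ^ k)

-- Identification of the Euler coefficients

module Expansion (f : ℕ) .{{_ : ℕ.NonZero f}} (c : ℕ → ℝ) (c-antiperiodic : ∀ n → c (n ℕ.+ f) ≈ - c n)
                 (x : ℝ) (0≤x : ι 0ℚ ≤ x) (x≤1 : x ≤ ι 1ℚ) where

  open Differences f
  open Summation f c c-antiperiodic
  open Monomials f x 0≤x x≤1

  -- The generating identity at small positive rational t already determines E.

  IsEulerSequence : (ℕ → ℝ) → Set
  IsEulerSequence E = ∃[ t₀ ] 0ℚ ℚ.< t₀ × t₀ ℚ.≤ 1ℚ × (∀ t → 0ℚ ℚ.< t → t ℚ.≤ t₀ →
    ∃[ s ] (λ n → Σᴿ n (λ k → E k * (ι (1/! k) * ι t ^ k))) ⟶ s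
         × s * (expᴿ (ν f * ι t) + ι 1ℚ) ≈ ν 2 * A (λ i → expᴿ (y i * ι t)))

  g : ℝ → ℕ → ℝ
  g t i = expᴿ (y i * t)

  g-shift : ∀ t n → g t (n ℕ.+ f) ≈ expᴿ (ν f * t) * g t n
  g-shift t n = ≈-trans (expᴿ-cong (≈-trans (*-congʳ (y-shift f n))
    (solve 3 (λ y F t → (y :+ F) :* t := F :* t :+ y :* t) ≈-refl (y n) (ν f) t)))
    (expᴿ-+ (ν f * t) (y n * t))

  0≤y*t : ∀ {t} → ι 0ℚ ≤ t → ∀ i → ι 0ℚ ≤ y i * t
  0≤y*t 0≤t i = *-nonNeg (0≤y i) 0≤t

  g-bound : ∀ {t} → ι 0ℚ ≤ t → t ≤ ι 1ℚ → ∀ i → g t i ≤ expᴿ (y i)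
  g-bound 0≤t t≤1 i = expᴿ-mono (≤-respʳ (*-identityʳ (y i)) (*-monoˡ (0≤y i) t≤1))

  M-taylor : ∀ K t → M K (λ i → taylor K (y i * t)) ≈ Σᴿ K (λ n → (ι (1/! n) * t ^ n) * M K (λ i → y i ^ n))
  M-taylor K t = ≈-trans
    (M-cong K λ i → Σᴿ-cong K λ n → ≈-trans (*-congˡ (^-distrib-* (y i) t n))
      (solve 3 (λ k u w → k :* (u :* w) := (k :* w) :* u) ≈-refl (ι (1/! n)) (y i ^ n) (t ^ n)))
    (M-Σᴿ K K (λ n → ι (1/! n) * t ^ n) (λ n i → y i ^ n))

  opaque
    ∣M-[g-taylor]∣≤ : ∀ K → ∃[ C ] (∀ t → ι 0ℚ ≤ t → t ≤ ι 1ℚ → ∣ M K (g t) - M K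
      (λ i → taylor K (y i * t)) ∣ ≤ C * t ^ K)
    ∣M-[g-taylor]∣≤ K = M-const K w , λ t 0≤t t≤1 → ≤-respˡ (∣∣-cong (M-sub K (g t) (λ i → taylor K (y i * t))))
      (∣M∣≤ K _ w (t ^ K) λ i → begin
      ∣ expᴿ (y i * t) - taylor K (y i * t) ∣      ≤⟨ expᴿ-taylor K (y i * t) ⟩
      ∣ y i * t ∣ ^ K * expᴿ ∣ y i * t ∣   ≈⟨ *-cong (^-congˡ K (0≤x⇒∣x∣≈x (0≤y*t 0≤t i)))
        (expᴿ-cong (0≤x⇒∣x∣≈x (0≤y*t 0≤t i))) ⟩
      (y i * t) ^ K * g t i   ≤⟨ *-monoˡ (^-nonNeg (0≤y*t 0≤t i) K) (g-bound 0≤t t≤1 i) ⟩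
      (y i * t) ^ K * expᴿ (y i)   ≈⟨ *-congʳ (^-distrib-* (y i) t K) ⟩
      (y i ^ K * t ^ K) * expᴿ (y i)   ≈⟨ solve 3 (λ u w e → (u :* w) :* e := w :* (u :* e)) ≈-refl
        (y i ^ K) (t ^ K) (expᴿ (y i)) ⟩
      t ^ K * w i   ∎)
      where
      open ≤R
      w : ℕ → ℝ
      w i = y i ^ K * expᴿ (y i)

    ∣s-M[g]∣≤ : ∀ K → ∃[ C ] (∀ t s → ι 0ℚ ≤ t → t ≤ ι 1ℚ → s * (expᴿ (ν f * t) + ι 1ℚ) ≈ ν 2 * A (g t) →
      ∣ ν 2 ^ K * s - ν 2 * M K (g t) ∣ ≤ C * t ^ K)
    ∣s-M[g]∣≤ K = F ^ K * (ν 2 * A⁺) , λ t s 0≤t t≤1 eq →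
      let e = expᴿ (ν f * t)
          w = ι 1ℚ - e
          0≤e = expᴿ-nonNeg (ν f * t)
          0≤1+e = +-nonNeg 0≤1 0≤e
          ft≤f = ≤-respʳ (*-identityʳ (ν f)) (*-monoˡ (0≤ν f) t≤1)
          0≤ft = *-nonNeg (0≤ν f) 0≤t
      in begin
      ∣ ν 2 ^ K * s - ν 2 * M K (g t) ∣
        ≤⟨ x≤y*x (0≤∣x∣ _) (x≤x+y 0≤e) ⟩
      (ι 1ℚ + e) * ∣ ν 2 ^ K * s - ν 2 * M K (g t) ∣
        ≈⟨ ∣x*y∣≈x*∣y∣ 0≤1+e ⟨
      ∣ (ι 1ℚ + e) * (ν 2 ^ K * s - ν 2 * M K (g t)) ∣
        ≈⟨ ∣∣-cong (begin-equality
             (ι 1ℚ + e) * (ν 2 ^ K * s - ν 2 * M K (g t))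
               ≈⟨ solve 5 (λ e p s t m → (con 1ℚ :+ e) :* (p :* s :- t :* m) := p :* (s :* (e :+ con 1ℚ)) :- t :*
                 ((con 1ℚ :+ e) :* m)) ≈-refl e (ν 2 ^ K) s (ν 2) (M K (g t)) ⟩
             ν 2 ^ K * (s * (e + ι 1ℚ)) - ν 2 * ((ι 1ℚ + e) * M K (g t))
               ≈⟨ +-cong (*-congˡ eq) (-‿cong (*-congˡ (M-geometric (g-shift t) K))) ⟩
             ν 2 ^ K * (ν 2 * A (g t)) - ν 2 * ((ν 2 ^ K - w ^ K) * A (g t))
               ≈⟨ solve 4 (λ p t a u → p :* (t :* a) :- t :* ((p :- u) :* a) := u :* (t :* a)) ≈-refl (ν 2 ^ K)
                 (ν 2) (A (g t)) (w ^ K) ⟩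
             w ^ K * (ν 2 * A (g t)) ∎) ⟩
      ∣ w ^ K * (ν 2 * A (g t)) ∣
        ≈⟨ ≈-trans (∣x*y∣≈∣x∣*∣y∣ _ _) (*-cong (∣x^n∣≈∣x∣^n w K) (∣x*y∣≈x*∣y∣ (0≤ν 2))) ⟩
      ∣ w ∣ ^ K * (ν 2 * ∣ A (g t) ∣)
        ≤⟨ *-mono (^-nonNeg (*-nonNeg 0≤F 0≤t) K) (*-nonNeg (0≤ν 2) (0≤∣x∣ _))
             (^-mono (0≤∣x∣ w) (begin
               ∣ ι 1ℚ - e ∣   ≈⟨ ∣-x∣≈∣x∣ _ ⟨
               ∣ - (ι 1ℚ - e) ∣   ≈⟨ ∣∣-cong
                 (solve 1 (λ e → :- (con 1ℚ :- e) := e :- con 1ℚ) ≈-refl e) ⟩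
               ∣ e - ι 1ℚ ∣   ≤⟨ ∣expᴿ-1∣≤ (ν f * t) ⟩
               ∣ ν f * t ∣ * expᴿ ∣ ν f * t ∣       ≈⟨ *-cong (0≤x⇒∣x∣≈x 0≤ft) (expᴿ-cong (0≤x⇒∣x∣≈x 0≤ft)) ⟩
               (ν f * t) * expᴿ (ν f * t)   ≤⟨ *-monoˡ 0≤ft (expᴿ-mono ft≤f) ⟩
               (ν f * t) * expᴿ (ν f)   ≈⟨ solve 3 (λ F t e → (F :* t) :* e := (F :* e) :* t) ≈-refl
                 (ν f) t (expᴿ (ν f)) ⟩
               F * t   ∎) K)
             (*-monoˡ (0≤ν 2) (≤-trans (∣S∣≤ (g t) (λ i → expᴿ (y i)) (ι 1ℚ)
               (λ i → ≤-trans (≈⇒≤ (0≤x⇒∣x∣≈x (expᴿ-nonNeg _)))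
                 (≤-respʳ (≈-sym (*-identityˡ _)) (g-bound 0≤t t≤1 i))) f) (≈⇒≤ (*-identityʳ A⁺)))) ⟩
      (F * t) ^ K * (ν 2 * A⁺)
        ≈⟨ *-congʳ (^-distrib-* F t K) ⟩
      (F ^ K * t ^ K) * (ν 2 * A⁺)
        ≈⟨ solve 3 (λ u w a → (u :* w) :* a := (u :* a) :* w) ≈-refl (F ^ K) (t ^ K) (ν 2 * A⁺) ⟩
      (F ^ K * (ν 2 * A⁺)) * t ^ K ∎
      where
      open ≤R
      F A⁺ : ℝ
      F = ν f * expᴿ (ν f)
      A⁺ = Σᴿ f (λ i → ∣ c i ∣ * expᴿ (y i))
      0≤F : ι 0ℚ ≤ F
      0≤F = *-nonNeg (0≤ν f) (expᴿ-nonNeg (ν f))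

  -- No growth condition on E is given. Convergence at t₀ alone bounds the terms E(k)t₀ᵏ/k!, so
  -- after rescaling t = t₀τ with τ ≤ ½ the tail of the series is O(τᴷ) and `coefficients-vanish`
  -- applies to the rescaled differences b.
  euler-coefficients : ∀ {E} → IsEulerSequence E → ∀ K n → n ℕ.< K → ν 2 ^ K * E n ≈ ν 2 * M K (λ i → y i ^ n)
  euler-coefficients {E} (t₀ , 0<t₀ , t₀≤1 , euler) K n n<K = begin-equality
    ν 2 ^ K * E n
      ≈⟨ solve 2 (λ a b → a := (a :- b) :+ b) ≈-refl (ν 2 ^ K * E n) (ν 2 * M K (λ i → y i ^ n)) ⟩
    d n + ν 2 * M K (λ i → y i ^ n)
      ≈⟨ +-congʳ d≈0 ⟩
    ι 0ℚ + ν 2 * M K (λ i → y i ^ n)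
      ≈⟨ +-identityˡ _ ⟩
    ν 2 * M K (λ i → y i ^ n) ∎
    where
    open ≤R
    T₀ = ι t₀
    0≤T₀ = ι-mono (ℚ.<⇒≤ 0<t₀)
    d b a : ℕ → ℝ
    d k = ν 2 ^ K * E k - ν 2 * M K (λ i → y i ^ k)
    b k = d k * (ι (1/! k) * T₀ ^ k)
    a k = E k * (ι (1/! k) * T₀ ^ k)
    C₁ = proj₁ (⟶⇒bounded a (proj₁ (proj₂ (euler t₀ 0<t₀ ℚ.≤-refl))))
    0≤C₁ = proj₁ (proj₂ (⟶⇒bounded a (proj₁ (proj₂ (euler t₀ 0<t₀ ℚ.≤-refl)))))
    ∣a∣≤C₁ = proj₂ (proj₂ (⟶⇒bounded a (proj₁ (proj₂ (euler t₀ 0<t₀ ℚ.≤-refl)))))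
    C₂ = proj₁ (∣s-M[g]∣≤ K)
    C₃ = proj₁ (∣M-[g-taylor]∣≤ K)
    -- One summand for each error in `bound`: the tail of the Euler series, the term with (1-e)ᴷ,
    -- and the Taylor remainder inside M.
    C = (ν 2 ^ K * (C₁ * ν 2) + ∣ C₂ ∣) + ν 2 * ∣ C₃ ∣
    0≤C : ι 0ℚ ≤ C
    0≤C = +-nonNeg (+-nonNeg (*-nonNeg (^-nonNeg (0≤ν 2) K) (*-nonNeg 0≤C₁ (0≤ν 2))) (0≤∣x∣ C₂))
      (*-nonNeg (0≤ν 2) (0≤∣x∣ C₃))

    bound : ∀ τ → 0ℚ ℚ.< τ → τ ℚ.≤ ½ → ∣ Σᴿ K (λ k → b k * ι τ ^ k) ∣ ≤ C * ι τ ^ K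
    bound τ 0<τ τ≤½ = begin
      ∣ Σᴿ K (λ k → b k * u ^ k) ∣
        ≈⟨ ∣∣-cong Σb ⟩
      ∣ ν 2 ^ K * Sₖ - ν 2 * Mt ∣
        ≈⟨ ∣∣-cong (solve 6 (λ p s σ t m m′ → p :* s :- t :* m′ := ((p :* σ :- t :* m) :- p :* (σ :- s)) :+ t :*
          (m :- m′)) ≈-refl (ν 2 ^ K) Sₖ s (ν 2) (M K (g t)) Mt) ⟩
      ∣ ((ν 2 ^ K * s - ν 2 * M K (g t)) - ν 2 ^ K * (s - Sₖ)) + ν 2 * (M K (g t) - Mt) ∣
        ≤⟨ ≤-trans (∣x+y∣≤∣x∣+∣y∣ _ _) (+-mono-≤ (∣x-y∣≤∣x∣+∣y∣ _ _) ≤-refl) ⟩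
      (∣ ν 2 ^ K * s - ν 2 * M K (g t) ∣ + ∣ ν 2 ^ K * (s - Sₖ) ∣) + ∣ ν 2 * (M K (g t) - Mt) ∣
        ≈⟨ +-cong (+-congˡ (∣x*y∣≈x*∣y∣ (^-nonNeg (0≤ν 2) K))) (∣x*y∣≈x*∣y∣ (0≤ν 2)) ⟩
      (∣ ν 2 ^ K * s - ν 2 * M K (g t) ∣ + ν 2 ^ K * ∣ s - Sₖ ∣) + ν 2 * ∣ M K (g t) - Mt ∣
        ≤⟨ +-mono-≤ (+-mono-≤ (≤-trans (proj₂ (∣s-M[g]∣≤ K) t s 0≤t t≤1 s-eq) (C*t^K≤ C₂))
                              (*-monoˡ (^-nonNeg (0≤ν 2) K) (≤-respˡ (∣∣-cong (+-congˡ (-‿cong (≈-sym Sₖ-eq))))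
                                (power-series-tail a C₁ u 0≤C₁ ∣a∣≤C₁ 0≤u (ι-mono τ≤½) s-lim K))))
                    (*-monoˡ (0≤ν 2) (≤-trans (proj₂ (∣M-[g-taylor]∣≤ K) t 0≤t t≤1) (C*t^K≤ C₃))) ⟩
      (∣ C₂ ∣ * u ^ K + ν 2 ^ K * ((C₁ * ν 2) * u ^ K)) + ν 2 * (∣ C₃ ∣ * u ^ K)
        ≈⟨ solve 6 (λ c₂ w p c₁ t c₃ → (c₂ :* w :+ p :* ((c₁ :* t) :* w)) :+ t :* (c₃ :* w) :=
          ((p :* (c₁ :* t) :+ c₂) :+ t :* c₃) :* w) ≈-refl
             (∣ C₂ ∣) (u ^ K) (ν 2 ^ K) C₁ (ν 2) (∣ C₃ ∣) ⟩
      C * u ^ K ∎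
      where
      u = ι τ
      t = ι (t₀ ℚ.* τ)
      0≤u = ι-mono (ℚ.<⇒≤ 0<τ)
      0≤t = ι-mono (ℚ.<⇒≤ (0<* 0<t₀ 0<τ))
      t₀τ≤t₀ : t₀ ℚ.* τ ℚ.≤ t₀
      t₀τ≤t₀ = ℚ.≤-trans (*-mono-≤ (ℚ.<⇒≤ 0<t₀) (ℚ.<⇒≤ 0<τ) ℚ.≤-refl (ℚ.≤-trans τ≤½ ½≤1))
        (ℚ.≤-reflexive (ℚ.*-identityʳ t₀))
      t≤1 = ι-mono (ℚ.≤-trans t₀τ≤t₀ t₀≤1)
      t^≈ : ∀ k → t ^ k ≈ T₀ ^ k * u ^ k
      t^≈ k = ≈-trans (^-congˡ k (ι-* t₀ τ)) (^-distrib-* T₀ u k)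
      C*t^K≤ : ∀ C → C * t ^ K ≤ ∣ C ∣ * u ^ K
      C*t^K≤ C = ≤-trans (*-monoʳ (^-nonNeg 0≤t K) (x≤∣x∣ C)) (*-monoˡ (0≤∣x∣ C) (^-mono 0≤t
        (ι-mono (ℚ.≤-trans (*-mono-≤ (ℚ.<⇒≤ 0<t₀) (ℚ.<⇒≤ 0<τ) t₀≤1 ℚ.≤-refl) (ℚ.≤-reflexive (ℚ.*-identityˡ τ)))) K))
      s = proj₁ (euler (t₀ ℚ.* τ) (0<* 0<t₀ 0<τ) t₀τ≤t₀)
      s-eq = proj₂ (proj₂ (euler (t₀ ℚ.* τ) (0<* 0<t₀ 0<τ) t₀τ≤t₀))
      term-eq : ∀ k → E k * (ι (1/! k) * t ^ k) ≈ a k * u ^ k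
      term-eq k = ≈-trans (*-congˡ (*-congˡ (t^≈ k)))
        (solve 4 (λ e k t u → e :* (k :* (t :* u)) := (e :* (k :* t)) :* u) ≈-refl (E k) (ι (1/! k)) (T₀ ^ k) (u ^ k))
      s-lim : (λ n → Σᴿ n (λ k → a k * u ^ k)) ⟶ s
      s-lim = ⟶-cong (λ n → Σᴿ-cong n term-eq) ≈-refl (proj₁ (proj₂ (euler (t₀ ℚ.* τ) (0<* 0<t₀ 0<τ) t₀τ≤t₀)))
      Sₖ Mt : ℝ
      Sₖ = Σᴿ K (λ k → E k * (ι (1/! k) * t ^ k))
      Mt = M K (λ i → taylor K (y i * t))
      Sₖ-eq : Sₖ ≈ Σᴿ K (λ k → a k * u ^ k)
      Sₖ-eq = Σᴿ-cong K term-eq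
      Σb : Σᴿ K (λ k → b k * u ^ k) ≈ ν 2 ^ K * Sₖ - ν 2 * Mt
      Σb = begin-equality
        Σᴿ K (λ k → b k * u ^ k)
          ≈⟨ Σᴿ-cong K (λ k → ≈-trans
               (solve 7 (λ p e t m k T u → ((p :* e :- t :* m) :* (k :* T)) :* u := p :* (e :* (k :* (T :* u))) :+
                 (:- t) :* ((k :* (T :* u)) :* m)) ≈-refl
                 (ν 2 ^ K) (E k) (ν 2) (M K (λ i → y i ^ k)) (ι (1/! k)) (T₀ ^ k) (u ^ k))
               (+-cong (*-congˡ (*-congˡ (*-congˡ (≈-sym (t^≈ k))))) (*-congˡ (*-congʳ (*-congˡ (≈-sym (t^≈ k))))))) ⟩
        Σᴿ K (λ k → ν 2 ^ K * (E k * (ι (1/! k) * t ^ k)) + (- ν 2) * ((ι (1/! k) * t ^ k) * M K (λ i → y i ^ k)))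
          ≈⟨ ≈-trans (Σᴿ-linear K (ν 2 ^ K) _ _) (+-congˡ (Σᴿ-* K (- ν 2) _)) ⟩
        ν 2 ^ K * Sₖ + (- ν 2) * Σᴿ K (λ k → (ι (1/! k) * t ^ k) * M K (λ i → y i ^ k))
          ≈⟨ +-congˡ (*-congˡ (≈-sym (M-taylor K t))) ⟩
        ν 2 ^ K * Sₖ + (- ν 2) * Mt
          ≈⟨ solve 3 (λ a t m → a :+ (:- t) :* m := a :- t :* m) ≈-refl (ν 2 ^ K * Sₖ) (ν 2) Mt ⟩
        ν 2 ^ K * Sₖ - ν 2 * Mt ∎

    d≈0 : d n ≈ ι 0ℚ
    -- The factor n! σⁿ, with σ the inverse of t₀, undoes the weight t₀ⁿ/n! by which b n differs
    -- from d n.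
    d≈0 = let σ , _ , σt₀≈1 = ι-inverse t₀ 0<t₀ in begin-equality
      d n
        ≈⟨ ≈-trans (*-congˡ (≈-trans (*-congʳ (ν!*ι1/! n))
          (≈-trans (*-identityˡ _) (≈-trans (^-congˡ n (≈-trans (*-comm T₀ (ι σ)) σt₀≈1)) (1^ n)))))
          (*-identityʳ (d n)) ⟨
      d n * ((ν (n !) * ι (1/! n)) * (T₀ * ι σ) ^ n)
        ≈⟨ *-congˡ (*-congˡ (^-distrib-* T₀ (ι σ) n)) ⟩
      d n * ((ν (n !) * ι (1/! n)) * (T₀ ^ n * ι σ ^ n))
        ≈⟨ solve 5 (λ d m k t s → d :* ((m :* k) :* (t :* s)) := (d :* (k :* t)) :* (m :* s)) ≈-refl (d n) (ν (n !))
          (ι (1/! n)) (T₀ ^ n) (ι σ ^ n) ⟩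
      b n * (ν (n !) * ι σ ^ n)
        ≈⟨ *-congʳ (coefficients-vanish K b C 0≤C bound n n<K) ⟩
      ι 0ℚ * (ν (n !) * ι σ ^ n)
        ≈⟨ zeroˡ _ ⟩
      ι 0ℚ ∎

-- Asymptotic expansion for one real component

module RealExpansion (f : ℕ) .{{_ : ℕ.NonZero f}} (c : ℕ → ℝ) (c-antiperiodic : ∀ n → c (n ℕ.+ f) ≈ - c n)
                     (x : ℝ) (0≤x : ι 0ℚ ≤ x) (x≤1 : x ≤ ι 1ℚ) (r : ℕ) .{{_ : ℕ.NonZero r}} where

  open Differences f
  open Summation f c c-antiperiodic
  open Monomials f x 0≤x x≤1
  open Decay f x 0≤x x≤1 r
  open Expansion f c c-antiperiodic x 0≤x x≤1

  ν≤y^r : ∀ n → ν n ≤ y n ^ r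
  ν≤y^r zero    = ^-nonNeg (0≤y 0) r
  ν≤y^r (suc n) = power r
    where
    power : ∀ r .{{_ : ℕ.NonZero r}} → ν (suc n) ≤ y (suc n) ^ r
    power (suc r) = ≤-trans (ν≤y (suc n)) (≤-respˡ (*-identityʳ (y (suc n)))
      (*-monoˡ (0≤y (suc n)) (1≤^ (≤-trans (1≤z n) (ν≤y (suc n))) r)))

  opaque
    -- (1+q)²e^(-q) is bounded and 1 + q ≥ δ(n+1) because yʳ ≥ n, so the terms are O(δ⁻²/n²). This
    -- is not uniform in θ and serves only for the existence of the sum; the uniform bound comes
    -- from the differences.
    converges : ∀ θ ε → 0ℚ ℚ.< ε → ι ε ≤ θ → ∃[ s ] S (φ θ) ⟶ s
    converges θ ε 0<ε ε≤θ =
      -- Both halves of the minimum matter: δ(n+1) = δ + δn, where δ ≤ 1 bounds the first summand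
      -- and δ ≤ ε ≤ θ the second.
      let δ , 0<δ , δ≤1 , δ≤ε = positive-lower-bound 1ℚ ε 0<1 0<ε
          σ , 0≤σ , σδ≈1 = ι-inverse δ 0<δ
          C = ν (2 !) * expᴿ (ι 1ℚ)
      in series-converges (C₀ * ((σ′ σ * C) * ν 2)) _ λ n →
      let ζ   = ι (harm n)
          0≤ζ = ι-mono (0≤/ 1 (suc n))
          e   = φ θ n
          0≤σ² = *-nonNeg 0≤σ 0≤σ
          0≤C  = *-nonNeg (0≤ν (2 !)) (expᴿ-nonNeg (ι 1ℚ))
          0≤δ  = ι-mono (ℚ.<⇒≤ 0<δ)
      in begin
      ∣ c n * e ∣
        ≈⟨ ≈-trans (∣x*y∣≈∣x∣*∣y∣ _ _) (*-congˡ (0≤x⇒∣x∣≈x (expᴿ-nonNeg _))) ⟩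
      ∣ c n ∣ * e
        ≤⟨ *-mono 0≤C₀ (expᴿ-nonNeg _) (∣c∣≤C₀ n) (begin
             e
               ≈⟨ ≈-trans (*-congʳ (≈-trans (*-cong (≈-trans (*-cong σδ≈1 σδ≈1) (*-identityˡ _))
                 (≈-trans (*-cong (harm*z n) (harm*z n)) (*-identityˡ _))) (*-identityˡ _))) (*-identityˡ e) ⟨
             (((ι σ * ι δ) * (ι σ * ι δ)) * ((ζ * z n) * (ζ * z n))) * e
               ≈⟨ solve 5 (λ s d h z e → (((s :* d) :* (s :* d)) :* ((h :* z) :* (h :* z))) :* e := (s :* s) :*
                 ((h :* h) :* (((d :* z) :* ((d :* z) :* con 1ℚ)) :* e))) ≈-refl (ι σ) (ι δ) ζ (z n) e ⟩
             (ι σ * ι σ) * ((ζ * ζ) * ((ι δ * z n) ^ 2 * e))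
               ≤⟨ *-monoˡ 0≤σ² (*-monoˡ (*-nonNeg 0≤ζ 0≤ζ) (≤-trans
                    (*-monoʳ (expᴿ-nonNeg _) (^-mono (*-nonNeg 0≤δ (0≤z n)) (begin
                      ι δ * z n   ≈⟨ ≈-trans (*-congˡ (ν-suc n))
                        (solve 2 (λ d n → d :* (con 1ℚ :+ n) := d :+ d :* n) ≈-refl (ι δ) (ν n)) ⟩
                      ι δ + ι δ * ν n   ≤⟨ +-mono-≤ (ι-mono δ≤1)
                        (*-mono (≤-trans 0≤δ δ≤θ[ δ≤ε ]) (0≤ν n) δ≤θ[ δ≤ε ] (ν≤y^r n)) ⟩
                      ι 1ℚ + q θ n   ∎) 2))
                    ([1+u]^j*expᴿ[-u]≤ 2 (0≤q (≤-trans 0≤δ δ≤θ[ δ≤ε ]) n)))) ⟩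
             (ι σ * ι σ) * ((ζ * ζ) * C)
               ≤⟨ *-monoˡ 0≤σ² (*-monoʳ 0≤C (harm*harm≤2harm² n)) ⟩
             (ι σ * ι σ) * ((ν 2 * harm² n) * C)
               ≈⟨ solve 4 (λ s t h C → s :* ((t :* h) :* C) := ((s :* C) :* t) :* h) ≈-refl (σ′ σ) (ν 2) (harm² n) C ⟩
             ((σ′ σ * C) * ν 2) * harm² n ∎) ⟩
      C₀ * (((σ′ σ * C) * ν 2) * harm² n)
        ≈⟨ *-assoc _ _ _ ⟨
      (C₀ * ((σ′ σ * C) * ν 2)) * harm² n ∎
      where
      open ≤R
      σ′ : ℚ → ℝ
      σ′ σ = ι σ * ι σ
      δ≤θ[_] : ∀ {δ} → δ ℚ.≤ ε → ι δ ≤ θ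
      δ≤θ[ δ≤ε ] = ≤-trans (ι-mono δ≤ε) ε≤θ

    ∣M-[φ-taylor]∣≤ : ∀ K N → ∃[ C ] (∀ θ → ι 0ℚ ≤ θ → θ ≤ ι 1ℚ →
      ∣ M K (φ θ) - M K (λ i → taylor (suc N) (- q θ i)) ∣ ≤ C * θ ^ suc N)
    ∣M-[φ-taylor]∣≤ K N = M-const K w , λ θ 0≤θ θ≤1 →
      ≤-respˡ (∣∣-cong (M-sub K (φ θ) (λ i → taylor (suc N) (- q θ i)))) (∣M∣≤ K _ w (θ ^ suc N) λ i →
      let ∣-q∣≈q = ≈-trans (∣-x∣≈∣x∣ (q θ i)) (0≤x⇒∣x∣≈x (0≤q 0≤θ i)) in begin
      ∣ φ θ i - taylor (suc N) (- q θ i) ∣   ≤⟨ expᴿ-taylor (suc N) (- q θ i) ⟩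
      ∣ - q θ i ∣ ^ suc N * expᴿ ∣ - q θ i ∣   ≈⟨ *-cong (^-congˡ (suc N) ∣-q∣≈q) (expᴿ-cong ∣-q∣≈q) ⟩
      q θ i ^ suc N * expᴿ (q θ i)   ≤⟨ *-monoˡ (^-nonNeg (0≤q 0≤θ i) (suc N))
        (expᴿ-mono (≤-respʳ (*-identityˡ _) (*-monoʳ (^-nonNeg (0≤y i) r) θ≤1))) ⟩
      q θ i ^ suc N * expᴿ (y i ^ r)   ≈⟨ *-congʳ (^-distrib-* θ (y i ^ r) (suc N)) ⟩
      (θ ^ suc N * (y i ^ r) ^ suc N) * expᴿ (y i ^ r) ≈⟨ *-assoc _ _ _ ⟩
      θ ^ suc N * w i   ∎)
      where
      open ≤R
      w : ℕ → ℝ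
      w i = (y i ^ r) ^ suc N * expᴿ (y i ^ r)

  partial : (ℕ → ℝ) → ℕ → ℝ → ℝ
  partial E N θ = Σᴿ (suc N) (λ n → (ι (1/! n) * (- θ) ^ n) * E (r ℕ.* n))

  M-partial : ∀ {E} → IsEulerSequence E → ∀ K N → (∀ n → n ℕ.≤ N → r ℕ.* n ℕ.< K) → ∀ θ →
              ν 2 * M K (λ i → taylor (suc N) (- q θ i)) ≈ ν 2 ^ K * partial E N θ
  M-partial {E} euler K N r*n<K θ = begin-equality
    ν 2 * M K (λ i → taylor (suc N) (- q θ i))
      ≈⟨ *-congˡ (≈-trans (M-cong K λ i → Σᴿ-cong (suc N) λ n → ≈-trans
           (*-congˡ (≈-trans (^-congˡ n (solve 2 (λ t y → :- (t :* y) := (:- t) :* y) ≈-refl θ (y i ^ r)))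
             (≈-trans (^-distrib-* (- θ) (y i ^ r) n) (*-congˡ (^-assocʳ (y i) r n))))) (≈-sym (*-assoc _ _ _)))
         (M-Σᴿ K (suc N) (λ n → ι (1/! n) * (- θ) ^ n) (λ n i → y i ^ (r ℕ.* n)))) ⟩
    ν 2 * Σᴿ (suc N) (λ n → (ι (1/! n) * (- θ) ^ n) * M K (λ i → y i ^ (r ℕ.* n)))
      ≈⟨ Σᴿ-* (suc N) (ν 2) _ ⟨
    Σᴿ (suc N) (λ n → ν 2 * ((ι (1/! n) * (- θ) ^ n) * M K (λ i → y i ^ (r ℕ.* n))))
      ≈⟨ Σᴿ-cong-< (suc N) (λ { n (s≤s n≤N) → begin-equality
           ν 2 * ((ι (1/! n) * (- θ) ^ n) * M K (λ i → y i ^ (r ℕ.* n)))   ≈⟨ solve 3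
             (λ t k m → t :* (k :* m) := k :* (t :* m)) ≈-refl (ν 2) _ _ ⟩
           (ι (1/! n) * (- θ) ^ n) * (ν 2 * M K (λ i → y i ^ (r ℕ.* n)))   ≈⟨ *-congˡ
             (euler-coefficients euler K (r ℕ.* n) (r*n<K n n≤N)) ⟨
           (ι (1/! n) * (- θ) ^ n) * (ν 2 ^ K * E (r ℕ.* n))   ≈⟨ solve 3
             (λ p k e → k :* (p :* e) := p :* (k :* e)) ≈-refl (ν 2 ^ K) _ _ ⟩
           ν 2 ^ K * ((ι (1/! n) * (- θ) ^ n) * E (r ℕ.* n))   ∎ }) ⟩
    Σᴿ (suc N) (λ n → ν 2 ^ K * ((ι (1/! n) * (- θ) ^ n) * E (r ℕ.* n)))
      ≈⟨ Σᴿ-* (suc N) (ν 2 ^ K) _ ⟩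
    ν 2 ^ K * partial E N θ ∎
    where open ≤R

  opaque
    expansion : ∀ {E} → IsEulerSequence E → ∀ N → ∃[ C ] ι 0ℚ ≤ C × (∀ θ → ι 0ℚ ≤ θ → θ ≤ ι 1ℚ → ∀ s → S (φ θ) ⟶ s →
      ∣ s - ι ½ * partial E N θ ∣ ≤ C * θ ^ suc N)
    expansion {E} euler N =
      let C₁ , 0≤C₁ , h₁ = Δ^-φ-summable N
          C₂ , h₂ = ∣M-[φ-taylor]∣≤ K N
      in C₀ * C₁ + ∣ C₂ ∣ , +-nonNeg (*-nonNeg 0≤C₀ 0≤C₁) (0≤∣x∣ C₂) , λ θ 0≤θ θ≤1 s lim →
      let t = θ ^ suc N
          0≤t = ^-nonNeg 0≤θ (suc N)
          T = M K (λ i → taylor (suc N) (- q θ i))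
      in begin
      ∣ s - ι ½ * partial E N θ ∣
        ≤⟨ x≤y*x (0≤∣x∣ _) (1≤^ 1≤2 K) ⟩
      ν 2 ^ K * ∣ s - ι ½ * partial E N θ ∣
        ≈⟨ ∣x*y∣≈x*∣y∣ (^-nonNeg (0≤ν 2) K) ⟨
      ∣ ν 2 ^ K * (s - ι ½ * partial E N θ) ∣
        ≈⟨ ∣∣-cong (begin-equality
             ν 2 ^ K * (s - ι ½ * partial E N θ)
               ≈⟨ solve 3 (λ p s e → p :* (s :- con ½ :* e) := p :* s :- con ½ :* (p :* e)) ≈-refl (ν 2 ^ K) s
                 (partial E N θ) ⟩
             ν 2 ^ K * s - ι ½ * (ν 2 ^ K * partial E N θ)
               ≈⟨ +-congˡ (-‿cong (*-congˡ (M-partial euler K N r*n<K θ))) ⟨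
             ν 2 ^ K * s - ι ½ * (ν 2 * T)
               -- Inserting `M K (φ θ)` splits the error into the limit of the differenced series,
               -- bounded by `Δ^-φ-summable`, and the effect of replacing φ by its Taylor polynomial
               -- inside M.
               ≈⟨ solve 3 (λ p m t → p :- con ½ :* (con (fromℕℚ 2) :* t) := (p :- m) :+ (m :- t)) ≈-refl
                 (ν 2 ^ K * s) (M K (φ θ)) T ⟩
             (ν 2 ^ K * s - M K (φ θ)) + (M K (φ θ) - T) ∎) ⟩
      ∣ (ν 2 ^ K * s - M K (φ θ)) + (M K (φ θ) - T) ∣
        ≤⟨ ∣x+y∣≤∣x∣+∣y∣ _ _ ⟩
      ∣ ν 2 ^ K * s - M K (φ θ) ∣ + ∣ M K (φ θ) - T ∣
        ≤⟨ +-mono-≤ (⟶-bound (S-Δ^-⟶ lim K) (∣Σᴿ∣≤C (C₀ * (C₁ * t)) _ (*-nonNeg 0≤C₀ (*-nonNeg 0≤C₁ 0≤t)) (λ n → begin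
                       ∣ c n * Δ^ K (φ θ) n ∣   ≈⟨ ∣x*y∣≈∣x∣*∣y∣ _ _ ⟩
                       ∣ c n ∣ * ∣ Δ^ K (φ θ) n ∣        ≤⟨ *-mono 0≤C₀ (0≤∣x∣ _) (∣c∣≤C₀ n) (h₁ θ 0≤θ θ≤1 n) ⟩
                       C₀ * ((C₁ * t) * harm² n)   ≈⟨ *-assoc _ _ _ ⟨
                       (C₀ * (C₁ * t)) * harm² n   ∎)))
                    (≤-trans (h₂ θ 0≤θ θ≤1) (*-monoʳ 0≤t (x≤∣x∣ C₂))) ⟩
      C₀ * (C₁ * t) + ∣ C₂ ∣ * t
        ≈⟨ solve 4 (λ a b d t → a :* (b :* t) :+ d :* t := (a :* b :+ d) :* t) ≈-refl C₀ C₁ (∣ C₂ ∣) t ⟩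
      (C₀ * C₁ + ∣ C₂ ∣) * t ∎
      where
      open ≤R
      K : ℕ
      K = 2 ℕ.+ suc N ℕ.* r
      r*n<K : ∀ n → n ℕ.≤ N → r ℕ.* n ℕ.< K
      r*n<K n n≤N = s≤s (ℕ.≤-trans (ℕ.≤-reflexive (ℕ.*-comm r n))
        (ℕ.≤-trans (ℕ.*-monoˡ-≤ r (ℕ.m≤n⇒m≤1+n n≤N)) (ℕ.n≤1+n (suc N ℕ.* r))))

-- Passage to real and imaginary parts

*ᶜ-re : ∀ a b c d → d ≈ ι 0ℚ → a * c + - (b * d) ≈ a * c
*ᶜ-re a b c d h = ≈-trans (+-congˡ (-‿cong (*-congˡ h)))
  (solve 3 (λ a b c → a :* c :- b :* con 0ℚ := a :* c) ≈-refl a b c)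

*ᶜ-im : ∀ a b c d → d ≈ ι 0ℚ → a * d + b * c ≈ b * c
*ᶜ-im a b c d h = ≈-trans (+-congʳ (*-congˡ h)) (solve 3 (λ a b c → a :* con 0ℚ :+ b :* c := b :* c) ≈-refl a b c)

data Component : Set where
  real imaginary : Component

part : Component → ℂ → ℝ
part real      = re
part imaginary = im

opaque
  unfolding _+_

  ∣∣≤ι : ∀ x {q} → Eventually (λ n → ℚ.∣ seq x n ∣ ℚ.≤ q) → ∣ x ∣ ≤ ι q
  ∣∣≤ι x h = eventually⇒≤ h

opaque
  unfolding _+_

  re-+ : ∀ z w → re (z +ᶜ w) ≈ re z + re w
  re-+ z w = pointwise⇒≈ λ _ → refl

  im-+ : ∀ z w → im (z +ᶜ w) ≈ im z + im w
  im-+ z w = pointwise⇒≈ λ _ → refl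

  re-sub : ∀ z w → re (z -ᶜ w) ≈ re z + - re w
  re-sub z w = pointwise⇒≈ λ _ → refl

  im-sub : ∀ z w → im (z -ᶜ w) ≈ im z + - im w
  im-sub z w = pointwise⇒≈ λ _ → refl

  re-· : ∀ a z → re (a ·ᶜ z) ≈ a * re z
  re-· a z = pointwise⇒≈ λ _ → refl

  im-· : ∀ a z → im (a ·ᶜ z) ≈ a * im z
  im-· a z = pointwise⇒≈ λ _ → refl

  re-* : ∀ z w → re (z *ᶜ w) ≈ re z * re w + - (im z * im w)
  re-* z w = pointwise⇒≈ λ _ → refl

  im-* : ∀ z w → im (z *ᶜ w) ≈ re z * im w + im z * re w
  im-* z w = pointwise⇒≈ λ _ → refl

  fromℚ≈ι : ∀ q → fromℚ q ≈ ι q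
  fromℚ≈ι q = pointwise⇒≈ λ _ → refl

part-+ : ∀ p z w → part p (z +ᶜ w) ≈ part p z + part p w
part-+ real      = re-+
part-+ imaginary = im-+

part-sub : ∀ p z w → part p (z -ᶜ w) ≈ part p z + - part p w
part-sub real      = re-sub
part-sub imaginary = im-sub

part-· : ∀ p a z → part p (a ·ᶜ z) ≈ a * part p z
part-· real      = re-·
part-· imaginary = im-·

part-* : ∀ p z w → im w ≈ ι 0ℚ → part p (z *ᶜ w) ≈ part p z * re w
part-* real      z w h = ≈-trans (re-* z w) (*ᶜ-re (re z) (im z) (re w) (im w) h)
part-* imaginary z w h = ≈-trans (im-* z w) (*ᶜ-im (re z) (im z) (re w) (im w) h)

part-0 : ∀ p → part p 0ᶜ ≈ ι 0ℚ
part-0 real      = fromℚ≈ι 0ℚ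
part-0 imaginary = fromℚ≈ι 0ℚ

∣z∣≤⇒∣part∣≤ : ∀ p z ε → 0ℚ ℚ.< ε → ∣ z ∣≤ fromℚ ε → ∣ part p z ∣ ≤ ι (ε ℚ.+ ε)
∣z∣≤⇒∣part∣≤ p z ε 0<ε (_ , h) = bound p (h (ε ℚ.* ε) (0<* 0<ε 0<ε))
  where
  Hyp = Eventually (λ n → seq (re z) n ℚ.* seq (re z) n ℚ.+ seq (im z) n ℚ.* seq (im z) n ℚ.≤ ε ℚ.* ε ℚ.+ ε ℚ.* ε)
  bound : ∀ p → Hyp → ∣ part p z ∣ ≤ ι (ε ℚ.+ ε)
  bound real      h = ∣∣≤ι (re z) (eventually-map (λ n → component-bound (seq (re z) n) (seq (im z) n) ε 0<ε) h)
  bound imaginary h = ∣∣≤ι (im z) (eventually-map (λ n le → component-bound (seq (im z) n) (seq (re z) n) ε 0<ε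
    (subst (ℚ._≤ ε ℚ.* ε ℚ.+ ε ℚ.* ε) (ℚ.+-comm (seq (re z) n ℚ.* seq (re z) n) (seq (im z) n ℚ.* seq (im z) n)) le)) h)

opaque
  unfolding _+_

  ^ᴿ≈^ : ∀ x n → x ^ᴿ n ≈ x ^ n
  ^ᴿ≈^ x n = pointwise⇒≈ (equal n)
    where
    equal : ∀ n i → seq (x ^ᴿ n) i ≡ seq (x ^ n) i
    equal zero    i = refl
    equal (suc n) i = cong (seq x i ℚ.*_) (equal n i)

  +ᴿ≈+ : ∀ x y → x +ᴿ y ≈ x + y
  +ᴿ≈+ x y = pointwise⇒≈ λ _ → refl

  *ᴿ≈* : ∀ x y → x *ᴿ y ≈ x * y
  *ᴿ≈* x y = pointwise⇒≈ λ _ → refl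

  -ᴿ≈- : ∀ x → -ᴿ x ≈ - x
  -ᴿ≈- x = pointwise⇒≈ λ _ → refl

  squares-pointwise : ∀ z → ∣ z ∣² ≈ re z * re z + im z * im z
  squares-pointwise z = pointwise⇒≈ λ _ → refl

  <ᴿ⇒≤ : ∀ {x y} → x <ᴿ y → x ≤ y
  <ᴿ⇒≤ {x} (ε , 0<ε , h) = eventually⇒≤ (eventually-map (λ n → ℚ.≤-trans
    (ℚ.≤-trans (ℚ.≤-reflexive (sym (ℚ.+-identityʳ (seq x n)))) (ℚ.+-monoʳ-≤ (seq x n) (ℚ.<⇒≤ 0<ε)))) h)

  0<ᴿ⇒ι≤ : ∀ {θ} → fromℚ 0ℚ <ᴿ θ → ∃[ ε ] 0ℚ ℚ.< ε × ι ε ≤ θ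
  0<ᴿ⇒ι≤ (ε , 0<ε , h) = ε , 0<ε , eventually⇒≤
    (eventually-map (λ n → ℚ.≤-trans (ℚ.≤-reflexive (sym (ℚ.+-identityˡ ε)))) h)

opaque
  unfolding _≈_

  ≈ᴿ⇒≈ : ∀ {x y} → x ≈ᴿ y → x ≈ y
  ≈ᴿ⇒≈ h = h

  ≈⇒≈ᴿ : ∀ {x y} → x ≈ y → x ≈ᴿ y
  ≈⇒≈ᴿ h = h

  ≤ᴿ⇒≤ : ∀ {x y} → x ≤ᴿ y → x ≤ y
  ≤ᴿ⇒≤ h = h

  ≤⇒≤ᴿ : ∀ {x y} → x ≤ y → x ≤ᴿ y
  ≤⇒≤ᴿ h = h

squares⇒∣∣≤ : ∀ {z B} → ι 0ℚ ≤ B → re z * re z + im z * im z ≤ B * B → ∣ z ∣≤ B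
squares⇒∣∣≤ {z} {B} h k = ≤⇒≤ᴿ (≤-respˡ (≈-sym (fromℚ≈ι 0ℚ)) h)
  , ≤⇒≤ᴿ (≤-respˡ (≈-sym (squares-pointwise z)) (≤-respʳ (≈-sym (*ᴿ≈* B B)) k))

opaque
  unfolding expᴿ

  re-exp : ∀ z → (∀ i → seq (im z) i ≡ 0ℚ) → re (exp z) ≈ expᴿ (re z)
  re-exp z h = pointwise⇒≈ λ n → trans (proj₁ (exp-real z n (h n))) (sym (seq-expᴿ (re z) n))

  im-exp : ∀ z → (∀ i → seq (im z) i ≡ 0ℚ) → im (exp z) ≈ fromℚ 0ℚ
  im-exp z h = pointwise⇒≈ λ n → proj₂ (exp-real z n (h n))

im-exp≈0 : ∀ z → (∀ i → seq (im z) i ≡ 0ℚ) → im (exp z) ≈ ι 0ℚ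
im-exp≈0 z h = ≈-trans (im-exp z h) (fromℚ≈ι 0ℚ)

-- The inequality B₁² + B₂² ≤ (B₁+B₂)² stands in for the square root, at the price of adding the two
-- constants.
parts⇒∣z∣≤ : ∀ {z B₁ B₂ B} → ι 0ℚ ≤ B₁ → ι 0ℚ ≤ B₂ → B₁ + B₂ ≤ B → ∣ re z ∣ ≤ B₁ → ∣ im z ∣ ≤ B₂ → ∣ z ∣≤ B
parts⇒∣z∣≤ {z} {B₁} {B₂} {B} 0≤B₁ 0≤B₂ B₁+B₂≤B h₁ h₂ = squares⇒∣∣≤ 0≤B (begin
  re z * re z + im z * im z   ≈⟨ +-cong (x*x≈∣x∣*∣x∣ (re z)) (x*x≈∣x∣*∣x∣ (im z)) ⟩
  ∣ re z ∣ * ∣ re z ∣ + ∣ im z ∣ * ∣ im z ∣     ≤⟨ +-mono-≤ (*-mono 0≤B₁ (0≤∣x∣ _) h₁ h₁)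
    (*-mono 0≤B₂ (0≤∣x∣ _) h₂ h₂) ⟩
  B₁ * B₁ + B₂ * B₂   ≤⟨ x≤x+y (*-nonNeg (0≤ν 2) (*-nonNeg 0≤B₁ 0≤B₂)) ⟩
  (B₁ * B₁ + B₂ * B₂) + ν 2 * (B₁ * B₂)   ≈⟨ solve 2
    (λ a b → (a :* a :+ b :* b) :+ con (fromℕℚ 2) :* (a :* b) := (a :+ b) :* (a :+ b)) ≈-refl B₁ B₂ ⟩
  (B₁ + B₂) * (B₁ + B₂)   ≤⟨ *-mono 0≤B (+-nonNeg 0≤B₁ 0≤B₂) B₁+B₂≤B B₁+B₂≤B ⟩
  B * B   ∎)
  where
  open ≤R
  0≤B = ≤-trans (+-nonNeg 0≤B₁ 0≤B₂) B₁+B₂≤B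

≈ᶜ-refl : ∀ z → z ≈ᶜ z
≈ᶜ-refl z = ≈⇒≈ᴿ {re z} {re z} ≈-refl , ≈⇒≈ᴿ {im z} {im z} ≈-refl

part-cong : ∀ p {z w} → z ≈ᶜ w → part p z ≈ part p w
part-cong real      (h , _) = ≈ᴿ⇒≈ h
part-cong imaginary (_ , h) = ≈ᴿ⇒≈ h

part-Σᶜ : ∀ p n a → part p (Σᶜ n a) ≈ Σᴿ n (λ k → part p (a k))
part-Σᶜ p zero    a = part-0 p
part-Σᶜ p (suc n) a = ≈-trans (part-+ p (Σᶜ n a) (a n)) (+-congʳ (part-Σᶜ p n a))

part-Σᶜ-sub : ∀ p n a s → part p (Σᶜ n a -ᶜ s) ≈ Σᴿ n (λ k → part p (a k)) - part p s
part-Σᶜ-sub p n a s = ≈-trans (part-sub p (Σᶜ n a) s) (+-congʳ (part-Σᶜ p n a))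

HasSum⇒⟶ : ∀ p {a s} → HasSum a s → (λ n → Σᴿ n (λ k → part p (a k))) ⟶ part p s
HasSum⇒⟶ p {a} {s} sum ε 0<ε = eventually-map
  (λ n h → ≤-respˡ (∣∣-cong (part-Σᶜ-sub p n a s))
    (subst (λ q → ∣ part p (Σᶜ n a -ᶜ s) ∣ ≤ ι q) (half+half ε)
      (∣z∣≤⇒∣part∣≤ p (Σᶜ n a -ᶜ s) (½ ℚ.* ε) (0<half 0<ε) h)))
  (sum (½ ℚ.* ε) (0<half 0<ε))

⟶⇒HasSum : ∀ {a s} → (∀ p → (λ n → Σᴿ n (λ k → part p (a k))) ⟶ part p s) → HasSum a s
⟶⇒HasSum {a} {s} h ε 0<ε = eventually-map₂
  (λ n h k → parts⇒∣z∣≤ 0≤½ε 0≤½ε (≈⇒≤ sum) (≤-respˡ (∣∣-cong (≈-sym (part-Σᶜ-sub real n a s))) h)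
                                             (≤-respˡ (∣∣-cong (≈-sym (part-Σᶜ-sub imaginary n a s))) k))
  (h real (½ ℚ.* ε) (0<half 0<ε)) (h imaginary (½ ℚ.* ε) (0<half 0<ε))
  where
  0≤½ε = ι-mono (ℚ.<⇒≤ (0<half 0<ε))
  sum : ι (½ ℚ.* ε) + ι (½ ℚ.* ε) ≈ fromℚ ε
  sum = ≈-trans (≈-sym (ι-+ _ _)) (subst (λ q → ι q ≈ fromℚ ε) (sym (half+half ε)) (≈-sym (fromℚ≈ι ε)))

-- The coefficients (-1)ⁿ χ(n)

-1^ : ∀ n → [-1]^ n ≈ (- ν 1) ^ n
-1^ n = ≈-trans (^ᴿ≈^ (-ᴿ fromℕ 1) n) (^-congˡ n (≈-trans (-ᴿ≈- (fromℕ 1)) (-‿cong (fromℚ≈ι (fromℕℚ 1)))))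

-1^odd : ∀ n → 2 ∤ n → (- ν 1) ^ n ≈ - ι 1ℚ
-1^odd n 2∤n = Sum.[ (λ 2∣n → contradiction 2∣n 2∤n) , id ] (parity n)
  where
  parity : ∀ n → (2 ∣ n) ⊎ ((- ν 1) ^ n ≈ - ι 1ℚ)
  parity zero          = inj₁ (divides 0 refl)
  parity (suc zero)    = inj₂ (solve 0 ((:- con (fromℕℚ 1)) :* con 1ℚ := :- con 1ℚ) ≈-refl)
  parity (suc (suc n)) = Sum.map (∣m∣n⇒∣m+n (divides 1 refl))
    (≈-trans (solve 1 (λ p → (:- con (fromℕℚ 1)) :* ((:- con (fromℕℚ 1)) :* p) := p) ≈-refl ((- ν 1) ^ n))) (parity n)

opaque
  unfolding _+_

  /ᴿ≈ : ∀ b r .{{_ : ℕ.NonZero r}} → b /ᴿ r ≈ b * ι (+ 1 / r)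
  /ᴿ≈ b r = pointwise⇒≈ λ _ → refl

/-inverse : ∀ r .{{_ : ℕ.NonZero r}} → ν r * ι (+ 1 / r) ≈ ι 1ℚ
/-inverse r = ≈-trans (≈-sym (ι-* (fromℕℚ r) (+ 1 / r)))
  (subst (λ q → ι q ≈ ι 1ℚ) (sym (trans (fromℕℚ-*-/ r 1 r)
    (/-≡ (r ℕ.* 1) r 1 1 (trans (ℕ.*-identityʳ (r ℕ.* 1)) (ℕ.*-comm r 1))))) ≈-refl)

-- All terms of the series are positive and the first one is 8/3; only the empty sum at n = 0 has to
-- be excluded.
2≤π : ∀ n → 1 ℕ.≤ n → fromℕℚ 2 ℚ.≤ seq π n
2≤π n 1≤n = ℚ.≤-trans (/-≤ 2 1 8 3 (ℕ.m≤m+n 6 2)) (ℚ.≤-trans (ℚ.≤-reflexive (sym (ℚ.+-identityˡ (π-term 0))))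
  (subst (λ n → Σℚ 1 π-term ℚ.≤ Σℚ n π-term) (ℕ.m∸n+n≡m 1≤n)
    (Σℚ-mono-length 1 (n ℕ.∸ 1) λ k → 0≤/ 8 (suc (4 ℕ.* k) ℕ.* suc (2 ℕ.+ 4 ℕ.* k)))))

-- Since π ≥ 2 the radius is at least 2δ. This leaves the margins δ and δ² that witness the two
-- strict inequalities: t² + δ² ≤ 2δ² ≤ 4δ².
∣t∣<πδ : ∀ δ t → 0ℚ ℚ.< δ → 0ℚ ℚ.< t → t ℚ.≤ δ → ∣ ofℝ (fromℚ t) ∣< (π *ᴿ fromℚ δ)
∣t∣<πδ δ t 0<δ 0<t t≤δ = (δ , 0<δ , 1 , λ n 1≤n → ℚ.≤-trans (ℚ.≤-reflexive (ℚ.+-identityˡ δ))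
    (ℚ.≤-trans (ℚ.≤-trans (ℚ.≤-reflexive (sym (ℚ.+-identityʳ δ))) (ℚ.+-monoʳ-≤ δ 0≤δ)) (2δ≤πδ n 1≤n)))
  , (δ ℚ.* δ , 0<* 0<δ 0<δ , 1 , λ n 1≤n → begin
      (t ℚ.* t ℚ.+ 0ℚ ℚ.* 0ℚ) ℚ.+ δ ℚ.* δ      ≡⟨ cong (ℚ._+ δ ℚ.* δ) (ℚ.+-identityʳ (t ℚ.* t)) ⟩
      t ℚ.* t ℚ.+ δ ℚ.* δ   ≤⟨ ℚ.+-monoˡ-≤ (δ ℚ.* δ) (*-mono-≤ 0≤t 0≤t t≤δ t≤δ) ⟩
      δ ℚ.* δ ℚ.+ δ ℚ.* δ   ≡⟨ ℚ.+-identityʳ _ ⟨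
      (δ ℚ.* δ ℚ.+ δ ℚ.* δ) ℚ.+ 0ℚ   ≤⟨ ℚ.+-monoʳ-≤ (δ ℚ.* δ ℚ.+ δ ℚ.* δ) (0≤+ (0≤p*p δ) (0≤p*p δ)) ⟩
      (δ ℚ.* δ ℚ.+ δ ℚ.* δ) ℚ.+ (δ ℚ.* δ ℚ.+ δ ℚ.* δ)
        ≡⟨ [2e]²≡ δ ⟩
      (δ ℚ.+ δ) ℚ.* (δ ℚ.+ δ)   ≤⟨ *-mono-≤ (0≤+ 0≤δ 0≤δ) (0≤+ 0≤δ 0≤δ) (2δ≤πδ n 1≤n) (2δ≤πδ n 1≤n) ⟩
      (seq π n ℚ.* δ) ℚ.* (seq π n ℚ.* δ)      ∎)
  where
  open ℚ.≤-Reasoning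
  0≤δ = ℚ.<⇒≤ 0<δ
  0≤t = ℚ.<⇒≤ 0<t
  2δ≤πδ : ∀ n → 1 ℕ.≤ n → δ ℚ.+ δ ℚ.≤ seq π n ℚ.* δ
  2δ≤πδ n 1≤n = ℚ.≤-trans (ℚ.≤-reflexive (p+p≡2*p δ))
    (*-mono-≤ (0≤fromℕℚ 2) 0≤δ (2≤π n 1≤n) ℚ.≤-refl)

re-*-real : ∀ z a → re (z *ᶜ ofℝ a) ≈ re z * a
re-*-real z a = ≈-trans (re-* z (ofℝ a)) (*ᶜ-re (re z) (im z) a (fromℚ 0ℚ) (fromℚ≈ι 0ℚ))

-- Taking the Euler polynomials of the conjugate character conjugates twice in the generating
-- function, so its coefficients are those of χ, as in the series for G.
part-conjugate² : ∀ p χ m → part p (conjugate (conjugate χ) m) ≈ part p (χ m)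
part-conjugate² real      χ m = pointwise⇒≈ λ _ → refl
part-conjugate² imaginary χ m = pointwise⇒≈ λ n → neg-involutive (seq (im (χ m)) n)

power-real : ∀ q n → re (ofℝ (fromℚ q) ^ᶜ n) ≈ ι q ^ n × im (ofℝ (fromℚ q) ^ᶜ n) ≈ ι 0ℚ
power-real q n =
    ≈-trans (pointwise⇒≈ λ i → trans (proj₁ (^ᶜ-real (ofℝ (fromℚ q)) i refl n)) (sym (seq-^ (fromℚ q) n i)))
      (^-congˡ n (fromℚ≈ι q))
  , ≈-trans (pointwise⇒≈ {y = fromℚ 0ℚ} λ i → proj₂ (^ᶜ-real (ofℝ (fromℚ q)) i refl n)) (fromℚ≈ι 0ℚ)

-- The complex data reduced to one component

module Character (f : ℕ) .{{_ : ℕ.NonZero f}} (2∤f : 2 ∤ f) (χ : ℤ → ℂ) (χ-periodic : ∀ m → χ (m ℤ.+ + f) ≈ᶜ χ m)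
                 (x : ℝ) (0≤x : ι 0ℚ ≤ x) (x≤1 : x ≤ ι 1ℚ) (p : Component) where

  c : ℕ → ℝ
  c n = (- ν 1) ^ n * part p (χ (+ n))

  c-antiperiodic : ∀ n → c (n ℕ.+ f) ≈ - c n
  c-antiperiodic n = begin-equality
    (- ν 1) ^ (n ℕ.+ f) * part p (χ (+ (n ℕ.+ f)))
      ≈⟨ *-cong (≈-trans (^-homo-* (- ν 1) n f) (*-congˡ (-1^odd f 2∤f))) (part-cong p (χ-periodic (+ n))) ⟩
    (- ν 1) ^ n * - ι 1ℚ * part p (χ (+ n))
      ≈⟨ solve 2 (λ u v → u :* (:- con 1ℚ) :* v := :- (u :* v)) ≈-refl ((- ν 1) ^ n) (part p (χ (+ n))) ⟩
    - c n ∎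
    where open ≤R

  open Expansion f c c-antiperiodic x 0≤x x≤1 using (IsEulerSequence)
  open Monomials f x 0≤x x≤1 using (y)
  open Summation f c c-antiperiodic using (A)

  term-part : ∀ n {w v} → w ≈ v → part p ([-1]^ n ·ᶜ (χ (+ n) *ᶜ exp (ofℝ w))) ≈ c n * expᴿ v
  term-part n {w} {v} w≈v = begin-equality
    part p ([-1]^ n ·ᶜ (χ (+ n) *ᶜ exp (ofℝ w)))   ≈⟨ part-· p ([-1]^ n) (χ (+ n) *ᶜ exp (ofℝ w)) ⟩
    [-1]^ n * part p (χ (+ n) *ᶜ exp (ofℝ w))   ≈⟨ *-cong (-1^ n)
      (part-* p (χ (+ n)) (exp (ofℝ w)) (im-exp≈0 (ofℝ w) λ _ → refl)) ⟩
    (- ν 1) ^ n * (part p (χ (+ n)) * re (exp (ofℝ w)))  ≈⟨ *-assoc _ _ _ ⟨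
    c n * re (exp (ofℝ w))   ≈⟨ *-congˡ
      (≈-trans (re-exp (ofℝ w) λ _ → refl) (expᴿ-cong w≈v)) ⟩
    c n * expᴿ v   ∎
    where open ≤R

  exponent : ∀ r θ n → -ᴿ ((fromℕ n +ᴿ x) ^ᴿ r *ᴿ θ) ≈ - (θ * y n ^ r)
  exponent r θ n = ≈-trans (-ᴿ≈- ((fromℕ n +ᴿ x) ^ᴿ r *ᴿ θ)) (-‿cong (≈-trans (*ᴿ≈* ((fromℕ n +ᴿ x) ^ᴿ r) θ)
    (≈-trans (*-comm ((fromℕ n +ᴿ x) ^ᴿ r) θ) (*-congˡ (≈-trans (^ᴿ≈^ (fromℕ n +ᴿ x) r)
      (^-congˡ r (≈-trans (+ᴿ≈+ (fromℕ n) x) (+-congʳ (fromℚ≈ι (fromℕℚ n))))))))))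

  series-term : ∀ r θ n → part p ([-1]^ n ·ᶜ (χ (+ n) *ᶜ exp (ofℝ (-ᴿ ((fromℕ n +ᴿ x) ^ᴿ r *ᴿ θ))))) ≈ c n * expᴿ
    (- (θ * y n ^ r))
  series-term r θ n = term-part n {w = -ᴿ ((fromℕ n +ᴿ x) ^ᴿ r *ᴿ θ)} (exponent r θ n)

  product-part : ∀ z a w {a′ w′} → a ≈ a′ → re w ≈ w′ × im w ≈ ι 0ℚ → part p (z *ᶜ (a ·ᶜ w)) ≈ part p z * (a′ * w′)
  product-part z a w a≈ (re-w , im-w) = ≈-trans
    (part-* p z (a ·ᶜ w) (≈-trans (im-· a w) (≈-trans (*-congˡ im-w) (zeroʳ a))))
    (*-congˡ (≈-trans (re-· a w) (*-cong a≈ re-w)))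

  left-part : ∀ s z {w} → (∀ i → seq (im z) i ≡ 0ℚ) → re z ≈ w → part p (s *ᶜ (exp z +ᶜ 1ᶜ)) ≈ part p s *
    (expᴿ w + ι 1ℚ)
  left-part s z im-z re-z = ≈-trans
    (part-* p s (exp z +ᶜ 1ᶜ) (≈-trans (im-+ (exp z) 1ᶜ)
      (≈-trans (+-cong (im-exp≈0 z im-z) (fromℚ≈ι 0ℚ)) (+-identityˡ (ι 0ℚ)))))
    (*-congˡ (≈-trans (re-+ (exp z) 1ᶜ) (+-cong (≈-trans (re-exp z im-z) (expᴿ-cong re-z)) (fromℚ≈ι 1ℚ))))

  right-part : ∀ m z {w} → (∀ i → seq (im z) i ≡ 0ℚ) → re z ≈ w →
    part p ((fromℕ 2 *ᴿ [-1]^ m) ·ᶜ (conjugate (conjugate χ) (+ m) *ᶜ exp z)) ≈ ν 2 * (c m * expᴿ w)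
  right-part m z {w} im-z re-z = begin-equality
    part p ((fromℕ 2 *ᴿ [-1]^ m) ·ᶜ (conjugate (conjugate χ) (+ m) *ᶜ exp z))
      ≈⟨ part-· p (fromℕ 2 *ᴿ [-1]^ m) (conjugate (conjugate χ) (+ m) *ᶜ exp z) ⟩
    (fromℕ 2 *ᴿ [-1]^ m) * part p (conjugate (conjugate χ) (+ m) *ᶜ exp z)
      ≈⟨ *-cong (≈-trans (*ᴿ≈* (fromℕ 2) ([-1]^ m)) (*-cong (fromℚ≈ι (fromℕℚ 2)) (-1^ m)))
        (part-* p (conjugate (conjugate χ) (+ m)) (exp z) (im-exp≈0 z im-z)) ⟩
    (ν 2 * (- ν 1) ^ m) * (part p (conjugate (conjugate χ) (+ m)) * re (exp z))
      ≈⟨ *-congˡ (*-cong (part-conjugate² p χ (+ m)) (≈-trans (re-exp z im-z) (expᴿ-cong re-z))) ⟩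
    (ν 2 * (- ν 1) ^ m) * (part p (χ (+ m)) * expᴿ w)
      ≈⟨ solve 4 (λ t u v e → (t :* u) :* (v :* e) := t :* ((u :* v) :* e)) ≈-refl (ν 2) ((- ν 1) ^ m)
        (part p (χ (+ m))) (expᴿ w) ⟩
    ν 2 * (c m * expᴿ w) ∎
    where open ≤R

  im-z : ∀ t m i → seq (im ((ofℝ (fromℕ m) +ᶜ ofℝ x) *ᶜ ofℝ (fromℚ t))) i ≡ 0ℚ
  im-z t m i = p*0+0*q≡0 (fromℕℚ m ℚ.+ seq x i) t

  re-z : ∀ t m → re ((ofℝ (fromℕ m) +ᶜ ofℝ x) *ᶜ ofℝ (fromℚ t)) ≈ y m * ι t
  re-z t m = ≈-trans (re-*-real (ofℝ (fromℕ m) +ᶜ ofℝ x) (fromℚ t))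
    (*-cong (≈-trans (re-+ (ofℝ (fromℕ m)) (ofℝ x)) (+-congʳ (fromℚ≈ι (fromℕℚ m)))) (fromℚ≈ι t))

  isEulerSequence : ∀ E → AreEulerPolynomials f (conjugate χ) E → IsEulerSequence (λ n → part p (E n (ofℝ x)))
  isEulerSequence E euler = t₀ , 0<t₀ , /-≤ 1 f 1 1 (ℕ.*-monoʳ-≤ 1 (ℕ.>-nonZero⁻¹ f)) , λ t 0<t t≤t₀ →
    let s , sum , eq = euler (ofℝ x) (ofℝ (fromℚ t)) (∣t∣<πδ t₀ t 0<t₀ 0<t t≤t₀)
    in part p s
     , ⟶-cong (λ n → Σᴿ-cong n (coefficient t)) ≈-refl (HasSum⇒⟶ p sum)
     , ≈-trans (≈-sym (left t s)) (≈-trans (part-cong p eq) (right t))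
    where
    open ≤R
    -- Inside the disc of radius π/f, and at most 1 as `IsEulerSequence` requires.
    t₀ = + 1 / f
    0<t₀ : 0ℚ ℚ.< t₀
    0<t₀ = ℚ.positive⁻¹ t₀ {{ℚ.normalize-pos 1 f}}

    coefficient : ∀ t k → part p (E k (ofℝ x) *ᶜ (fromℚ (1/! k) ·ᶜ ofℝ (fromℚ t) ^ᶜ k)) ≈ part p (E k (ofℝ x)) *
      (ι (1/! k) * ι t ^ k)
    coefficient t k = product-part (E k (ofℝ x)) (fromℚ (1/! k)) (ofℝ (fromℚ t) ^ᶜ k) (fromℚ≈ι (1/! k)) (power-real t k)

    left : ∀ t s → part p (s *ᶜ (exp (fromℕ f ·ᶜ ofℝ (fromℚ t)) +ᶜ 1ᶜ)) ≈ part p s * (expᴿ (ν f * ι t) + ι 1ℚ)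
    left t s = left-part s (fromℕ f ·ᶜ ofℝ (fromℚ t)) (λ _ → ℚ.*-zeroʳ (fromℕℚ f))
      (≈-trans (re-· (fromℕ f) (ofℝ (fromℚ t))) (*-cong (fromℚ≈ι (fromℕℚ f)) (fromℚ≈ι t)))

    right : ∀ t → part p (Σᶜ f (λ m → (fromℕ 2 *ᴿ [-1]^ m) ·ᶜ
      (conjugate (conjugate χ) (+ m) *ᶜ exp ((ofℝ (fromℕ m) +ᶜ ofℝ x) *ᶜ ofℝ (fromℚ t)))))
          ≈ ν 2 * A (λ i → expᴿ (y i * ι t))
    right t = ≈-trans (part-Σᶜ p f (λ m → (fromℕ 2 *ᴿ [-1]^ m) ·ᶜ
      (conjugate (conjugate χ) (+ m) *ᶜ exp ((ofℝ (fromℕ m) +ᶜ ofℝ x) *ᶜ ofℝ (fromℚ t)))))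
      (≈-trans (Σᴿ-cong f (λ m → right-part m ((ofℝ (fromℕ m) +ᶜ ofℝ x) *ᶜ ofℝ (fromℚ t)) (im-z t m) (re-z t m)))
               (Σᴿ-* f (ν 2) (λ m → c m * expᴿ (y m * ι t))))

  partial-term : ∀ (E : ℕ → ℂ) r θ n → part p (([-1]^ n *ᴿ fromℚ (1/! n) *ᴿ θ ^ᴿ n) ·ᶜ E (r ℕ.* n)) ≈
    (ι (1/! n) * (- θ) ^ n) * part p (E (r ℕ.* n))
  partial-term E r θ n = ≈-trans (part-· p ([-1]^ n *ᴿ fromℚ (1/! n) *ᴿ θ ^ᴿ n) (E (r ℕ.* n))) (*-congʳ (begin-equality
    [-1]^ n *ᴿ fromℚ (1/! n) *ᴿ θ ^ᴿ n       ≈⟨ ≈-trans (*ᴿ≈* ([-1]^ n *ᴿ fromℚ (1/! n)) (θ ^ᴿ n))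
      (*-cong (≈-trans (*ᴿ≈* ([-1]^ n) (fromℚ (1/! n))) (*-cong (-1^ n) (fromℚ≈ι (1/! n)))) (^ᴿ≈^ θ n)) ⟩
    ((- ν 1) ^ n * ι (1/! n)) * θ ^ n        ≈⟨ solve 3 (λ a b c → (a :* b) :* c := b :* (a :* c)) ≈-refl
      ((- ν 1) ^ n) (ι (1/! n)) (θ ^ n) ⟩
    ι (1/! n) * ((- ν 1) ^ n * θ ^ n)        ≈⟨ *-congˡ (^-distrib-* (- ν 1) θ n) ⟨
    ι (1/! n) * (- ν 1 * θ) ^ n   ≈⟨ *-congˡ
      (^-congˡ n (solve 1 (λ t → (:- con (fromℕℚ 1)) :* t := :- t) ≈-refl θ)) ⟩
    ι (1/! n) * (- θ) ^ n   ∎))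
    where open ≤R

  partial-sum : ∀ (E : ℕ → ℂ) r θ N → part p (Σᶜ N
    (λ n → ([-1]^ n *ᴿ fromℚ (1/! n) *ᴿ θ ^ᴿ n) ·ᶜ E (r ℕ.* n))) ≈ Σᴿ N
    (λ n → (ι (1/! n) * (- θ) ^ n) * part p (E (r ℕ.* n)))
  partial-sum E r θ N = ≈-trans (part-Σᶜ p N (λ n → ([-1]^ n *ᴿ fromℚ (1/! n) *ᴿ θ ^ᴿ n) ·ᶜ E (r ℕ.* n)))
    (Σᴿ-cong N (partial-term E r θ))

-- Assembly of the two components

module Asymptotics
  (f : ℕ) .{{_ : ℕ.NonZero f}} (2∤f : 2 ∤ f) (χ : ℤ → ℂ) (χ-periodic : ∀ m → χ (m ℤ.+ + f) ≈ᶜ χ m)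
  (x : ℝ) (0≤x : ι 0ℚ ≤ x) (x≤1 : x ≤ ι 1ℚ) (r : ℕ) .{{_ : ℕ.NonZero r}}
  (E : ℕ → ℂ → ℂ) (euler : AreEulerPolynomials f (conjugate χ) E)
  where

  open ≤R
  module C (p : Component) = Character f 2∤f χ χ-periodic x 0≤x x≤1 p
  module R (p : Component) = RealExpansion f (C.c p) (C.c-antiperiodic p) x 0≤x x≤1 r

  -- The witness of 0 < θ supplies the rational lower bound from which the constant for convergence
  -- is built; hence the sum takes it as an argument.
  sum : Component → (θ : ℝ) → fromℚ 0ℚ <ᴿ θ → ℝ
  sum p θ 0<θ = let ε , 0<ε , ε≤θ = 0<ᴿ⇒ι≤ 0<θ in proj₁ (R.converges p θ ε 0<ε ε≤θ)

  sum-⟶ : ∀ p θ 0<θ → (λ n → Σᴿ n (λ k → C.c p k * expᴿ (- (θ * (ν k + x) ^ r)))) ⟶ sum p θ 0<θ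
  sum-⟶ p θ 0<θ = let ε , 0<ε , ε≤θ = 0<ᴿ⇒ι≤ 0<θ in proj₂ (R.converges p θ ε 0<ε ε≤θ)

  total : ℝ⁺→ℂ
  total θ 0<θ = sum real θ 0<θ +i sum imaginary θ 0<θ

  part-total : ∀ p θ 0<θ → part p (total θ 0<θ) ≈ sum p θ 0<θ
  part-total real      θ 0<θ = ≈-refl
  part-total imaginary θ 0<θ = ≈-refl

  isG₁ : ∀ θ (0<θ : fromℚ 0ℚ <ᴿ θ) →
    ∃[ s ] HasSum (λ n → [-1]^ n ·ᶜ (χ (+ n) *ᶜ exp
      (ofℝ (-ᴿ ((fromℕ n +ᴿ x) ^ᴿ r *ᴿ θ))))) s × fromℕ r ·ᶜ total θ 0<θ ≈ᶜ fromℕ r ·ᶜ s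
  isG₁ θ 0<θ = total θ 0<θ
    , ⟶⇒HasSum (λ p → ⟶-cong (λ n → Σᴿ-cong n λ k → ≈-sym (C.series-term p r θ k)) (≈-sym (part-total p θ 0<θ))
      (sum-⟶ p θ 0<θ))
    , ≈ᶜ-refl (fromℕ r ·ᶜ total θ 0<θ)

  module _ (N : ℕ) where

    e : Component → ℕ → ℝ
    e p n = part p (E n (ofℝ x))

    C₁ : Component → ℝ
    C₁ p = proj₁ (R.expansion p (C.isEulerSequence p E euler) N)

    r/2≈ : fromℚ (+ r / 2) ≈ ν r * ι ½
    r/2≈ = ≈-trans (fromℚ≈ι (+ r / 2)) (≈-trans
      (subst (λ q → ι (+ r / 2) ≈ ι q) (trans (cong (λ n → + n / 2) (sym (ℕ.*-identityʳ r)))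
        (sym (fromℕℚ-*-/ r 1 2))) ≈-refl) (ι-* (fromℕℚ r) ½))

    part-difference : ∀ p z w {v} → part p w ≈ v →
      part p (fromℕ r ·ᶜ z -ᶜ fromℚ (+ r / 2) ·ᶜ w) ≈ ν r * (part p z - ι ½ * v)
    part-difference p z w {v} w≈v = begin-equality
      part p (fromℕ r ·ᶜ z -ᶜ fromℚ (+ r / 2) ·ᶜ w)
        ≈⟨ part-sub p (fromℕ r ·ᶜ z) (fromℚ (+ r / 2) ·ᶜ w) ⟩
      part p (fromℕ r ·ᶜ z) - part p (fromℚ (+ r / 2) ·ᶜ w)
        ≈⟨ +-cong (≈-trans (part-· p (fromℕ r) z) (*-congʳ (fromℚ≈ι (fromℕℚ r))))
             (-‿cong (≈-trans (part-· p (fromℚ (+ r / 2)) w) (*-cong r/2≈ w≈v))) ⟩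
      ν r * part p z - (ν r * ι ½) * v
        ≈⟨ solve 4 (λ r s h q → r :* s :- (r :* h) :* q := r :* (s :- h :* q)) ≈-refl (ν r) (part p z) (ι ½) v ⟩
      ν r * (part p z - ι ½ * v) ∎

    part-error : ∀ p θ 0<θ → part p (fromℕ r ·ᶜ total θ 0<θ -ᶜ fromℚ (+ r / 2) ·ᶜ Σᶜ (suc N)
      (λ n → ([-1]^ n *ᴿ fromℚ (1/! n) *ᴿ θ ^ᴿ n) ·ᶜ E (r ℕ.* n) (ofℝ x))) ≈ ν r *
      (sum p θ 0<θ - ι ½ * R.partial p (e p) N θ)
    part-error p θ 0<θ = ≈-trans
      (part-difference p (total θ 0<θ) (Σᶜ (suc N) (λ n → ([-1]^ n *ᴿ fromℚ (1/! n) *ᴿ θ ^ᴿ n) ·ᶜ E (r ℕ.* n) (ofℝ x)))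
        (C.partial-sum p (λ n → E n (ofℝ x)) r θ (suc N)))
      (*-congˡ (+-congʳ (part-total p θ 0<θ)))

    bound : ∀ p θ 0<θ → θ <ᴿ fromℚ 1ℚ → ∣ part p
      (fromℕ r ·ᶜ total θ 0<θ -ᶜ fromℚ (+ r / 2) ·ᶜ Σᶜ (suc N)
      (λ n → ([-1]^ n *ᴿ fromℚ (1/! n) *ᴿ θ ^ᴿ n) ·ᶜ E (r ℕ.* n) (ofℝ x))) ∣ ≤ (ν r * C₁ p) * θ ^ suc N
    bound p θ 0<θ θ<1 = begin
      ∣ part p (fromℕ r ·ᶜ total θ 0<θ -ᶜ fromℚ (+ r / 2) ·ᶜ Σᶜ (suc N)
        (λ n → ([-1]^ n *ᴿ fromℚ (1/! n) *ᴿ θ ^ᴿ n) ·ᶜ E (r ℕ.* n) (ofℝ x))) ∣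
        ≈⟨ ≈-trans (∣∣-cong (part-error p θ 0<θ)) (∣x*y∣≈x*∣y∣ (0≤ν r)) ⟩
      ν r * ∣ sum p θ 0<θ - ι ½ * R.partial p (e p) N θ ∣
        ≤⟨ *-monoˡ (0≤ν r) (proj₂ (proj₂ (R.expansion p (C.isEulerSequence p E euler) N)) θ
             (≤-respˡ (fromℚ≈ι 0ℚ) (<ᴿ⇒≤ 0<θ)) (≤-respʳ (fromℚ≈ι 1ℚ) (<ᴿ⇒≤ θ<1)) (sum p θ 0<θ) (sum-⟶ p θ 0<θ)) ⟩
      ν r * (C₁ p * θ ^ suc N)
        ≈⟨ *-assoc _ _ _ ⟨
      (ν r * C₁ p) * θ ^ suc N ∎

    bigO : (λ θ 0<θ → fromℕ r ·ᶜ total θ 0<θ -ᶜ fromℚ (+ r / 2) ·ᶜ Σᶜ (suc N)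
      (λ n → ([-1]^ n *ᴿ fromℚ (1/! n) *ᴿ θ ^ᴿ n) ·ᶜ E (r ℕ.* n) (ofℝ x))) =O[θ^ suc N ]
    -- The threshold 1 is the range in which `expansion` is uniform; the constant adds those of the
    -- two components, as `parts⇒∣z∣≤` needs.
    bigO = ν r * C₁ real + ν r * C₁ imaginary , fromℚ 1ℚ
      , (1ℚ , 0<1 , 0 , λ n _ → ℚ.≤-reflexive (ℚ.+-identityˡ 1ℚ))
      , λ θ 0<θ θ<1 → parts⇒∣z∣≤ (0≤C*θ real θ 0<θ) (0≤C*θ imaginary θ 0<θ)
          (≈⇒≤ (≈-trans (≈-sym (distribʳ (θ ^ suc N) _ _))
            (≈-sym (≈-trans (*ᴿ≈* (ν r * C₁ real + ν r * C₁ imaginary) (θ ^ᴿ suc N)) (*-congˡ (^ᴿ≈^ θ (suc N)))))))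
          (bound real θ 0<θ θ<1) (bound imaginary θ 0<θ θ<1)
      where
      0≤C*θ : ∀ p θ → fromℚ 0ℚ <ᴿ θ → ι 0ℚ ≤ (ν r * C₁ p) * θ ^ suc N
      0≤C*θ p θ 0<θ = *-nonNeg (*-nonNeg (0≤ν r) (proj₁ (proj₂ (R.expansion p (C.isEulerSequence p E euler) N))))
        (^-nonNeg (≤-respˡ (fromℚ≈ι 0ℚ) (<ᴿ⇒≤ 0<θ)) (suc N))

0≤b/r : ∀ r .{{_ : ℕ.NonZero r}} {b} → fromℚ 0ℚ ≤ᴿ b → ι 0ℚ ≤ b /ᴿ r
0≤b/r r {{r≢0}} {b} 0≤b = ≤-respʳ (≈-sym (/ᴿ≈ b r {{r≢0}}))
  (*-nonNeg (≤-respˡ (fromℚ≈ι 0ℚ) (≤ᴿ⇒≤ {fromℚ 0ℚ} {b} 0≤b)) (ι-mono (0≤/ 1 r)))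

b/r≤1 : ∀ r .{{_ : ℕ.NonZero r}} {b} → b <ᴿ fromℕ r → b /ᴿ r ≤ ι 1ℚ
b/r≤1 r {{r≢0}} {b} b<r = ≤-respˡ (≈-sym (/ᴿ≈ b r {{r≢0}}))
  (≤-respʳ (/-inverse r) (*-monoʳ (ι-mono (0≤/ 1 r)) (≤-respʳ (fromℚ≈ι (fromℕℚ r)) (<ᴿ⇒≤ {b} {fromℕ r} b<r))))

theorem1p2 : (f : ℕ) .{{_ : NonZero f}} → 2 ∤ f →
    (χ : ℤ → ℂ) → IsPrimitive f χ → ¬ IsPrincipal χ →
    (r : ℕ) .{{_ : NonZero r}} →
    (b : ℝ) → fromℚ 0ℚ ≤ᴿ b → b <ᴿ fromℕ r →
    (E : ℕ → ℂ → ℂ) → AreEulerPolynomials f (conjugate χ) E →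
    ∃[ G ] IsG₁ χ b r G ×
    (∀ (N : ℕ) →
    (λ θ 0<θ → G θ 0<θ -ᶜ
    fromℚ (+ r / 2) ·ᶜ
    Σᶜ (suc N) (λ n → ([-1]^ n *ᴿ fromℚ (1/! n) *ᴿ θ ^ᴿ n) ·ᶜ E (r ℕ.* n) (ofℝ (b /ᴿ r))))
    =O[θ^ suc N ])
theorem1p2 f {{f≢0}} 2∤f χ χ-prim _ r {{r≢0}} b 0≤b b<r E euler =
  (λ θ 0<θ → fromℕ r ·ᶜ total θ 0<θ) , isG₁ , bigO
  where
  open Asymptotics f {{f≢0}} 2∤f χ (IsDirichletCharacter.periodic (IsPrimitive.isCharacter χ-prim))
         ((b /ᴿ r) {{r≢0}}) (0≤b/r r {{r≢0}} {b} 0≤b) (b/r≤1 r {{r≢0}} {b} b<r) r {{r≢0}} E euler
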